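{- Let $p<q$ be square-free integers $\ge 2$ with $p\equiv 2$ or $3\pmod 4$ and $q\equiv 1\pmod 4$, put $r=pq/\gcd(p,q)^2$ and assume $p<q<r$. Let $K=\mathbb{Q}(\sqrt p,\sqrt q)$. Let $m,\kappa,t$ be positive integers. Let $$I_2=\left[\frac{m\kappa}{4t}+\frac{\sqrt m}{\sqrt{2t}},\ \frac{m\kappa}{4(t-1)}-\frac{\sqrt m}{\sqrt{2(t-1)}}\right]\quad(t>1),$$ $$I_3=\left[\frac{m\kappa}{t}+\frac{2\sqrt m}{\sqrt t},\ \frac{m\kappa}{t-2}-\frac{2\sqrt m}{\sqrt{t-2}}\right]\quad(t>2),$$ where the right endpoint of $I_2$ is replaced by $\infty$ when $t=1$, and the right endpoint of $I_3$ is replaced by $\infty$ when $t\in\{1,2\}$. If $m\le\min\{\frac{r}{2\lceil\kappa\sqrt r\rceil},\,p,\,\frac q2\}$, $m\kappa\equiv t\pmod 2$, $\sqrt p\in I_2$ and $\sqrt q\in I_3$, then not all elements of $m\mathcal{O}_K^+$ are sums of squares of elements of $\mathcal{O}_K$. Moreover, these intervals are non-empty for $m\ge\frac{8t(t-1)\left(2t-1+2\sqrt{t(t-1)}\right)}{\kappa^2}$.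
   Context: $\mathcal{O}_K$ is the ring of integers of $K$, $\mathcal{O}_K^+$ is the set of its totally positive elements (all four real embeddings positive), and $m\mathcal{O}_K^+=\{m\alpha:\alpha\in\mathcal{O}_K^+\}$. A sum of squares in $\mathcal{O}_K$ is a finite sum $\sum_i\alpha_i^2$ with $\alpha_i\in\mathcal{O}_K$. -}

module Defs where

open import Data.Integer as ℤ using (ℤ; +_)
import Data.Integer.Properties as ℤₚ
open import Data.List using (List; []; _∷_)
open import Data.List.Relation.Unary.All using (All)
open import Data.Maybe using (Maybe; just; nothing)
open import Data.Nat as ℕ using (ℕ; zero; suc; NonZero)
import Data.Nat.Properties as ℕₚ
open import Data.Nat.Divisibility using (_∣_)
import Data.Integer.Tactic.RingSolver as ℤ-Solver
import Data.Nat.Tactic.RingSolver as ℕ-Solver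
open import Data.Product using (∃; ∃-syntax; Σ-syntax; _×_; _,_; proj₁; proj₂)
open import Data.Rational as ℚ
  using (ℚ; mkℚ; 0ℚ; 1ℚ; ½; _/_; ∣_∣; ↧ₙ_; 1/_; Positive; toℚᵘ)
import Data.Rational.Properties as ℚₚ
import Data.Rational.Unnormalised as ℚᵘ
import Data.Rational.Unnormalised.Properties as ℚᵘₚ
import Data.Rational.Solver as ℚ-Solver
open import Data.Sign as Sign using (Sign)
open import Data.Sum using (inj₁; inj₂)
open import Relation.Binary.PropositionalEquality
open import Relation.Nullary using (yes; no)

SquareFree : ℕ → Set
SquareFree n = ∀ d → d ℕ.* d ∣ n → d ≡ 1

fromℤ : ℤ → ℚ
fromℤ z = z / 1

fromℕ : ℕ → ℚ
fromℕ n = fromℤ (+ n)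

-- Reals are Cauchy sequences of rationals. Two sequences represent the same
-- real when each is ≤ᴿ the other; no quotient is taken, and the order
-- relations below respect this equivalence.
record ℝ : Set where
  constructor mkℝ
  field
    seq    : ℕ → ℚ
    cauchy : ∀ ε → 0ℚ ℚ.< ε →
             ∃[ N ] (∀ i j → N ℕ.≤ i → N ℕ.≤ j → ∣ seq i ℚ.- seq j ∣ ℚ.≤ ε)

open ℝ public

infix 4 _≤ᴿ_ _<ᴿ_

_≤ᴿ_ : ℝ → ℝ → Set
x ≤ᴿ y = ∀ ε → 0ℚ ℚ.< ε → ∃[ N ] (∀ n → N ℕ.≤ n → seq x n ℚ.≤ seq y n ℚ.+ ε)

_<ᴿ_ : ℝ → ℝ → Set
x <ᴿ y = Σ[ ε ∈ ℚ ] 0ℚ ℚ.< ε × ∃[ N ] (∀ n → N ℕ.≤ n → seq x n ℚ.+ ε ℚ.≤ seq y n)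

const : ℚ → ℝ
const a = mkℝ (λ _ → a) λ ε 0<ε → 0 , λ _ _ _ _ →
  subst (ℚ._≤ ε) (sym (cong ∣_∣ (ℚₚ.+-inverseʳ a))) (ℚₚ.<⇒≤ 0<ε)

private
  interchange : ∀ a b c d → (a ℚ.+ b) ℚ.- (c ℚ.+ d) ≡ (a ℚ.- c) ℚ.+ (b ℚ.- d)
  interchange = solve 4 (λ a b c d → (a :+ b) :- (c :+ d) := (a :- c) :+ (b :- d)) refl
    where open ℚ-Solver.+-*-Solver

  factor : ∀ a x y → a ℚ.* x ℚ.- a ℚ.* y ≡ a ℚ.* (x ℚ.- y)
  factor = solve 3 (λ a x y → a :* x :- a :* y := a :* (x :- y)) refl
    where open ℚ-Solver.+-*-Solver

  halves : ∀ ε → ½ ℚ.* ε ℚ.+ ½ ℚ.* ε ≡ ε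
  halves ε = trans (sym (ℚₚ.*-distribʳ-+ ε ½ ½)) (ℚₚ.*-identityˡ ε)

  *-pos : ∀ {x y} → 0ℚ ℚ.< x → 0ℚ ℚ.< y → 0ℚ ℚ.< x ℚ.* y
  *-pos {x} {y} 0<x 0<y = ℚₚ.positive⁻¹ (x ℚ.* y)
    {{ℚₚ.pos*pos⇒pos x {{ℚ.positive 0<x}} y {{ℚ.positive 0<y}}}}

infixl 6 _+ᴿ_ _-ᴿ_
infixr 7 _·ᴿ_

_+ᴿ_ : ℝ → ℝ → ℝ
x +ᴿ y = mkℝ (λ n → seq x n ℚ.+ seq y n) λ ε 0<ε →
  let 0<δ     = *-pos {½} (ℚₚ.positive⁻¹ ½) 0<ε
      (M , p) = cauchy x (½ ℚ.* ε) 0<δ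
      (N , q) = cauchy y (½ ℚ.* ε) 0<δ
  in M ℕ.⊔ N , λ i j Ki Kj → let open ℚₚ.≤-Reasoning in begin
    ∣ (seq x i ℚ.+ seq y i) ℚ.- (seq x j ℚ.+ seq y j) ∣
      ≡⟨ cong ∣_∣ (interchange (seq x i) (seq y i) (seq x j) (seq y j)) ⟩
    ∣ (seq x i ℚ.- seq x j) ℚ.+ (seq y i ℚ.- seq y j) ∣
      ≤⟨ ℚₚ.∣p+q∣≤∣p∣+∣q∣ (seq x i ℚ.- seq x j) (seq y i ℚ.- seq y j) ⟩
    ∣ seq x i ℚ.- seq x j ∣ ℚ.+ ∣ seq y i ℚ.- seq y j ∣
      ≤⟨ ℚₚ.+-mono-≤
           (p i j (ℕₚ.m⊔n≤o⇒m≤o M N Ki) (ℕₚ.m⊔n≤o⇒m≤o M N Kj))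
           (q i j (ℕₚ.m⊔n≤o⇒n≤o M N Ki) (ℕₚ.m⊔n≤o⇒n≤o M N Kj)) ⟩
    ½ ℚ.* ε ℚ.+ ½ ℚ.* ε
      ≡⟨ halves ε ⟩
    ε ∎

_·ᴿ_ : ℚ → ℝ → ℝ
a ·ᴿ x = mkℝ (λ n → a ℚ.* seq x n) λ ε 0<ε →
  let b       = ∣ a ∣ ℚ.+ 1ℚ
      b⁺      = ℚₚ.nonNeg+pos⇒pos ∣ a ∣ {{ℚ.nonNegative (ℚₚ.0≤∣p∣ a)}} 1ℚ
      b⁰      = ℚₚ.pos⇒nonZero b {{b⁺}}
      b⁻¹     = (1/ b) {{b⁰}}
      0<δ     = *-pos {b⁻¹} (ℚₚ.positive⁻¹ b⁻¹ {{ℚₚ.1/pos⇒pos b {{b⁺}}}}) 0<ε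
      (N , p) = cauchy x (b⁻¹ ℚ.* ε) 0<δ
  in N , λ i j Ni Nj → let open ℚₚ.≤-Reasoning in begin
    ∣ a ℚ.* seq x i ℚ.- a ℚ.* seq x j ∣
      ≡⟨ cong ∣_∣ (factor a (seq x i) (seq x j)) ⟩
    ∣ a ℚ.* (seq x i ℚ.- seq x j) ∣
      ≡⟨ ℚₚ.∣p*q∣≡∣p∣*∣q∣ a (seq x i ℚ.- seq x j) ⟩
    ∣ a ∣ ℚ.* ∣ seq x i ℚ.- seq x j ∣
      ≤⟨ ℚₚ.*-monoˡ-≤-nonNeg ∣ a ∣ {{ℚ.nonNegative (ℚₚ.0≤∣p∣ a)}} (p i j Ni Nj) ⟩
    ∣ a ∣ ℚ.* (b⁻¹ ℚ.* ε)
      ≤⟨ ℚₚ.*-monoʳ-≤-nonNeg (b⁻¹ ℚ.* ε) {{ℚ.nonNegative (ℚₚ.<⇒≤ 0<δ)}}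
           (subst (ℚ._≤ b) (ℚₚ.+-identityʳ ∣ a ∣)
             (ℚₚ.+-monoʳ-≤ ∣ a ∣ (ℚₚ.<⇒≤ (ℚₚ.positive⁻¹ 1ℚ)))) ⟩
    b ℚ.* (b⁻¹ ℚ.* ε)
      ≡⟨ sym (ℚₚ.*-assoc b b⁻¹ ε) ⟩
    b ℚ.* b⁻¹ ℚ.* ε
      ≡⟨ cong (ℚ._* ε) (ℚₚ.*-inverseʳ b {{b⁰}}) ⟩
    1ℚ ℚ.* ε
      ≡⟨ ℚₚ.*-identityˡ ε ⟩
    ε ∎

_-ᴿ_ : ℝ → ℝ → ℝ
x -ᴿ y = x +ᴿ (ℚ.- 1ℚ) ·ᴿ y

⌊√_⌋ : ℕ → ℕ
⌊√ zero ⌋  = 0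
⌊√ suc n ⌋ with suc ⌊√ n ⌋ ℕ.* suc ⌊√ n ⌋ ℕ.≤? suc n
... | yes _ = suc ⌊√ n ⌋
... | no  _ = ⌊√ n ⌋

⌊√⌋-spec : ∀ n → ⌊√ n ⌋ ℕ.* ⌊√ n ⌋ ℕ.≤ n × n ℕ.< suc ⌊√ n ⌋ ℕ.* suc ⌊√ n ⌋
⌊√⌋-spec zero = ℕ.z≤n , ℕ.s≤s ℕ.z≤n
⌊√⌋-spec (suc n) with suc ⌊√ n ⌋ ℕ.* suc ⌊√ n ⌋ ℕ.≤? suc n
... | no s≰  = ℕₚ.m≤n⇒m≤1+n (proj₁ (⌊√⌋-spec n)) , ℕₚ.≰⇒> s≰
... | yes s≤ = s≤ , ℕₚ.≤-<-trans (proj₂ (⌊√⌋-spec n))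
                      (ℕₚ.*-mono-< (ℕₚ.n<1+n s) (ℕₚ.n<1+n s))
  where s = suc ⌊√ n ⌋

private
  squares : ∀ x y → (x ℕ.* y) ℕ.* (x ℕ.* y) ≡ (x ℕ.* x) ℕ.* (y ℕ.* y)
  squares = ℕ-Solver.solve-∀

  swap : ∀ c x y → c ℕ.* (x ℕ.* x) ℕ.* (y ℕ.* y) ≡ c ℕ.* (y ℕ.* y) ℕ.* (x ℕ.* x)
  swap = ℕ-Solver.solve-∀

  sq-cancel-< : ∀ {x y} → x ℕ.* x ℕ.< y ℕ.* y → x ℕ.< y
  sq-cancel-< {x} {y} x²<y² with x ℕ.<? y
  ... | yes x<y = x<y
  ... | no  x≮y with () ← ℕₚ.<⇒≱ x²<y² (ℕₚ.*-mono-≤ (ℕₚ.≮⇒≥ x≮y) (ℕₚ.≮⇒≥ x≮y))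

  ⌊√⌋-cross : ∀ c I J .{{_ : NonZero I}} .{{_ : NonZero J}} →
              ⌊√ c ℕ.* (I ℕ.* I) ⌋ ℕ.* J ℕ.≤ suc ⌊√ c ℕ.* (J ℕ.* J) ⌋ ℕ.* I
  ⌊√⌋-cross c I J = ℕₚ.<⇒≤ (sq-cancel-< (begin-strict
    (u ℕ.* J) ℕ.* (u ℕ.* J)          ≡⟨ squares u J ⟩
    (u ℕ.* u) ℕ.* (J ℕ.* J)          ≤⟨ ℕₚ.*-monoˡ-≤ (J ℕ.* J) (proj₁ (⌊√⌋-spec (c ℕ.* (I ℕ.* I)))) ⟩
    c ℕ.* (I ℕ.* I) ℕ.* (J ℕ.* J)    ≡⟨ swap c I J ⟩
    c ℕ.* (J ℕ.* J) ℕ.* (I ℕ.* I)    <⟨ ℕₚ.*-monoˡ-< (I ℕ.* I) {{ℕₚ.m*n≢0 I I}}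
                                          (proj₂ (⌊√⌋-spec (c ℕ.* (J ℕ.* J)))) ⟩
    (suc v ℕ.* suc v) ℕ.* (I ℕ.* I)  ≡⟨ squares (suc v) I ⟨
    (suc v ℕ.* I) ℕ.* (suc v ℕ.* I)  ∎))
    where
    open ℕₚ.≤-Reasoning
    u = ⌊√ c ℕ.* (I ℕ.* I) ⌋
    v = ⌊√ c ℕ.* (J ℕ.* J) ⌋

  toℚᵘ-/ : ∀ n d → toℚᵘ (n / suc d) ℚᵘ.≃ ℚᵘ.mkℚᵘ n d
  toℚᵘ-/ n d = ℚₚ.toℚᵘ-fromℚᵘ (ℚᵘ.mkℚᵘ n d)

  /-≤ : ∀ a b c d .{{_ : NonZero b}} .{{_ : NonZero d}} →
        a ℕ.* d ℕ.≤ c ℕ.* b → + a / b ℚ.≤ + c / d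
  /-≤ a (suc b) c (suc d) ad≤cb = ℚₚ.toℚᵘ-cancel-≤
    (ℚᵘₚ.≤-respˡ-≃ (ℚᵘₚ.≃-sym (toℚᵘ-/ (+ a) b))
    (ℚᵘₚ.≤-respʳ-≃ (ℚᵘₚ.≃-sym (toℚᵘ-/ (+ c) d))
    (ℚᵘ.*≤* (subst₂ ℤ._≤_ (ℤₚ.pos-* a (suc d)) (ℤₚ.pos-* c (suc b)) (ℤ.+≤+ ad≤cb)))))

  suc-/ : ∀ n d .{{_ : NonZero d}} → + suc n / d ≡ + n / d ℚ.+ + 1 / d
  suc-/ n (suc d) = ℚₚ.toℚᵘ-injective (begin
    toℚᵘ (+ suc n / suc d)                       ≈⟨ toℚᵘ-/ (+ suc n) d ⟩
    ℚᵘ.mkℚᵘ (+ suc n) d                          ≈⟨ ℚᵘ.*≡* (trans (cong (+ suc n ℤ.*_) (ℤₚ.pos-* (suc d) (suc d)))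
                                                           (lemma (+ n) (+ suc d))) ⟩
    ℚᵘ.mkℚᵘ (+ n) d ℚᵘ.+ ℚᵘ.mkℚᵘ (+ 1) d         ≈⟨ ℚᵘₚ.+-cong (toℚᵘ-/ (+ n) d) (toℚᵘ-/ (+ 1) d) ⟨
    toℚᵘ (+ n / suc d) ℚᵘ.+ toℚᵘ (+ 1 / suc d)   ≈⟨ ℚₚ.toℚᵘ-homo-+ (+ n / suc d) (+ 1 / suc d) ⟨
    toℚᵘ (+ n / suc d ℚ.+ + 1 / suc d)           ∎)
    where
    open ℚᵘₚ.≃-Reasoning
    lemma : ∀ n d → (+ 1 ℤ.+ n) ℤ.* (d ℤ.* d) ≡ (n ℤ.* d ℤ.+ + 1 ℤ.* d) ℤ.* d
    lemma = ℤ-Solver.solve-∀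

  1/-≤ : ∀ ε → 0ℚ ℚ.< ε → ∀ d .{{_ : NonZero d}} → ↧ₙ ε ℕ.≤ d → + 1 / d ℚ.≤ ε
  1/-≤ ε@(mkℚ (+ zero) _ _) 0<ε with () ← ℚ.positive 0<ε
  1/-≤ ε@(mkℚ ℤ.-[1+ _ ] _ _) 0<ε with () ← ℚ.positive 0<ε
  1/-≤ ε@(mkℚ ℤ.+[1+ n ] e _) 0<ε d e<d = subst (+ 1 / d ℚ.≤_) (ℚₚ.↥p/↧p≡p ε)
    (/-≤ 1 d (suc n) (suc e) (ℕₚ.≤-trans
      (subst (ℕ._≤ d) (sym (ℕₚ.*-identityˡ (suc e))) e<d) (ℕₚ.m≤n*m d (suc n))))

  cancel : ∀ x ε → x ℚ.+ ε ℚ.- x ≡ ε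
  cancel = solve 2 (λ x ε → x :+ ε :- x := ε) refl
    where open ℚ-Solver.+-*-Solver

  flip : ∀ x y → y ℚ.- x ≡ ℚ.- (x ℚ.- y)
  flip = solve 2 (λ x y → y :- x := :- (x :- y)) refl
    where open ℚ-Solver.+-*-Solver

  ∣-∣-≤ : ∀ {x y ε} → x ℚ.≤ y ℚ.+ ε → y ℚ.≤ x ℚ.+ ε → ∣ x ℚ.- y ∣ ℚ.≤ ε
  ∣-∣-≤ {x} {y} {ε} x≤ y≤ with ℚₚ.∣p∣≡p∨∣p∣≡-p (x ℚ.- y)
  ... | inj₁ eq = subst₂ ℚ._≤_ (sym eq) (cancel y ε) (ℚₚ.+-monoˡ-≤ (ℚ.- y) x≤)
  ... | inj₂ eq = subst₂ ℚ._≤_ (trans (flip x y) (sym eq)) (cancel x ε) (ℚₚ.+-monoˡ-≤ (ℚ.- x) y≤)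

-- √[ a / b ] is the square root of the fraction a/b. Since √(a/b) = √(ab)/b,
-- it is approximated by ⌊k√(ab)⌋ / (bk) for k = 1, 2, …
√[_/_] : (a b : ℕ) .{{_ : NonZero b}} → ℝ
√[ a / b ] = mkℝ approx λ ε 0<ε → ↧ₙ ε , λ i j Ni Nj →
  ∣-∣-≤ (close ε 0<ε i j Nj) (close ε 0<ε j i Ni)
  where
  den-nonZero : ∀ i → NonZero (b ℕ.* suc i)
  den-nonZero i = ℕₚ.m*n≢0 b (suc i)

  num : ℕ → ℕ
  num i = ⌊√ a ℕ.* b ℕ.* (suc i ℕ.* suc i) ⌋

  approx : ℕ → ℚ
  approx i = _/_ (+ num i) (b ℕ.* suc i) {{den-nonZero i}}

  close : ∀ ε → 0ℚ ℚ.< ε → ∀ i j → ↧ₙ ε ℕ.≤ j → approx i ℚ.≤ approx j ℚ.+ ε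
  close ε 0<ε i j N≤j = ℚₚ.≤-trans
    (/-≤ (num i) (b ℕ.* suc i) (suc (num j)) (b ℕ.* suc j)
      (subst₂ ℕ._≤_ (swap′ b (num i) (suc j)) (swap′ b (suc (num j)) (suc i))
        (ℕₚ.*-monoʳ-≤ b (⌊√⌋-cross (a ℕ.* b) (suc i) (suc j)))))
    (subst (ℚ._≤ approx j ℚ.+ ε) (sym (suc-/ (num j) (b ℕ.* suc j)))
      (ℚₚ.+-monoʳ-≤ (approx j) (1/-≤ ε 0<ε (b ℕ.* suc j)
        (ℕₚ.≤-trans (ℕₚ.m≤n⇒m≤1+n N≤j) (ℕₚ.m≤n*m (suc j) b)))))
    where
    instance
      _ = den-nonZero i
      _ = den-nonZero j
    swap′ : ∀ b x y → b ℕ.* (x ℕ.* y) ≡ x ℕ.* (b ℕ.* y)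
    swap′ = ℕ-Solver.solve-∀

√_ : ℕ → ℝ
√ n = √[ n / 1 ]

infix 8 √_

IsCeiling : ℝ → ℤ → Set
IsCeiling x c = x ≤ᴿ const (fromℤ c) × (∀ n → x ≤ᴿ const (fromℤ n) → c ℤ.≤ n)

-- A closed interval [ lower ⋯ upper ], where upper = nothing stands for ∞.
record Interval : Set where
  constructor [_⋯_]
  field
    lower : ℝ
    upper : Maybe ℝ

infix 4 _∈ᴵ_

_∈ᴵ_ : ℝ → Interval → Set
x ∈ᴵ [ l ⋯ just u  ] = l ≤ᴿ x × x ≤ᴿ u
x ∈ᴵ [ l ⋯ nothing ] = l ≤ᴿ x

NonEmpty : Interval → Set
NonEmpty I = ∃[ x ] x ∈ᴵ I

I₂ : (m κ t : ℕ) .{{_ : NonZero t}} → Interval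
I₂ m κ t@(suc _) = [ const (+ (m ℕ.* κ) / (4 ℕ.* t)) +ᴿ √[ m / 2 ℕ.* t ] ⋯ upper t ]
  where
  upper : ℕ → Maybe ℝ
  upper (suc s@(suc _)) = just (const (+ (m ℕ.* κ) / (4 ℕ.* s)) -ᴿ √[ m / 2 ℕ.* s ])
  upper _               = nothing

I₃ : (m κ t : ℕ) .{{_ : NonZero t}} → Interval
I₃ m κ t@(suc _) = [ const (+ (m ℕ.* κ) / t) +ᴿ fromℕ 2 ·ᴿ √[ m / t ] ⋯ upper t ]
  where
  upper : ℕ → Maybe ℝ
  upper (suc (suc s@(suc _))) = just (const (+ (m ℕ.* κ) / s) -ᴿ fromℕ 2 ·ᴿ √[ m / s ])
  upper _                     = nothing

-- ⟨ a , b , c , d ⟩ stands for a + b√p + c√q + d√p√q. When p and q are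
-- distinct square-free integers ≥ 2, the family 1, √p, √q, √p√q is a
-- ℚ-basis of K, so equality of coordinates is equality in K.
module Biquadratic (p q : ℕ) where

  record K : Set where
    constructor ⟨_,_,_,_⟩
    field
      re √p-part √q-part √pq-part : ℚ

  private
    P = fromℕ p
    Q = fromℕ q

  fromRational : ℚ → K
  fromRational a = ⟨ a , 0ℚ , 0ℚ , 0ℚ ⟩

  infixl 6 _+ᴷ_
  infixl 7 _*ᴷ_

  _+ᴷ_ : K → K → K
  ⟨ a , b , c , d ⟩ +ᴷ ⟨ a′ , b′ , c′ , d′ ⟩ =
    ⟨ a ℚ.+ a′ , b ℚ.+ b′ , c ℚ.+ c′ , d ℚ.+ d′ ⟩

  _*ᴷ_ : K → K → K
  ⟨ a , b , c , d ⟩ *ᴷ ⟨ a′ , b′ , c′ , d′ ⟩ =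
    ⟨ a * a′ + P * (b * b′) + Q * (c * c′) + P * Q * (d * d′)
    , a * b′ + b * a′ + Q * (c * d′ + d * c′)
    , a * c′ + c * a′ + P * (b * d′ + d * b′)
    , a * d′ + d * a′ + (b * c′ + c * b′)
    ⟩
    where open import Data.Rational using (_+_; _*_)

  -- The value at x of the monic polynomial with lower coefficients
  -- c₀ , … , cₙ₋₁, that is c₀ + c₁ x + ⋯ + cₙ₋₁ xⁿ⁻¹ + xⁿ.
  evalMonic : List ℤ → K → K
  evalMonic []       x = fromRational 1ℚ
  evalMonic (c ∷ cs) x = fromRational (fromℤ c) +ᴷ x *ᴷ evalMonic cs x

  _∈𝒪 : K → Set
  x ∈𝒪 = ∃[ cs ] evalMonic cs x ≡ fromRational 0ℚ

  signed : Sign → ℚ → ℚ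
  signed Sign.+ a = a
  signed Sign.- a = ℚ.- a

  -- The four real embeddings √p ↦ s√p, √q ↦ s′√q, indexed by the signs s, s′.
  embed : Sign → Sign → K → ℝ
  embed s s′ ⟨ a , b , c , d ⟩ =
    const a +ᴿ signed s b ·ᴿ √ p +ᴿ signed s′ c ·ᴿ √ q
            +ᴿ signed (s Sign.* s′) d ·ᴿ √ (p ℕ.* q)

  TotallyPositive : K → Set
  TotallyPositive x = ∀ s s′ → const 0ℚ <ᴿ embed s s′ x

  _∈𝒪⁺ : K → Set
  x ∈𝒪⁺ = x ∈𝒪 × TotallyPositive x

  sumOfSquares : List K → K
  sumOfSquares []       = fromRational 0ℚ
  sumOfSquares (x ∷ xs) = x *ᴷ x +ᴷ sumOfSquares xs

  IsSumOfSquares : K → Set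
  IsSumOfSquares x = ∃[ xs ] All _∈𝒪 xs × x ≡ sumOfSquares xs

-- Let b ≡ κ (mod 2) be maximal with b < κ√q and α = ½(b + 2 + κ√q), a totally
-- positive integer whose conjugate under √q ↦ -√q lies in (0, 1). Write a
-- representation mα = Σ xᵢ² with xᵢ = ½(A + B√p + C√q + D√r), A ≡ C (mod 2).
-- The trace bounds Σ D² by 1, and equality is impossible, so all D vanish.
-- Then ΣAC = mκ and, for N = ΣC² ≡ mκ ≡ t (mod 2), Cauchy–Schwarz gives
-- (N√q - mκ)² < 4mN, that is √q lies strictly between mκ/N - 2√(m/N) and
-- mκ/N + 2√(m/N). For N ≥ t this puts √q below I₃, for N ≤ t - 2 above it.
--
-- The shape of the xᵢ is obtained without determinants: integral elements have
-- powers with bounded denominators, this property passes to sums, products and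
-- conjugates, and a rational number with it is an integer.
--
-- The bound on m in the second claim is the squared form of the inequality
-- between the end points of I₂, and it implies that inequality for I₃.
module Submission where

open import Algebra.Bundles using (CommutativeRing)
open import Data.Nat using (ℕ)
import Defs
open import Level using (0ℓ)

-- The interval hypotheses speak of Cauchy sequences, while the contradiction must come from
-- integers. So each irrational is tested against one explicit rational, and integrality supplies
-- the margin: b² < κ²q means a difference of at least 1. From below, b/κ is a good enough
-- substitute for √q. From above, the error must be small compared with κ√q - b, which is where the
-- denominator 8κNq² comes from.
--
-- The equality ΣD² = 1 is the delicate point. Put g = gcd(p, q), p′ = p/g, q′ = q/g, so that √p√r =
-- p′√q. The C vanish, since otherwise q = 2m, while q is odd. The √q-coefficient then reads p′ΣBD =
-- mκ, and m ≤ p forces ΣBD = 1, so p′ = mκ. The bound on m by r gives 4(mκ)² ≤ r, hence q′ ≥ 4p′ ≥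
-- 4(g + 1), with equality excluded because q is odd. This is only just enough: for g = 1 and q′ = 9
-- the last estimate compares 36 with 36, and strictness decides.

-- Integer inequalities by certificates of nonnegativity

module IntegerOrder where
  open import Data.Integer
  open import Data.Integer.Properties
  import Data.Nat as ℕ
  open import Data.List using ([]; _∷_)
  open import Data.Empty using (⊥)
  open import Relation.Binary.PropositionalEquality
  open import Data.Integer.Tactic.RingSolver using (solve)

  infixl 6 _⊕_
  infixl 7 _⊗_

  _⊕_ : ∀ {x y} → 0ℤ ≤ x → 0ℤ ≤ y → 0ℤ ≤ x + y
  _⊕_ = +-mono-≤

  _⊗_ : ∀ {x y} → 0ℤ ≤ x → 0ℤ ≤ y → 0ℤ ≤ x * y
  _⊗_ {+ m} {+ n} _ _ = subst (0ℤ ≤_) (pos-* m n) (+≤+ ℕ.z≤n)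

  le : ∀ {x y} → x ≤ y → 0ℤ ≤ y - x
  le = i≤j⇒0≤j-i

  -- Discreteness of ℤ turns strictness into a gap of 1, and the certificates below depend on that
  -- unit.
  lt : ∀ {x y} → x < y → 0ℤ ≤ y - (1ℤ + x)
  lt x<y = i≤j⇒0≤j-i (i<j⇒suc[i]≤j x<y)

  sq : ∀ x → 0ℤ ≤ x * x
  sq (+ m)    = _⊗_ {+ m} {+ m} (+≤+ ℕ.z≤n) (+≤+ ℕ.z≤n)
  sq -[1+ m ] = +≤+ ℕ.z≤n

  -- An equation, unlike an inequality, may enter a certificate with a coefficient of either sign;
  -- hence the arbitrary `c`.
  eq : ∀ {x y} → x ≡ y → ∀ c → 0ℤ ≤ c * (x - y)
  eq {x} refl c = ≤-reflexive (sym (trans (cong (c *_) (+-inverseʳ x)) (*-zeroʳ c)))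

  lit : ∀ n → 0ℤ ≤ + n
  lit n = +≤+ ℕ.z≤n

  -- A certificate has two halves: `e`, a combination of hypotheses that is visibly nonnegative, and
  -- a ring identity equating it with the difference wanted, which the solver checks.
  by : ∀ {e x y} → 0ℤ ≤ e → e ≡ y - x → x ≤ y
  by p refl = 0≤i-j⇒j≤i p

  by< : ∀ {e x y} → 0ℤ ≤ e → e ≡ y - (1ℤ + x) → x < y
  by< p refl = suc[i]≤j⇒i<j (0≤i-j⇒j≤i p)

  absurd : ∀ {e} → 0ℤ ≤ e → e ≡ - 1ℤ → ⊥
  absurd () refl

  *-cancelˡ : ∀ {x y z} → 0ℤ < x → x * y ≤ x * z → y ≤ z
  *-cancelˡ {x} {y} {z} 0<x h = *-cancelˡ-≤-pos y z x {{positive 0<x}} h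

  *-cancelˡ-< : ∀ {x y z} → 0ℤ ≤ x → x * y < x * z → y < z
  *-cancelˡ-< {x} 0≤x h = *-cancelˡ-<-nonNeg x {{nonNegative 0≤x}} h

  square-cancel-≤ : ∀ {x y} → 0ℤ ≤ y → x * x ≤ y * y → x ≤ y
  square-cancel-≤ {x} {y} 0≤y h = ≮⇒≥ y≮x
    where
    y≮x : y < x → ⊥
    y≮x y<x = absurd
      (le h ⊕ (lt y<x ⊗ (0≤y ⊕ 0≤y)) ⊕ lt y<x ⊕ lt y<x ⊕ sq (x - (1ℤ + y)) ⊕ (0≤y ⊕ 0≤y))
      (solve (x ∷ y ∷ []))

  square-cancel-< : ∀ {x y} → 0ℤ ≤ y → x * x < y * y → x < y
  square-cancel-< {x} {y} 0≤y h = ≰⇒> y≰x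
    where
    y≰x : y ≤ x → ⊥
    y≰x y≤x = absurd (lt h ⊕ (le y≤x ⊗ (0≤y ⊕ 0≤y)) ⊕ sq (x - y)) (solve (x ∷ y ∷ []))

  even≢odd : ∀ x y → + 2 * x ≢ 1ℤ + + 2 * y
  even≢odd x y 2x≡1+2y = x≰y (≮⇒≥ y≮x)
    where
    x≰y : x ≤ y → ⊥
    x≰y x≤y = absurd (lit 2 ⊗ le x≤y ⊕ eq 2x≡1+2y 1ℤ) (solve (x ∷ y ∷ []))
    y≮x : y < x → ⊥
    y≮x y<x = absurd (lit 2 ⊗ lt y<x ⊕ eq 2x≡1+2y (- 1ℤ)) (solve (x ∷ y ∷ []))

-- The numerical contradiction behind the case ΣD² = 1

module LargeTrace where
  open IntegerOrder
  open import Data.Integer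
  open import Data.Integer.Properties
  open import Data.List using ([]; _∷_)
  open import Data.Empty using (⊥)
  open import Relation.Binary.PropositionalEquality
  open import Data.Integer.Tactic.RingSolver using (solve)

  -- With p′ = mκ the trace bound gives (q′ + g - 4)² < 4 g q′, while q′ > 4 (g + 1).
  r+p-too-large : ∀ {g q′ m κ b} → 1ℤ ≤ g → 1ℤ ≤ m → 1ℤ ≤ κ → 0ℤ ≤ b →
    g < m * κ → + 4 * (m * κ) ≤ q′ → q′ ≢ + 4 * (g + 1ℤ) →
    b * b < κ * κ * (g * q′) → m * κ * q′ + g * (m * κ) ≤ + 2 * m * (b + + 2) → ⊥
  r+p-too-large {g} {q′} {m} {κ} {b} 1≤g 1≤m 1≤κ 0≤b g<p′ 4p′≤q′ q′≢ b²<κ²q r+p≤ = contra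
    where
    4[g+1]≤q′ : + 4 * (g + 1ℤ) ≤ q′
    4[g+1]≤q′ = by (le 4p′≤q′ ⊕ lit 4 ⊗ lt g<p′) (solve (g ∷ q′ ∷ m ∷ κ ∷ []))
    4[g+1]<q′ : + 4 * (g + 1ℤ) < q′
    4[g+1]<q′ = ≤∧≢⇒< 4[g+1]≤q′ (λ e → q′≢ (sym e))
    -- The constant term 4m on the right is absorbed as 4m ≤ 4mκ.
    WV≤ : m * κ * (q′ + g - + 4) ≤ + 2 * m * b
    WV≤ = by (le r+p≤ ⊕ lit 4 ⊗ (le 1≤m ⊕ lit 1) ⊗ le 1≤κ) (solve (g ∷ q′ ∷ m ∷ κ ∷ b ∷ []))
    κV≤ : κ * (q′ + g - + 4) ≤ + 2 * b
    κV≤ = *-cancelˡ {m} (by< (le 1≤m) (solve (m ∷ []))) (by (le WV≤) (solve (g ∷ q′ ∷ m ∷ κ ∷ b ∷ [])))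
    0≤V : 0ℤ ≤ q′ + g - + 4
    0≤V = by (lt 4[g+1]<q′ ⊕ lit 5 ⊗ le 1≤g ⊕ lit 6) (solve (g ∷ q′ ∷ []))
    0≤κ : 0ℤ ≤ κ
    0≤κ = by (le 1≤κ ⊕ lit 1) (solve (κ ∷ []))
    κ²V²< : κ * κ * ((q′ + g - + 4) * (q′ + g - + 4)) < κ * κ * (+ 4 * (g * q′))
    κ²V²< = by< (le κV≤ ⊗ (0≤κ ⊗ 0≤V ⊕ lit 2 ⊗ 0≤b) ⊕ lit 4 ⊗ lt b²<κ²q ⊕ lit 3)
      (solve (g ∷ q′ ∷ κ ∷ b ∷ []))
    V²< : (q′ + g - + 4) * (q′ + g - + 4) < + 4 * (g * q′)
    V²< = *-cancelˡ-< {κ * κ} (sq κ) κ²V²<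
    contra : ⊥
    -- With x = q′ - 4(g + 1) - 1 ≥ 0, the difference (q′ + g - 4)² - 4gq′ equals 9(g - 1)² + 8(g -
    -- 1) + 8x + 6(g - 1)x + x². It vanishes for g = 1, x = 0, so the strictness of `V²<` is
    -- essential.
    contra = absurd
      (lt V²< ⊕ lit 9 ⊗ sq (g - 1ℤ) ⊕ lit 8 ⊗ le 1≤g ⊕ lit 8 ⊗ lt 4[g+1]<q′
        ⊕ lit 6 ⊗ le 1≤g ⊗ lt 4[g+1]<q′ ⊕ sq (q′ - (1ℤ + + 4 * (g + 1ℤ))))
      (solve (g ∷ q′ ∷ []))

-- Vanishing of the coefficients of √r

module TraceBound where
  open IntegerOrder
  open LargeTrace
  open import Data.Integer
  open import Data.Integer.Properties
  open import Data.List using ([]; _∷_)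
  open import Data.Empty using (⊥)
  open import Relation.Binary.PropositionalEquality
  open import Data.Integer.Tactic.RingSolver using (solve)

  module _ {g p′ q′ m κ b c SA SB SC SD SAC SBD q₁}
    (1≤g : 1ℤ ≤ g) (1≤m : 1ℤ ≤ m) (1≤κ : 1ℤ ≤ κ) (0≤b : 0ℤ ≤ b) (0≤c : 0ℤ ≤ c)
    (g<p′ : g < p′) (q<r : g * q′ < p′ * q′) (q≡1 : g * q′ ≡ 1ℤ + + 4 * q₁)
    (m≤p : m ≤ g * p′) (2m≤q : + 2 * m ≤ g * q′) (2mc≤r : + 2 * m * c ≤ p′ * q′)
    (κ²r≤c² : κ * κ * (p′ * q′) ≤ c * c) (b²<κ²q : b * b < κ * κ * (g * q′))
    (b+2≤c+1 : b + + 2 ≤ c + 1ℤ)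
    (0≤SA : 0ℤ ≤ SA) (0≤SB : 0ℤ ≤ SB) (0≤SC : 0ℤ ≤ SC) (0≤SD : 0ℤ ≤ SD)
    (SC≡0⇒SAC≡0 : SC ≡ 0ℤ → SAC ≡ 0ℤ)
    (psd : ∀ x y → 0ℤ ≤ x * x * SB + + 2 * (x * y) * SBD + y * y * SD)
    (trace : SA + g * p′ * SB + g * q′ * SC + p′ * q′ * SD ≡ + 2 * m * (b + + 2))
    (√q-part : SAC + p′ * SBD ≡ m * κ)
    where

    private
      0≤m : 0ℤ ≤ m
      0≤m = ≤-trans (lit 1) 1≤m

      1≤p′ : 1ℤ ≤ p′
      1≤p′ = by (lt g<p′ ⊕ le 1≤g ⊕ lit 1) (solve (g ∷ p′ ∷ []))

      1≤p : 1ℤ ≤ g * p′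
      1≤p = by (le 1≤g ⊗ le 1≤p′ ⊕ le 1≤g ⊕ le 1≤p′) (solve (g ∷ p′ ∷ []))

      0≤q : 0ℤ ≤ g * q′
      0≤q = by (le 2m≤q ⊕ lit 2 ⊗ 0≤m) (solve (g ∷ q′ ∷ m ∷ []))

      0<r : 0ℤ < p′ * q′
      0<r = ≤-<-trans 0≤q q<r

      0≤r : 0ℤ ≤ p′ * q′
      0≤r = <⇒≤ 0<r

      -- The trace is 2m(b + 2) ≤ 2mc + 2m ≤ r + q < 2r.
      SD≱2 : + 2 ≤ SD → ⊥
      SD≱2 2≤SD = absurd
        (eq trace (- 1ℤ) ⊕ 0≤SA ⊕ (≤-trans (lit 1) 1≤p) ⊗ 0≤SB ⊕ 0≤q ⊗ 0≤SC ⊕ 0≤r ⊗ le 2≤SD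
          ⊕ lit 2 ⊗ 0≤m ⊗ le b+2≤c+1 ⊕ le 2mc≤r ⊕ le 2m≤q ⊕ lt q<r)
        (solve (g ∷ p′ ∷ q′ ∷ m ∷ b ∷ c ∷ SA ∷ SB ∷ SC ∷ SD ∷ []))

      module SD≡1 (SD≡1 : SD ≡ 1ℤ) where

        remainder : SA + g * p′ * SB + g * q′ * SC ≤ + 2 * m
        remainder = by (eq trace (- 1ℤ) ⊕ eq SD≡1 (p′ * q′) ⊕ lit 2 ⊗ 0≤m ⊗ le b+2≤c+1 ⊕ le 2mc≤r)
          (solve (g ∷ p′ ∷ q′ ∷ m ∷ b ∷ c ∷ SA ∷ SB ∷ SC ∷ SD ∷ []))

        0≤pSB : 0ℤ ≤ g * p′ * SB
        0≤pSB = ≤-trans (lit 1) 1≤p ⊗ 0≤SB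

        -- After removing r from the trace at most 2m ≤ q remains, so one nonzero C would give q =
        -- 2m, against q odd.
        SC≱1 : 1ℤ ≤ SC → ⊥
        SC≱1 1≤SC = even≢odd m (+ 2 * q₁) (trans (≤-antisym 2m≤q q≤2m) (trans q≡1 rhs))
          where
          rhs : 1ℤ + + 4 * q₁ ≡ 1ℤ + + 2 * (+ 2 * q₁)
          rhs = solve (q₁ ∷ [])
          q≤2m : g * q′ ≤ + 2 * m
          q≤2m = by (le remainder ⊕ 0≤SA ⊕ 0≤pSB ⊕ 0≤q ⊗ le 1≤SC)
            (solve (g ∷ p′ ∷ q′ ∷ m ∷ SA ∷ SB ∷ SC ∷ []))

        SAC≡0 : SAC ≡ 0ℤ
        SAC≡0 = SC≡0⇒SAC≡0 (≤-antisym (≮⇒≥ λ 0<SC → SC≱1 (i<j⇒suc[i]≤j 0<SC)) 0≤SC)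

        p′SBD≡W : p′ * SBD ≡ m * κ
        p′SBD≡W = trans (sym (+-identityˡ (p′ * SBD))) (trans (cong (_+ p′ * SBD) (sym SAC≡0)) √q-part)

        SBD≰0 : SBD ≤ 0ℤ → ⊥
        SBD≰0 SBD≤0 = absurd
          (eq p′SBD≡W 1ℤ ⊕ ≤-trans (lit 1) 1≤p′ ⊗ le SBD≤0 ⊕ le 1≤m ⊗ le 1≤κ ⊕ le 1≤m ⊕ le 1≤κ)
          (solve (p′ ∷ m ∷ κ ∷ SBD ∷ []))

        -- Cauchy-Schwarz with ΣD² = 1: the form is evaluated at (1, -ΣBD).
        SBD²≤SB : SBD * SBD ≤ SB
        SBD²≤SB = by (psd 1ℤ (- SBD) ⊕ eq SD≡1 (- (SBD * SBD))) (solve (SB ∷ SD ∷ SBD ∷ []))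

        -- Otherwise 4p ≤ pΣB² ≤ 2m ≤ 2p.
        SBD≱2 : + 2 ≤ SBD → ⊥
        SBD≱2 2≤SBD = absurd
          (le remainder ⊕ 0≤SA ⊕ 0≤q ⊗ 0≤SC ⊕ lit 2 ⊗ le m≤p ⊕ 0≤p ⊗ le SBD²≤SB
            ⊕ 0≤p ⊗ (le 2≤SBD ⊗ (le 2≤SBD ⊕ lit 4)) ⊕ lit 2 ⊗ le 1≤p ⊕ lit 1)
          (solve (g ∷ p′ ∷ q′ ∷ m ∷ SA ∷ SB ∷ SC ∷ SBD ∷ []))
          where
          0≤p : 0ℤ ≤ g * p′
          0≤p = ≤-trans (lit 1) 1≤p

        1≤SBD : 1ℤ ≤ SBD
        1≤SBD = i<j⇒suc[i]≤j (≰⇒> SBD≰0)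

        SBD≡1 : SBD ≡ 1ℤ
        SBD≡1 = ≤-antisym (≮⇒≥ λ 1<SBD → SBD≱2 (i<j⇒suc[i]≤j 1<SBD)) 1≤SBD

        p′≡W : p′ ≡ m * κ
        p′≡W = trans (sym (*-identityʳ p′)) (trans (cong (p′ *_) (sym SBD≡1)) p′SBD≡W)

        -- Squaring 2mc ≤ r and inserting κ²r ≤ c² gives 4m²κ²r ≤ 4m²c² ≤ r²; the common factor r is
        -- cancelled next.
        W²4≤r : p′ * q′ * (+ 4 * (m * κ * (m * κ))) ≤ p′ * q′ * (p′ * q′)
        W²4≤r = by (le 2mc≤r ⊗ (0≤r ⊕ lit 2 ⊗ 0≤m ⊗ 0≤c) ⊕ lit 4 ⊗ sq m ⊗ le κ²r≤c²)
          (solve (p′ ∷ q′ ∷ m ∷ κ ∷ c ∷ []))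

        4W²≤r : + 4 * (m * κ * (m * κ)) ≤ p′ * q′
        4W²≤r = *-cancelˡ 0<r W²4≤r

        4W≤q′ : + 4 * (m * κ) ≤ q′
        4W≤q′ = *-cancelˡ {p′} (suc[i]≤j⇒i<j 1≤p′) (by
          (le 4W²≤r ⊕ eq p′≡W (- (+ 4 * (m * κ))))
          (solve (p′ ∷ q′ ∷ m ∷ κ ∷ [])))

        -- The value q′ = 8 at g = 1 would survive the final estimate, as 5² < 32, so it has to be
        -- excluded by parity.
        q′≢4[g+1] : q′ ≢ + 4 * (g + 1ℤ)
        q′≢4[g+1] q′≡ = even≢odd (+ 2 * (g * (g + 1ℤ))) (+ 2 * q₁)
          (trans lhs (trans (trans (cong (g *_) (sym q′≡)) q≡1) rhs))
          where
          lhs : + 2 * (+ 2 * (g * (g + 1ℤ))) ≡ g * (+ 4 * (g + 1ℤ))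
          lhs = solve (g ∷ [])
          rhs : 1ℤ + + 4 * q₁ ≡ 1ℤ + + 2 * (+ 2 * q₁)
          rhs = solve (q₁ ∷ [])

        1≤SB : 1ℤ ≤ SB
        1≤SB = by (le SBD²≤SB ⊕ le 1≤SBD ⊗ le 1≤SBD ⊕ lit 2 ⊗ le 1≤SBD) (solve (SB ∷ SBD ∷ []))

        r+p≤ : p′ * q′ + g * p′ ≤ + 2 * m * (b + + 2)
        r+p≤ = by
          (eq trace (- 1ℤ) ⊕ eq SD≡1 (p′ * q′) ⊕ 0≤SA ⊕ 0≤q ⊗ 0≤SC ⊕ ≤-trans (lit 1) 1≤p ⊗ le 1≤SB)
          (solve (g ∷ p′ ∷ q′ ∷ m ∷ b ∷ SA ∷ SB ∷ SC ∷ SD ∷ []))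

        impossible : ⊥
        impossible = r+p-too-large 1≤g 1≤m 1≤κ 0≤b (subst (g <_) p′≡W g<p′) 4W≤q′ q′≢4[g+1] b²<κ²q
          (subst (λ x → x * q′ + g * x ≤ + 2 * m * (b + + 2)) p′≡W r+p≤)

    √r-coordinates-vanish : SD ≡ 0ℤ
    √r-coordinates-vanish = ≤-antisym (≮⇒≥ 0≮SD) 0≤SD
      where
      0≮SD : 0ℤ < SD → ⊥
      0≮SD 0<SD = SD≡1.impossible
        (≤-antisym (≮⇒≥ λ 1<SD → SD≱2 (i<j⇒suc[i]≤j 1<SD)) (i<j⇒suc[i]≤j 0<SD))

-- Fractions of natural numbers

module Fractions where
  open import Data.Integer as ℤ using (+_)
  import Data.Integer.Properties as ℤ
  open import Data.Nat hiding (_/_)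
  open import Data.Nat.Properties
  open import Data.Nat.Tactic.RingSolver using (solve-∀)
  open import Data.Rational as ℚ using (_/_; toℚᵘ; 0ℚ)
  import Data.Rational.Properties as ℚ
  import Data.Rational.Unnormalised as ℚᵘ
  import Data.Rational.Unnormalised.Properties as ℚᵘ
  open import Relation.Binary.PropositionalEquality

  toℚᵘ-/ : ∀ a b .{{_ : NonZero b}} → toℚᵘ (+ a / b) ℚᵘ.≃ + a ℚᵘ./ b
  toℚᵘ-/ a (suc b) = ℚ.toℚᵘ-fromℚᵘ (ℚᵘ.mkℚᵘ (+ a) b)

  /-mono-≤ : ∀ {a b c d} .{{_ : NonZero b}} .{{_ : NonZero d}} →
             a * d ≤ c * b → + a / b ℚ.≤ + c / d
  /-mono-≤ {a} {suc b} {c} {suc d} ad≤cb = ℚ.toℚᵘ-cancel-≤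
    (ℚᵘ.≤-respˡ-≃ (ℚᵘ.≃-sym (toℚᵘ-/ a (suc b)))
    (ℚᵘ.≤-respʳ-≃ (ℚᵘ.≃-sym (toℚᵘ-/ c (suc d)))
    (ℚᵘ.*≤* (subst₂ ℤ._≤_ (ℤ.pos-* a (suc d)) (ℤ.pos-* c (suc b)) (ℤ.+≤+ ad≤cb)))))

  /-cancel-≤ : ∀ {a b c d} .{{_ : NonZero b}} .{{_ : NonZero d}} →
               + a / b ℚ.≤ + c / d → a * d ≤ c * b
  /-cancel-≤ {a} {suc b} {c} {suc d} h = ℤ.drop‿+≤+
    (subst₂ ℤ._≤_ (sym (ℤ.pos-* a (suc d))) (sym (ℤ.pos-* c (suc b)))
      (ℚᵘ.drop-*≤* (ℚᵘ.≤-respˡ-≃ (toℚᵘ-/ a (suc b)) (ℚᵘ.≤-respʳ-≃ (toℚᵘ-/ c (suc d)) (ℚ.toℚᵘ-mono-≤ h)))))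

  +-/ : ∀ a b c d .{{_ : NonZero b}} .{{_ : NonZero d}} →
        + a / b ℚ.+ + c / d ≡ _/_ (+ (a * d + c * b)) (b * d) {{m*n≢0 b d}}
  +-/ a (suc b) c (suc d) = ℚ.toℚᵘ-injective (begin
    toℚᵘ (+ a / suc b ℚ.+ + c / suc d)           ≈⟨ ℚ.toℚᵘ-homo-+ (+ a / suc b) (+ c / suc d) ⟩
    toℚᵘ (+ a / suc b) ℚᵘ.+ toℚᵘ (+ c / suc d)   ≈⟨ ℚᵘ.+-cong (toℚᵘ-/ a (suc b)) (toℚᵘ-/ c (suc d)) ⟩
    + a ℚᵘ./ suc b ℚᵘ.+ + c ℚᵘ./ suc d           ≈⟨ ℚᵘ.≃-reflexive (cong (λ i → i ℚᵘ./ (suc b * suc d)) numerators) ⟩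
    + (a * suc d + c * suc b) ℚᵘ./ (suc b * suc d) ≈⟨ toℚᵘ-/ (a * suc d + c * suc b) (suc b * suc d) ⟨
    toℚᵘ (+ (a * suc d + c * suc b) / (suc b * suc d)) ∎)
    where
    open ℚᵘ.≃-Reasoning
    numerators : + a ℤ.* + suc d ℤ.+ + c ℤ.* + suc b ≡ + (a * suc d + c * suc b)
    numerators = cong₂ ℤ._+_ (sym (ℤ.pos-* a (suc d))) (sym (ℤ.pos-* c (suc b)))

  *-/ : ∀ a b c d .{{_ : NonZero b}} .{{_ : NonZero d}} →
        + a / b ℚ.* (+ c / d) ≡ _/_ (+ (a * c)) (b * d) {{m*n≢0 b d}}
  *-/ a (suc b) c (suc d) = ℚ.toℚᵘ-injective (begin
    toℚᵘ (+ a / suc b ℚ.* (+ c / suc d))         ≈⟨ ℚ.toℚᵘ-homo-* (+ a / suc b) (+ c / suc d) ⟩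
    toℚᵘ (+ a / suc b) ℚᵘ.* toℚᵘ (+ c / suc d)   ≈⟨ ℚᵘ.*-cong (toℚᵘ-/ a (suc b)) (toℚᵘ-/ c (suc d)) ⟩
    (+ a ℚᵘ./ suc b) ℚᵘ.* (+ c ℚᵘ./ suc d)       ≈⟨ ℚᵘ.≃-reflexive (cong (λ i → i ℚᵘ./ (suc b * suc d)) (sym (ℤ.pos-* a c))) ⟩
    + (a * c) ℚᵘ./ (suc b * suc d)               ≈⟨ toℚᵘ-/ (a * c) (suc b * suc d) ⟨
    toℚᵘ (+ (a * c) / (suc b * suc d)) ∎)
    where open ℚᵘ.≃-Reasoning

  /-cross : ∀ {a b c d} .{{_ : NonZero b}} .{{_ : NonZero d}} →
            a * d ≡ c * b → + a / b ≡ + c / d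
  /-cross {a} {b} {c} {d} e = ℚ.≤-antisym
    (/-mono-≤ {a} {b} {c} {d} (≤-reflexive e)) (/-mono-≤ {c} {d} {a} {b} (≤-reflexive (sym e)))

  suc-/ : ∀ n d .{{_ : NonZero d}} → + suc n / d ≡ + n / d ℚ.+ + 1 / d
  suc-/ n d = trans (let instance _ = m*n≢0 d d in /-cross {suc n} {d} {n * d + 1 * d} {d * d} (lemma n d)) (sym (+-/ n d 1 d))
    where
    lemma : ∀ n d → suc n * (d * d) ≡ (n * d + 1 * d) * d
    lemma = solve-∀

  -- A positive rational has numerator at least 1, so its denominator serves as a modulus of
  -- convergence.
  1/n≤ε : ∀ {ε} → 0ℚ ℚ.< ε → ∀ n .{{_ : NonZero n}} → ℚ.↧ₙ ε ≤ n → + 1 / n ℚ.≤ ε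
  1/n≤ε {ε@(ℚ.mkℚ (+ zero) _ _)} 0<ε with () ← ℚ.positive 0<ε
  1/n≤ε {ε@(ℚ.mkℚ ℤ.-[1+ _ ] _ _)} 0<ε with () ← ℚ.positive 0<ε
  1/n≤ε {ε@(ℚ.mkℚ ℤ.+[1+ n ] e _)} 0<ε d e<d = subst (+ 1 / d ℚ.≤_) (ℚ.↥p/↧p≡p ε)
    (/-mono-≤ {1} {d} {suc n} {suc e} (≤-trans
      (≤-reflexive (*-identityˡ (suc e))) (≤-trans e<d (m≤n*m d (suc n)))))

  square-cancel-≤ : ∀ {x y} → x * x ≤ y * y → x ≤ y
  square-cancel-≤ {x} {y} h = ≮⇒≥ λ y<x → <⇒≱ (*-mono-< y<x y<x) h

-- Order on the Cauchy reals, and square roots compared with rationals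

module Reals where
  open import Defs
  open Fractions
  open import Data.Integer using (+_)
  open import Data.Nat hiding (_/_)
  open import Data.Nat.Properties
  open import Data.Nat.Tactic.RingSolver using (solve-∀)
  open import Data.Product using (_,_; proj₁; proj₂)
  open import Data.Rational as ℚ using (_/_; 0ℚ; ½)
  import Data.Rational.Properties as ℚ
  open import Relation.Binary.PropositionalEquality

  ½*-pos : ∀ {ε} → 0ℚ ℚ.< ε → 0ℚ ℚ.< ½ ℚ.* ε
  ½*-pos {ε} 0<ε = ℚ.positive⁻¹ (½ ℚ.* ε) {{ℚ.pos*pos⇒pos ½ ε {{ℚ.positive 0<ε}}}}

  ½*+½* : ∀ ε → ½ ℚ.* ε ℚ.+ ½ ℚ.* ε ≡ ε
  ½*+½* ε = trans (sym (ℚ.*-distribʳ-+ ε ½ ½)) (ℚ.*-identityˡ ε)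

  ≤-pointwise : ∀ {x y} → (∀ n → seq x n ℚ.≤ seq y n) → x ≤ᴿ y
  ≤-pointwise {x} {y} h ε 0<ε = 0 , λ n _ → ℚ.≤-trans (h n)
    (subst (ℚ._≤ seq y n ℚ.+ ε) (ℚ.+-identityʳ (seq y n)) (ℚ.+-monoʳ-≤ (seq y n) (ℚ.<⇒≤ 0<ε)))

  ≤ᴿ-trans : ∀ {x y z} → x ≤ᴿ y → y ≤ᴿ z → x ≤ᴿ z
  ≤ᴿ-trans {x} {y} {z} x≤y y≤z ε 0<ε =
    let M , p = x≤y (½ ℚ.* ε) (½*-pos 0<ε)
        N , q = y≤z (½ ℚ.* ε) (½*-pos 0<ε)
    in M ⊔ N , λ n K≤n → let open ℚ.≤-Reasoning in begin
      seq x n                                  ≤⟨ p n (m⊔n≤o⇒m≤o M N K≤n) ⟩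
      seq y n ℚ.+ ½ ℚ.* ε                      ≤⟨ ℚ.+-monoˡ-≤ (½ ℚ.* ε) (q n (m⊔n≤o⇒n≤o M N K≤n)) ⟩
      seq z n ℚ.+ ½ ℚ.* ε ℚ.+ ½ ℚ.* ε          ≡⟨ ℚ.+-assoc (seq z n) _ _ ⟩
      seq z n ℚ.+ (½ ℚ.* ε ℚ.+ ½ ℚ.* ε)        ≡⟨ cong (seq z n ℚ.+_) (½*+½* ε) ⟩
      seq z n ℚ.+ ε                            ∎

  +ᴿ-monoʳ-≤ : ∀ x {y z} → y ≤ᴿ z → x +ᴿ y ≤ᴿ x +ᴿ z
  +ᴿ-monoʳ-≤ x {y} {z} y≤z ε 0<ε =
    let N , h = y≤z ε 0<ε
    in N , λ n N≤n → subst (seq x n ℚ.+ seq y n ℚ.≤_)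
         (sym (ℚ.+-assoc (seq x n) (seq z n) ε)) (ℚ.+-monoʳ-≤ (seq x n) (h n N≤n))

  ·ᴿ-monoʳ-≤ : ∀ a b .{{_ : NonZero b}} {x y} → x ≤ᴿ y → (+ a / b) ·ᴿ x ≤ᴿ (+ a / b) ·ᴿ y
  ·ᴿ-monoʳ-≤ a b {x} {y} x≤y ε 0<ε =
    let N , h = x≤y δ 0<δ
    in N , λ n N≤n → let open ℚ.≤-Reasoning in begin
      + a / b ℚ.* seq x n                       ≤⟨ ℚ.*-monoˡ-≤-nonNeg (+ a / b) {{nonNeg}} (h n N≤n) ⟩
      + a / b ℚ.* (seq y n ℚ.+ δ)               ≡⟨ ℚ.*-distribˡ-+ (+ a / b) (seq y n) δ ⟩
      + a / b ℚ.* seq y n ℚ.+ + a / b ℚ.* δ     ≤⟨ ℚ.+-monoʳ-≤ (+ a / b ℚ.* seq y n) aδ≤ε ⟩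
      + a / b ℚ.* seq y n ℚ.+ ε                 ∎
    where
    instance
      _ = m*n≢0 b (suc a)
    nonNeg : ℚ.NonNegative (+ a / b)
    nonNeg = ℚ.normalize-nonNeg a b
    -- The divisor is a + 1 because a may be 0.
    δ = + 1 / suc a ℚ.* ε
    0<δ : 0ℚ ℚ.< δ
    0<δ = ℚ.positive⁻¹ δ {{ℚ.pos*pos⇒pos (+ 1 / suc a) {{ℚ.normalize-pos 1 (suc a)}} ε {{ℚ.positive 0<ε}}}}
    aδ≤ε : + a / b ℚ.* δ ℚ.≤ ε
    aδ≤ε = begin
      + a / b ℚ.* (+ 1 / suc a ℚ.* ε)           ≡⟨ ℚ.*-assoc (+ a / b) (+ 1 / suc a) ε ⟨
      + a / b ℚ.* (+ 1 / suc a) ℚ.* ε           ≡⟨ cong (ℚ._* ε) (*-/ a b 1 (suc a)) ⟩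
      + (a * 1) / (b * suc a) ℚ.* ε             ≤⟨ ℚ.*-monoʳ-≤-nonNeg ε {{ℚ.nonNegative (ℚ.<⇒≤ 0<ε)}} (/-mono-≤ {a * 1} {b * suc a} {1} {1} a≤ba) ⟩
      + 1 / 1 ℚ.* ε                             ≡⟨ ℚ.*-identityˡ ε ⟩
      ε                                         ∎
      where
      open ℚ.≤-Reasoning
      a≤ba : a * 1 * 1 ≤ 1 * (b * suc a)
      a≤ba = ≤-trans (≤-reflexive (trans (*-identityʳ (a * 1)) (*-identityʳ a)))
        (≤-trans (n≤1+n a) (≤-trans (m≤n*m (suc a) b) (≤-reflexive (sym (*-identityˡ (b * suc a))))))

  -- If b < a, a rational c strictly between them yields the tolerance c - b, too small to bridge
  -- the gap.
  const-cancel-≤ : ∀ {a b} → const a ≤ᴿ const b → a ℚ.≤ b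
  const-cancel-≤ {a} {b} h = ℚ.≮⇒≥ λ b<a →
    let c , b<c , c<a = ℚ.<-dense b<a
        N , a≤b+ε     = h (c ℚ.- b) (subst (ℚ._< c ℚ.- b) (ℚ.+-inverseʳ b) (ℚ.+-monoˡ-< (ℚ.- b) b<c))
    in ℚ.<-irrefl refl (ℚ.<-≤-trans c<a (subst (a ℚ.≤_) (b+[c-b] b c) (a≤b+ε N ≤-refl)))
    where
    b+[c-b] : ∀ b c → b ℚ.+ (c ℚ.- b) ≡ c
    b+[c-b] = solve 2 (λ b c → b :+ (c :- b) := c) refl
      where
      open import Data.Rational.Solver
      open +-*-Solver

  -- The n-th approximant is rounded down by less than 1/(b(n + 1)), so raising its numerator by one
  -- passes the root. The surplus is at most ε once n reaches the denominator of ε.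
  const≤√ : ∀ {h e a b} .{{_ : NonZero e}} .{{_ : NonZero b}} →
            h * h * b ≤ a * (e * e) → const (+ h / e) ≤ᴿ √[ a / b ]
  const≤√ {h} {e} {a} {b} h²b≤ae² ε 0<ε = ℚ.↧ₙ ε , λ n N≤n →
    let instance _ = m*n≢0 b (suc n)
        s = ⌊√ a * b * (suc n * suc n) ⌋
        open ℚ.≤-Reasoning
    in begin
      + h / e                                         ≤⟨ /-mono-≤ {h} {e} {suc s} {b * suc n} (bound (suc n)) ⟩
      + suc s / (b * suc n)                           ≡⟨ suc-/ s (b * suc n) ⟩
      + s / (b * suc n) ℚ.+ + 1 / (b * suc n)         ≤⟨ ℚ.+-monoʳ-≤ (+ s / (b * suc n))
                                                          (1/n≤ε 0<ε (b * suc n) (≤-trans (m≤n⇒m≤1+n N≤n) (m≤n*m (suc n) b))) ⟩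
      + s / (b * suc n) ℚ.+ ε                         ∎
    where
    bound : ∀ k → h * (b * k) ≤ suc ⌊√ a * b * (k * k) ⌋ * e
    bound k = square-cancel-≤ (begin
      h * (b * k) * (h * (b * k))      ≡⟨ left h b k ⟩
      h * h * b * (b * (k * k))        ≤⟨ *-monoˡ-≤ (b * (k * k)) h²b≤ae² ⟩
      a * (e * e) * (b * (k * k))      ≡⟨ right a e b k ⟩
      a * b * (k * k) * (e * e)        ≤⟨ *-monoˡ-≤ (e * e) (<⇒≤ (proj₂ (⌊√⌋-spec (a * b * (k * k))))) ⟩
      s * s * (e * e)                  ≡⟨ squares s e ⟩
      s * e * (s * e)                  ∎)
      where
      open ≤-Reasoning
      s = suc ⌊√ a * b * (k * k) ⌋
      left : ∀ h b k → h * (b * k) * (h * (b * k)) ≡ h * h * b * (b * (k * k))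
      left = solve-∀
      right : ∀ a e b k → a * (e * e) * (b * (k * k)) ≡ a * b * (k * k) * (e * e)
      right = solve-∀
      squares : ∀ s e → s * s * (e * e) ≡ s * e * (s * e)
      squares = solve-∀

  -- Rounding down keeps every approximant below the root, so the bound holds at each index without
  -- a tolerance.
  seq-√≤ : ∀ {h e a b} .{{_ : NonZero e}} .{{_ : NonZero b}} →
           a * (e * e) ≤ h * h * b → ∀ n → seq √[ a / b ] n ℚ.≤ + h / e
  seq-√≤ {h} {e} {a} {b} ae²≤h²b n =
    /-mono-≤ {⌊√ a * b * (suc n * suc n) ⌋} {b * suc n} {h} {e} {{m*n≢0 b (suc n)}} (bound (suc n))
    where
    bound : ∀ k → ⌊√ a * b * (k * k) ⌋ * e ≤ h * (b * k)
    bound k = square-cancel-≤ (begin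
      s * e * (s * e)                  ≡⟨ squares s e ⟩
      s * s * (e * e)                  ≤⟨ *-monoˡ-≤ (e * e) (proj₁ (⌊√⌋-spec (a * b * (k * k)))) ⟩
      a * b * (k * k) * (e * e)        ≡⟨ right a e b k ⟩
      a * (e * e) * (b * (k * k))      ≤⟨ *-monoˡ-≤ (b * (k * k)) ae²≤h²b ⟩
      h * h * b * (b * (k * k))        ≡⟨ left h b k ⟩
      h * (b * k) * (h * (b * k))      ∎)
      where
      open ≤-Reasoning
      s = ⌊√ a * b * (k * k) ⌋
      left : ∀ h b k → h * h * b * (b * (k * k)) ≡ h * (b * k) * (h * (b * k))
      left = solve-∀
      right : ∀ a e b k → a * b * (k * k) * (e * e) ≡ a * (e * e) * (b * (k * k))
      right = solve-∀
      squares : ∀ s e → s * e * (s * e) ≡ s * s * (e * e)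
      squares = solve-∀

  √≤const : ∀ {h e a b} .{{_ : NonZero e}} .{{_ : NonZero b}} →
            a * (e * e) ≤ h * h * b → √[ a / b ] ≤ᴿ const (+ h / e)
  √≤const {h} {e} {a} {b} ae²≤h²b = ≤-pointwise {√[ a / b ]} {const (+ h / e)} (seq-√≤ {h} {e} {a} {b} ae²≤h²b)

-- Square roots and the end points of I₃ at rational test points

module RealBounds where
  open import Defs
  open Fractions
  open Reals
  open import Data.Integer using (+_)
  open import Data.Nat hiding (_/_)
  open import Data.Nat.Properties
  open import Data.Nat.Tactic.RingSolver using (solve-∀)
  open import Data.Product using (_,_)
  open import Data.Rational as ℚ using (_/_; 1ℚ)
  import Data.Rational.Properties as ℚ
  open import Relation.Binary.PropositionalEquality

  -- If Y² > q j², then one Newton step from Y/j towards √q stays above √q.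
  const≤√⇒ : ∀ {Y j q} .{{_ : NonZero j}} → const (+ Y / j) ≤ᴿ √ q → Y * Y ≤ q * (j * j)
  const≤√⇒ {zero}          h = z≤n
  const≤√⇒ {Y@(suc y)} {j} {q} h = ≮⇒≥ λ qj²<Y² →
    let instance
          _ = m*n≢0 2 Y
          2Yj≢0 = m*n≢0 (2 * Y) j
        -- Here w = Y² - 1. The fraction S/T = (2Y² - 1)/(2Yj) is the Newton step ½(Y/j + qj/Y) with
        -- qj² replaced by its largest possible value Y² - 1.
        w = y + y * Y
        S = suc (2 * w) ; T = 2 * Y * j
        qT²≤S² = begin
          q * (T * T)                ≡⟨ lhs q Y j ⟩
          4 * (Y * Y) * (q * (j * j)) ≤⟨ *-monoʳ-≤ (4 * (Y * Y)) (s≤s⁻¹ qj²<Y²) ⟩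
          4 * suc w * w              ≤⟨ n≤1+n _ ⟩
          suc (4 * suc w * w)        ≡⟨ mid w ⟩
          S * S * 1                  ∎
        Y/j≤S/T = const-cancel-≤ (≤ᴿ-trans {const (+ Y / j)} {√ q} {const (+ S / T)} h
          (√≤const {S} {T} {q} {1} qT²≤S²))
    in <⇒≱ (n<1+n (suc (2 * w))) (*-cancelˡ-≤ j (begin
         j * (2 + 2 * w)   ≡⟨ rhs j w ⟩
         2 * suc w * j     ≡⟨ rhs′ Y j ⟩
         Y * T             ≤⟨ /-cancel-≤ {Y} {j} {S} {T} Y/j≤S/T ⟩
         S * j             ≡⟨ *-comm S j ⟩
         j * S             ∎))
    where
    open ≤-Reasoning
    lhs : ∀ q Y j → q * (2 * Y * j * (2 * Y * j)) ≡ 4 * (Y * Y) * (q * (j * j))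
    lhs = solve-∀
    mid : ∀ w → suc (4 * suc w * w) ≡ suc (2 * w) * suc (2 * w) * 1
    mid = solve-∀
    rhs : ∀ j w → j * (2 + 2 * w) ≡ 2 * suc w * j
    rhs = solve-∀
    rhs′ : ∀ Y j → 2 * (Y * Y) * j ≡ Y * (2 * Y * j)
    rhs′ = solve-∀

  -- If Y² + 1 ≤ k²qj², then Y + 1/(2Y + 1) ≤ √(Y² + 1) ≤ kj√q. Division by kj gives the fraction
  -- S/T ≤ √q, and k(S/T) exceeds Y/j by 1/(j(2Y + 1)).
  ·√≤const⇒ : ∀ {k Y j q} .{{_ : NonZero k}} .{{_ : NonZero j}} →
              (+ k / 1) ·ᴿ √ q ≤ᴿ const (+ Y / j) → k * k * q * (j * j) ≤ Y * Y
  ·√≤const⇒ {k} {Y} {j} {q} h = ≮⇒≥ λ Y²<k²qj² →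
    let instance
          _ = m*n≢0 k j
          kj[2Y+1]≢0 = m*n≢0 (k * j) (suc (2 * Y))
          1kj[2Y+1]≢0 = m*n≢0 1 (k * j * suc (2 * Y))
        S = suc (Y * suc (2 * Y)) ; T = k * j * suc (2 * Y)
        S²≤qT² = begin
          S * S * 1                                           ≡⟨ lhs Y ⟩
          Y * Y * (suc (2 * Y) * suc (2 * Y)) + suc (2 * (Y * suc (2 * Y)))
            ≤⟨ +-monoʳ-≤ (Y * Y * (suc (2 * Y) * suc (2 * Y))) (≤-trans (m≤m+n _ (2 * Y)) (≤-reflexive (mid Y))) ⟩
          Y * Y * (suc (2 * Y) * suc (2 * Y)) + suc (2 * Y) * suc (2 * Y)
            ≡⟨ +-comm (Y * Y * (suc (2 * Y) * suc (2 * Y))) _ ⟩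
          suc (Y * Y) * (suc (2 * Y) * suc (2 * Y))           ≤⟨ *-monoˡ-≤ (suc (2 * Y) * suc (2 * Y)) Y²<k²qj² ⟩
          k * k * q * (j * j) * (suc (2 * Y) * suc (2 * Y))   ≡⟨ rhs k q j (suc (2 * Y)) ⟩
          q * (T * T)                                         ∎
        kS/T≤Y/j = const-cancel-≤ (≤ᴿ-trans {const _} {(+ k / 1) ·ᴿ const (+ S / T)} {const (+ Y / j)}
          (≤-pointwise {const (+ (k * S) / (1 * T))} {(+ k / 1) ·ᴿ const (+ S / T)} (λ _ → ℚ.≤-reflexive (sym (*-/ k 1 S T))))
          (≤ᴿ-trans {(+ k / 1) ·ᴿ const (+ S / T)} {(+ k / 1) ·ᴿ √ q} {const (+ Y / j)}
            (·ᴿ-monoʳ-≤ k 1 {const (+ S / T)} {√ q} (const≤√ {S} {T} {q} {1} S²≤qT²)) h))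
    in <⇒≱ (n<1+n (Y * suc (2 * Y))) (*-cancelˡ-≤ (k * j) (begin
         k * j * S               ≡⟨ shuffle k j S ⟩
         k * S * j               ≤⟨ /-cancel-≤ {k * S} {1 * T} {Y} {j} kS/T≤Y/j ⟩
         Y * (1 * T)             ≡⟨ shuffle′ Y (k * j) (suc (2 * Y)) ⟩
         k * j * (Y * suc (2 * Y)) ∎))
    where
    open ≤-Reasoning
    lhs : ∀ Y → suc (Y * suc (2 * Y)) * suc (Y * suc (2 * Y)) * 1 ≡
                Y * Y * (suc (2 * Y) * suc (2 * Y)) + suc (2 * (Y * suc (2 * Y)))
    lhs = solve-∀
    mid : ∀ Y → suc (2 * (Y * suc (2 * Y))) + 2 * Y ≡ suc (2 * Y) * suc (2 * Y)
    mid = solve-∀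
    rhs : ∀ k q j u → k * k * q * (j * j) * (u * u) ≡ q * (k * j * u * (k * j * u))
    rhs = solve-∀
    shuffle : ∀ k j S → k * j * S ≡ k * S * j
    shuffle = solve-∀
    shuffle′ : ∀ Y k u → Y * (1 * (k * u)) ≡ k * (Y * u)
    shuffle′ = solve-∀

  -ᴿ-monoʳ-≤ : ∀ z {x y} → x ≤ᴿ y → z -ᴿ y ≤ᴿ z -ᴿ x
  -ᴿ-monoʳ-≤ z {x} {y} x≤y ε 0<ε =
    let N , h = x≤y ε 0<ε
    in N , λ n N≤n → flip (seq z n) (seq x n) (seq y n) (h n N≤n)
    where
    flip : ∀ c a b → a ℚ.≤ b ℚ.+ ε → c ℚ.+ (ℚ.- 1ℚ) ℚ.* b ℚ.≤ c ℚ.+ (ℚ.- 1ℚ) ℚ.* a ℚ.+ ε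
    flip c a b a≤b+ε = subst₂ ℚ._≤_ (lhs c a b) (rhs c a b ε) (ℚ.+-monoʳ-≤ (c ℚ.- a ℚ.- b) a≤b+ε)
      where
      open import Data.Rational.Solver
      open +-*-Solver
      lhs : ∀ c a b → c ℚ.- a ℚ.- b ℚ.+ a ≡ c ℚ.+ (ℚ.- 1ℚ) ℚ.* b
      lhs = solve 3 (λ c a b → c :- a :- b :+ a := c :+ con (ℚ.- 1ℚ) :* b) refl
      rhs : ∀ c a b ε → c ℚ.- a ℚ.- b ℚ.+ (b ℚ.+ ε) ≡ c ℚ.+ (ℚ.- 1ℚ) ℚ.* a ℚ.+ ε
      rhs = solve 4 (λ c a b ε → c :- a :- b :+ (b :+ ε) := c :+ con (ℚ.- 1ℚ) :* a :+ ε) refl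

  ≤-⇒-≤ : ∀ {a b c} → a ℚ.+ b ℚ.≤ c → a ℚ.≤ c ℚ.+ (ℚ.- 1ℚ) ℚ.* b
  ≤-⇒-≤ {a} {b} {c} h = subst₂ ℚ._≤_ (lhs a b) (rhs b c) (ℚ.+-monoˡ-≤ (ℚ.- b) h)
    where
    open import Data.Rational.Solver
    open +-*-Solver
    lhs : ∀ a b → a ℚ.+ b ℚ.- b ≡ a
    lhs = solve 2 (λ a b → a :+ b :- b := a) refl
    rhs : ∀ b c → c ℚ.- b ≡ c ℚ.+ (ℚ.- 1ℚ) ℚ.* b
    rhs = solve 2 (λ b c → c :- b := c :+ con (ℚ.- 1ℚ) :* b) refl

  -≤⇐≤+ : ∀ {a b c} → a ℚ.≤ c ℚ.+ b → a ℚ.+ (ℚ.- 1ℚ) ℚ.* b ℚ.≤ c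
  -≤⇐≤+ {a} {b} {c} h = subst₂ ℚ._≤_ (lhs a b) (rhs b c) (ℚ.+-monoˡ-≤ (ℚ.- b) h)
    where
    open import Data.Rational.Solver
    open +-*-Solver
    lhs : ∀ a b → a ℚ.- b ≡ a ℚ.+ (ℚ.- 1ℚ) ℚ.* b
    lhs = solve 2 (λ a b → a :- b := a :+ con (ℚ.- 1ℚ) :* b) refl
    rhs : ∀ b c → c ℚ.+ b ℚ.- b ≡ c
    rhs = solve 2 (λ b c → c :+ b :- b := c) refl

  2[H/2tj] : ∀ H t j .{{_ : NonZero t}} .{{_ : NonZero j}} →
    let instance _ = m*n≢0 t j ; _ = m*n≢0 2 (t * j)
    in fromℕ 2 ℚ.* (+ H / (2 * (t * j))) ≡ + H / (t * j)
  2[H/2tj] H t j =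
    let instance _ = m*n≢0 t j ; _ = m*n≢0 2 (t * j) ; _ = m*n≢0 1 (2 * (t * j))
    in trans (*-/ 2 1 H (2 * (t * j))) (/-cross {2 * H} {1 * (2 * (t * j))} {H} {t * j} (lemma H (t * j)))
    where
    lemma : ∀ H u → 2 * H * u ≡ H * (1 * (2 * u))
    lemma = solve-∀

  H/2tj≤√m/t : ∀ {H m t j} .{{_ : NonZero t}} .{{_ : NonZero j}} → H * H ≤ 4 * m * t * (j * j) →
    let instance _ = m*n≢0 t j ; _ = m*n≢0 2 (t * j)
    in const (+ H / (2 * (t * j))) ≤ᴿ √[ m / t ]
  H/2tj≤√m/t {H} {m} {t} {j} H²≤ =
    let instance _ = m*n≢0 t j ; _ = m*n≢0 2 (t * j)
    in const≤√ {H} {2 * (t * j)} {m} {t} (≤-trans (*-monoˡ-≤ t H²≤) (≤-reflexive (lemma m t j)))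
    where
    lemma : ∀ m t j → 4 * m * t * (j * j) * t ≡ m * (2 * (t * j) * (2 * (t * j)))
    lemma = solve-∀

  -- `H` is an integer below 2j√(mt), so H/(2tj) underestimates √(m/t) and W/t + H/(tj)
  -- underestimates the left end point of I₃. The test point Y/j lies below that, hence below √q.
  lower-bound : ∀ {m W t q H j Y} .{{_ : NonZero t}} .{{_ : NonZero j}} →
    const (+ W / t) +ᴿ fromℕ 2 ·ᴿ √[ m / t ] ≤ᴿ √ q →
    H * H ≤ 4 * m * t * (j * j) → t * Y ≤ W * j + H → Y * Y ≤ q * (j * j)
  lower-bound {m} {W} {t} {q} {H} {j} {Y} l≤√q H²≤ tY≤ =
    const≤√⇒ {Y} {j} {q} (≤ᴿ-trans {const (+ Y / j)} {l} {√ q} Y/j≤l l≤√q)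
    where
    instance
      _ = m*n≢0 t j
      _ = m*n≢0 2 (t * j)
      _ = m*n≢0 t (t * j)
    l  = const (+ W / t) +ᴿ fromℕ 2 ·ᴿ √[ m / t ]
    l′ = const (+ W / t) +ᴿ fromℕ 2 ·ᴿ const (+ H / (2 * (t * j)))
    Y/j≤ : + Y / j ℚ.≤ + W / t ℚ.+ fromℕ 2 ℚ.* (+ H / (2 * (t * j)))
    Y/j≤ = subst (+ Y / j ℚ.≤_)
      (sym (trans (cong (+ W / t ℚ.+_) (2[H/2tj] H t j)) (+-/ W t H (t * j))))
      (/-mono-≤ {Y} {j} {W * (t * j) + H * t} {t * (t * j)} (begin
        Y * (t * (t * j))           ≡⟨ lhs Y t j ⟩
        t * j * (t * Y)             ≤⟨ *-monoʳ-≤ (t * j) tY≤ ⟩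
        t * j * (W * j + H)         ≡⟨ rhs W H t j ⟩
        (W * (t * j) + H * t) * j   ∎))
      where
      open ≤-Reasoning
      lhs : ∀ Y t j → Y * (t * (t * j)) ≡ t * j * (t * Y)
      lhs = solve-∀
      rhs : ∀ W H t j → t * j * (W * j + H) ≡ (W * (t * j) + H * t) * j
      rhs = solve-∀
    Y/j≤l : const (+ Y / j) ≤ᴿ l
    Y/j≤l = ≤ᴿ-trans {const (+ Y / j)} {l′} {l} (≤-pointwise {const (+ Y / j)} {l′} λ _ → Y/j≤)
      (+ᴿ-monoʳ-≤ (const (+ W / t)) {fromℕ 2 ·ᴿ const (+ H / (2 * (t * j)))} {fromℕ 2 ·ᴿ √[ m / t ]}
        (·ᴿ-monoʳ-≤ 2 1 {const (+ H / (2 * (t * j)))} {√[ m / t ]} (H/2tj≤√m/t {H} {m} {t} {j} H²≤)))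

  -- The root is subtracted here, so underestimating it by H/(2sj) moves the right end point up, and
  -- Y/j lies above the result. `H` is therefore again a bound from below.
  upper-bound : ∀ {m W s q H j Y} .{{_ : NonZero s}} .{{_ : NonZero j}} →
    √ q ≤ᴿ const (+ W / s) -ᴿ fromℕ 2 ·ᴿ √[ m / s ] →
    H * H ≤ 4 * m * s * (j * j) → W * j ≤ s * Y + H → q * (j * j) ≤ Y * Y
  upper-bound {m} {W} {s} {q} {H} {j} {Y} √q≤u H²≤ Wj≤ =
    subst (λ x → x * (j * j) ≤ Y * Y) (*-identityˡ q)
      (·√≤const⇒ {1} {Y} {j} {q} (≤ᴿ-trans {1ℚ ·ᴿ √ q} {√ q} {const (+ Y / j)}
        (≤-pointwise {1ℚ ·ᴿ √ q} {√ q} λ n → ℚ.≤-reflexive (ℚ.*-identityˡ (seq (√ q) n)))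
        (≤ᴿ-trans {√ q} {u} {const (+ Y / j)} √q≤u u≤Y/j)))
    where
    instance
      _ = m*n≢0 s j
      _ = m*n≢0 2 (s * j)
      _ = m*n≢0 j (s * j)
    u  = const (+ W / s) -ᴿ fromℕ 2 ·ᴿ √[ m / s ]
    u′ = const (+ W / s) -ᴿ fromℕ 2 ·ᴿ const (+ H / (2 * (s * j)))
    W/s≤ : + W / s ℚ.≤ + Y / j ℚ.+ fromℕ 2 ℚ.* (+ H / (2 * (s * j)))
    W/s≤ = subst (+ W / s ℚ.≤_)
      (sym (trans (cong (+ Y / j ℚ.+_) (2[H/2tj] H s j)) (+-/ Y j H (s * j))))
      (/-mono-≤ {W} {s} {Y * (s * j) + H * j} {j * (s * j)} (begin
        W * (j * (s * j))           ≡⟨ lhs W s j ⟩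
        s * j * (W * j)             ≤⟨ *-monoʳ-≤ (s * j) Wj≤ ⟩
        s * j * (s * Y + H)         ≡⟨ rhs Y H s j ⟩
        (Y * (s * j) + H * j) * s   ∎))
      where
      open ≤-Reasoning
      lhs : ∀ W s j → W * (j * (s * j)) ≡ s * j * (W * j)
      lhs = solve-∀
      rhs : ∀ Y H s j → s * j * (s * Y + H) ≡ (Y * (s * j) + H * j) * s
      rhs = solve-∀
    u≤Y/j : u ≤ᴿ const (+ Y / j)
    u≤Y/j = ≤ᴿ-trans {u} {u′} {const (+ Y / j)}
      (-ᴿ-monoʳ-≤ (const (+ W / s)) {fromℕ 2 ·ᴿ const (+ H / (2 * (s * j)))} {fromℕ 2 ·ᴿ √[ m / s ]}
        (·ᴿ-monoʳ-≤ 2 1 {const (+ H / (2 * (s * j)))} {√[ m / s ]} (H/2tj≤√m/t {H} {m} {s} {j} H²≤)))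
      (≤-pointwise {u′} {const (+ Y / j)} λ _ → -≤⇐≤+ W/s≤)

-- From the Cauchy-Schwarz bound to the position of √q

module IntervalGaps where
  open IntegerOrder
  open import Data.Integer
  open import Data.Integer.Properties
  import Data.Nat as ℕ
  open import Data.List using ([]; _∷_)
  open import Relation.Binary.PropositionalEquality
  open import Data.Integer.Tactic.RingSolver using (solve)

  -- E is (N√q - mκ)² ≤ 2mN(b + 2 - κ√q), arranged so that √q occurs only squared.
  -- As b < κ√q, the right-hand side is less than 4mN.
  module _ {m κ q b N}
    (0≤m : 0ℤ ≤ m) (0<N : 0ℤ < N)
    (E : m * κ * (m * κ) + q * (N * N) ≤ + 2 * m * N * (b + + 2))
    (b²<κ²q : b * b < κ * κ * q) where

    -- Multiplying `E` by κ² and lowering κ²q to b² completes the square: (mκ² - Nb)² ≤ 4mNκ².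
    -- Passing from N to s shrinks the nonnegative left base and enlarges the right side. In
    -- `upper-bound` this is the test point b/κ with H = mκ² - sb.
    above : ∀ {s} → 0ℤ ≤ b → N ≤ s → s * b ≤ m * κ * κ →
            (m * κ * κ - s * b) * (m * κ * κ - s * b) ≤ + 4 * m * s * (κ * κ)
    above {s} 0≤b N≤s sb≤Wκ = by
      (sq κ ⊗ le E ⊕ sq N ⊗ le (<⇒≤ b²<κ²q)
        ⊕ le N≤s ⊗ 0≤b ⊗ (lit 2 ⊗ le sb≤Wκ ⊕ le N≤s ⊗ 0≤b) ⊕ lit 4 ⊗ 0≤m ⊗ sq κ ⊗ le N≤s)
      (solve (m ∷ κ ∷ q ∷ b ∷ N ∷ s ∷ []))

    -- The hypothesis `close` pays for replacing √q by Y/j in `E`, which gives Y/j ≤ mκ/N + 2√(m/N).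
    -- The right side decreases in N, so t may replace N. In `lower-bound` the corresponding H is tY
    -- - mκj.
    below : ∀ {t Y j} → 0ℤ ≤ κ → 0ℤ ≤ t → t ≤ N → 0ℤ ≤ j → m * κ * j ≤ t * Y →
            N * (Y * Y - q * (j * j)) ≤ + 2 * m * j * (κ * Y - b * j) →
            (t * Y - m * κ * j) * (t * Y - m * κ * j) ≤ + 4 * m * t * (j * j)
    below {t} {Y} {j} 0≤κ 0≤t t≤N 0≤j Wj≤tY close = *-cancelˡ {N} 0<N ND²≤4mNtj²
      where
      G²≤ : (N * Y - m * κ * j) * (N * Y - m * κ * j) ≤ + 4 * m * N * (j * j)
      G²≤ = by (sq j ⊗ le E ⊕ <⇒≤ 0<N ⊗ le close) (solve (m ∷ κ ∷ q ∷ b ∷ N ∷ Y ∷ j ∷ []))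
      ND≤tG : N * (t * Y - m * κ * j) ≤ t * (N * Y - m * κ * j)
      ND≤tG = by (le t≤N ⊗ 0≤m ⊗ 0≤κ ⊗ 0≤j) (solve (m ∷ κ ∷ N ∷ t ∷ Y ∷ j ∷ []))
      N²D²≤t²G² : N * (t * Y - m * κ * j) * (N * (t * Y - m * κ * j)) ≤
                  t * (N * Y - m * κ * j) * (t * (N * Y - m * κ * j))
      N²D²≤t²G² = by (le ND≤tG ⊗ (le ND≤tG ⊕ lit 2 ⊗ <⇒≤ 0<N ⊗ le Wj≤tY))
        (solve (m ∷ κ ∷ N ∷ t ∷ Y ∷ j ∷ []))
      N²D²≤ : N * (N * ((t * Y - m * κ * j) * (t * Y - m * κ * j))) ≤ N * (+ 4 * m * (t * t) * (j * j))
      N²D²≤ = by (sq t ⊗ le G²≤ ⊕ le N²D²≤t²G²) (solve (m ∷ κ ∷ N ∷ t ∷ Y ∷ j ∷ []))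
      ND²≤ : N * ((t * Y - m * κ * j) * (t * Y - m * κ * j)) ≤ + 4 * m * (t * t) * (j * j)
      ND²≤ = *-cancelˡ {N} 0<N N²D²≤
      ND²≤4mNtj² : N * ((t * Y - m * κ * j) * (t * Y - m * κ * j)) ≤ N * (+ 4 * m * t * (j * j))
      ND²≤4mNtj² = by (le ND²≤ ⊕ lit 4 ⊗ 0≤m ⊗ 0≤t ⊗ sq j ⊗ le t≤N) (solve (m ∷ κ ∷ N ∷ t ∷ Y ∷ j ∷ []))

    -- Since Y exceeds the floor v by 1, Y² - qj² ≤ 2Y. Since κ²q - b² ≥ 1, also (κY)² - (bj)² ≥ j²,
    -- whence κY - bj ≥ j²/(2κY). So 2κNY² ≤ mj³ suffices, and Y ≤ 2qj reduces this to 8κNq² ≤ mj,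
    -- which the choice of `j` satisfies.
    close-approximation : ∀ {j Y v} → j ≡ + 8 * κ * N * (q * q) →
      1ℤ ≤ m → 1ℤ ≤ κ → 1ℤ ≤ q → 0ℤ ≤ b → 0ℤ ≤ v → Y ≡ 1ℤ + v →
      v * v ≤ q * (j * j) → q * (j * j) < Y * Y →
      N * (Y * Y - q * (j * j)) ≤ + 2 * m * j * (κ * Y - b * j)
    close-approximation {j} {Y} {v} j≡ 1≤m 1≤κ 1≤q 0≤b 0≤v Y≡1+v v²≤qj² qj²<Y² = by
      (lit 2 ⊗ le NY≤ ⊕ 0≤N ⊗ (le v²≤qj² ⊕ eq Y≡1+v (- (1ℤ + v + Y)) ⊕ eq Y≡1+v (+ 2) ⊕ lit 1))
      (solve (m ∷ κ ∷ q ∷ b ∷ N ∷ j ∷ Y ∷ v ∷ []))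
      where
      0≤N : 0ℤ ≤ N
      0≤N = <⇒≤ 0<N
      1≤N : 1ℤ ≤ N
      1≤N = i<j⇒suc[i]≤j 0<N
      0≤κ : 0ℤ ≤ κ
      0≤κ = ≤-trans (lit 1) 1≤κ
      1≤* : ∀ {x y} → 1ℤ ≤ x → 1ℤ ≤ y → 1ℤ ≤ x * y
      1≤* {x} {y} 1≤x 1≤y = by (le 1≤x ⊗ le 1≤y ⊕ le 1≤x ⊕ le 1≤y) (solve (x ∷ y ∷ []))
      1≤j : 1ℤ ≤ j
      1≤j = subst (1ℤ ≤_) (sym j≡) (1≤* {+ 8 * κ * N} {q * q}
        (1≤* {+ 8 * κ} {N} (1≤* {+ 8} {κ} (+≤+ (ℕ.s≤s ℕ.z≤n)) 1≤κ) 1≤N) (1≤* {q} {q} 1≤q 1≤q))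
      0≤j : 0ℤ ≤ j
      0≤j = ≤-trans (lit 1) 1≤j
      1≤qj : 1ℤ ≤ q * j
      1≤qj = 1≤* {q} {j} 1≤q 1≤j
      0≤qj : 0ℤ ≤ q * j
      0≤qj = ≤-trans (lit 1) 1≤qj
      0<Y : 0ℤ < Y
      0<Y = by< (0≤v ⊕ eq Y≡1+v 1ℤ) (solve (Y ∷ v ∷ []))
      v²≤[qj]² : v * v ≤ q * j * (q * j)
      v²≤[qj]² = by (le v²≤qj² ⊕ (le 1≤q ⊕ lit 1) ⊗ le 1≤q ⊗ sq j) (solve (q ∷ j ∷ v ∷ []))
      v≤qj : v ≤ q * j
      v≤qj = square-cancel-≤ 0≤qj v²≤[qj]²
      Y≤2qj : Y ≤ + 2 * (q * j)
      Y≤2qj = by (le v≤qj ⊕ le 1≤qj ⊕ eq Y≡1+v (- 1ℤ)) (solve (q ∷ j ∷ Y ∷ v ∷ []))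
      Y²≤4q²j² : Y * Y ≤ + 4 * (q * q) * (j * j)
      Y²≤4q²j² = by (le Y≤2qj ⊗ (lit 2 ⊗ 0≤qj ⊕ <⇒≤ 0<Y)) (solve (q ∷ j ∷ Y ∷ []))
      2κNY²≤j³ : + 2 * κ * N * (Y * Y) ≤ j * (j * j)
      2κNY²≤j³ = by (lit 2 ⊗ 0≤κ ⊗ 0≤N ⊗ le Y²≤4q²j² ⊕ eq j≡ (j * j)) (solve (κ ∷ q ∷ N ∷ j ∷ Y ∷ []))
      j²≤ : j * j ≤ (κ * Y - b * j) * (+ 2 * (κ * Y))
      j²≤ = by (sq κ ⊗ le (<⇒≤ qj²<Y²) ⊕ sq j ⊗ lt b²<κ²q ⊕ sq (κ * Y - b * j))
        (solve (κ ∷ q ∷ b ∷ j ∷ Y ∷ []))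
      2κY[NY]≤ : + 2 * (κ * Y) * (N * Y) ≤ + 2 * (κ * Y) * (m * j * (κ * Y - b * j))
      2κY[NY]≤ = by (≤-trans (lit 1) 1≤m ⊗ 0≤j ⊗ le j²≤ ⊕ le 1≤m ⊗ 0≤j ⊗ sq j ⊕ le 2κNY²≤j³)
        (solve (m ∷ κ ∷ b ∷ N ∷ j ∷ Y ∷ []))
      0<2κY : 0ℤ < + 2 * (κ * Y)
      0<2κY = suc[i]≤j⇒i<j (1≤* {+ 2} {κ * Y} (+≤+ (ℕ.s≤s ℕ.z≤n)) (1≤* {κ} {Y} 1≤κ (i<j⇒suc[i]≤j 0<Y)))
      NY≤ : N * Y ≤ m * j * (κ * Y - b * j)
      NY≤ = *-cancelˡ {+ 2 * (κ * Y)} 0<2κY 2κY[NY]≤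

-- Transfer of polynomial inequalities between ℕ and ℤ

module Casts where
  open import Data.Integer as ℤ using (ℤ; +_)
  import Data.Integer.Properties as ℤ
  open import Data.Nat
  open import Relation.Binary.PropositionalEquality hiding ([_])

  infixl 6 _⟨+⟩_
  infixl 7 _⟨*⟩_

  -- The combinators follow the syntax of a natural number expression and push `+_` to its leaves,
  -- the form in which the integer certificates are stated.
  [_] : ∀ a → + a ≡ + a
  [ a ] = refl

  _⟨+⟩_ : ∀ {a b x y} → + a ≡ x → + b ≡ y → + (a + b) ≡ x ℤ.+ y
  refl ⟨+⟩ refl = refl

  _⟨*⟩_ : ∀ {a b x y} → + a ≡ x → + b ≡ y → + (a * b) ≡ x ℤ.* y
  _⟨*⟩_ {a} {b} refl refl = ℤ.pos-* a b

  ≤ℤ : ∀ {a b x y} → + a ≡ x → + b ≡ y → a ≤ b → x ℤ.≤ y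
  ≤ℤ refl refl = ℤ.+≤+

  <ℤ : ∀ {a b x y} → + a ≡ x → + b ≡ y → a < b → x ℤ.< y
  <ℤ refl refl = ℤ.+<+

  ≤ℕ : ∀ {a b x y} → + a ≡ x → + b ≡ y → x ℤ.≤ y → a ≤ b
  ≤ℕ refl refl = ℤ.drop‿+≤+

  <ℕ : ∀ {a b x y} → + a ≡ x → + b ≡ y → x ℤ.< y → a < b
  <ℕ refl refl = ℤ.drop‿+<+

-- √q lies outside I₃

module I₃Gap where
  open import Defs
  open IntegerOrder
  open IntervalGaps
  open Casts
  open RealBounds
  open import Data.Integer as ℤ using (ℤ; +_; 0ℤ; 1ℤ)
  import Data.Integer.Properties as ℤ
  open import Data.Maybe using (just; nothing)
  open import Data.Nat
  open import Data.Nat.Properties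
  open import Data.Nat.DivMod using (_%_)
  open import Data.Integer.Tactic.RingSolver using (solve-∀)
  open import Data.Product using (proj₁; proj₂)
  open import Data.Sum using (_⊎_; inj₁; inj₂; map₂)
  open import Data.Empty using (⊥)
  open import Data.Rational using () renaming (_/_ to _/ℚ_)
  open import Relation.Binary.PropositionalEquality hiding ([_])

  ∈⇒lower≤ : ∀ {x l u} → x ∈ᴵ [ l ⋯ u ] → l ≤ᴿ x
  ∈⇒lower≤ {u = just _}  = proj₁
  ∈⇒lower≤ {u = nothing} h = h

  same-parity-gap : ∀ {n t} → n % 2 ≡ t % 2 → n < t → 2 + n ≤ t
  same-parity-gap {zero}        {suc (suc t)} _ _ = s≤s (s≤s z≤n)
  same-parity-gap {suc zero}    {suc zero}    _ (s≤s ())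
  same-parity-gap {suc zero}    {suc (suc (suc t))} _ _ = s≤s (s≤s (s≤s z≤n))
  same-parity-gap {suc (suc n)} {suc (suc t)} e (s≤s (s≤s n<t)) = s≤s (s≤s (same-parity-gap {n} {t} e n<t))

  nonneg-difference : ∀ {x y} → x ℤ.≤ y → + ℤ.∣ y ℤ.- x ∣ ≡ y ℤ.- x
  nonneg-difference x≤y = ℤ.0≤i⇒+∣i∣≡i (le x≤y)

  x+[y-x] : ∀ x y → x ℤ.+ (y ℤ.- x) ≡ y
  x+[y-x] = solve-∀

  module _ {m κ q b N : ℕ} .{{_ : NonZero m}} .{{_ : NonZero κ}} .{{_ : NonZero q}} .{{_ : NonZero N}}
    (E : + m ℤ.* + κ ℤ.* (+ m ℤ.* + κ) ℤ.+ + q ℤ.* (+ N ℤ.* + N) ℤ.≤ + 2 ℤ.* + m ℤ.* + N ℤ.* (+ b ℤ.+ + 2))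
    (b²<κ²q : + b ℤ.* + b ℤ.< + κ ℤ.* + κ ℤ.* + q) where

    private
      0<N : 0ℤ ℤ.< + N
      0<N = ℤ.+<+ (>-nonZero⁻¹ N)
      1≤m : 1ℤ ℤ.≤ + m
      1≤m = ℤ.+≤+ (>-nonZero⁻¹ m)
      1≤κ : 1ℤ ℤ.≤ + κ
      1≤κ = ℤ.+≤+ (>-nonZero⁻¹ κ)
      1≤q : 1ℤ ℤ.≤ + q
      1≤q = ℤ.+≤+ (>-nonZero⁻¹ q)

    upper<√q : ∀ {s} .{{_ : NonZero s}} → N ≤ s →
               √ q ≤ᴿ const (+ (m * κ) /ℚ s) -ᴿ fromℕ 2 ·ᴿ √[ m / s ] → ⊥
    upper<√q {s} N≤s √q≤u with ≤-total (m * κ * κ) (s * b)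
    -- Here mκ/s is already at most b/κ, so H = 0 is enough.
    ... | inj₁ Wκ≤sb = <⇒≱ (<ℕ ([ b ] ⟨*⟩ [ b ]) ([ κ ] ⟨*⟩ [ κ ] ⟨*⟩ [ q ]) b²<κ²q)
      (≤-trans (≤-reflexive (*-comm (κ * κ) q))
        (upper-bound {m} {m * κ} {s} {q} {0} {κ} {b} √q≤u z≤n (≤-trans Wκ≤sb (m≤m+n (s * b) 0))))
    ... | inj₂ sb≤Wκ = <⇒≱ (<ℕ ([ b ] ⟨*⟩ [ b ]) ([ κ ] ⟨*⟩ [ κ ] ⟨*⟩ [ q ]) b²<κ²q)
      (≤-trans (≤-reflexive (*-comm (κ * κ) q))
        (upper-bound {m} {m * κ} {s} {q} {H} {κ} {b} √q≤u
          (≤ℕ (H≡ ⟨*⟩ H≡) ([ 4 ] ⟨*⟩ [ m ] ⟨*⟩ [ s ] ⟨*⟩ ([ κ ] ⟨*⟩ [ κ ]))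
            (above {+ m} {+ κ} {+ q} {+ b} {+ N} (ℤ.+≤+ z≤n) 0<N E b²<κ²q {+ s} (ℤ.+≤+ z≤n) (ℤ.+≤+ N≤s) sb≤Wκ′))
          (≤ℕ ([ m ] ⟨*⟩ [ κ ] ⟨*⟩ [ κ ]) ([ s ] ⟨*⟩ [ b ] ⟨+⟩ H≡)
            (ℤ.≤-reflexive (sym (x+[y-x] (+ s ℤ.* + b) (+ m ℤ.* + κ ℤ.* + κ)))))))
      where
      D = + m ℤ.* + κ ℤ.* + κ ℤ.- + s ℤ.* + b
      sb≤Wκ′ : + s ℤ.* + b ℤ.≤ + m ℤ.* + κ ℤ.* + κ
      sb≤Wκ′ = ≤ℤ ([ s ] ⟨*⟩ [ b ]) ([ m ] ⟨*⟩ [ κ ] ⟨*⟩ [ κ ]) sb≤Wκ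
      H = ℤ.∣ D ∣
      H≡ : + H ≡ D
      H≡ = nonneg-difference sb≤Wκ′

    √q<lower : ∀ {t} .{{_ : NonZero t}} → t ≤ N →
               const (+ (m * κ) /ℚ t) +ᴿ fromℕ 2 ·ᴿ √[ m / t ] ≤ᴿ √ q → ⊥
    √q<lower {t} t≤N l≤√q = <⇒≱ qj²<Y² (Y²≤qj² (≤-total (t * Y) (m * κ * j)))
      where
      -- The denominator required by `close-approximation`; Y/j is then the least fraction with this
      -- denominator above √q.
      j = 8 * κ * N * (q * q)
      v = ⌊√ q * (j * j) ⌋
      Y = suc v
      instance
        j≢0 : NonZero j
        j≢0 = m*n≢0 (8 * κ * N) (q * q) {{m*n≢0 (8 * κ) N {{m*n≢0 8 κ}}}} {{m*n≢0 q q}}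
      qj²<Y² : q * (j * j) < Y * Y
      qj²<Y² = proj₂ (⌊√⌋-spec (q * (j * j)))
      D = + t ℤ.* + Y ℤ.- + m ℤ.* + κ ℤ.* + j
      H = ℤ.∣ D ∣
      qj² = [ q ] ⟨*⟩ ([ j ] ⟨*⟩ [ j ])
      tY  = [ t ] ⟨*⟩ [ Y ]
      Wj  = [ m ] ⟨*⟩ [ κ ] ⟨*⟩ [ j ]
      Y²≤qj² : (t * Y ≤ m * κ * j) ⊎ (m * κ * j ≤ t * Y) → Y * Y ≤ q * (j * j)
      Y²≤qj² (inj₁ tY≤Wj) = lower-bound {m} {m * κ} {t} {q} {0} {j} {Y} l≤√q z≤n
        (≤-trans tY≤Wj (m≤m+n (m * κ * j) 0))
      Y²≤qj² (inj₂ Wj≤tY) = lower-bound {m} {m * κ} {t} {q} {H} {j} {Y} l≤√q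
        (≤ℕ (H≡ ⟨*⟩ H≡) ([ 4 ] ⟨*⟩ [ m ] ⟨*⟩ [ t ] ⟨*⟩ ([ j ] ⟨*⟩ [ j ]))
          (below {+ m} {+ κ} {+ q} {+ b} {+ N} (ℤ.+≤+ z≤n) 0<N E b²<κ²q {+ t} {+ Y} {+ j} (ℤ.+≤+ z≤n) (ℤ.+≤+ z≤n) (ℤ.+≤+ t≤N) (ℤ.+≤+ z≤n) (≤ℤ Wj tY Wj≤tY)
            (close-approximation {+ m} {+ κ} {+ q} {+ b} {+ N} (ℤ.+≤+ z≤n) 0<N E b²<κ²q {+ j} {+ Y} {+ v} ([ 8 ] ⟨*⟩ [ κ ] ⟨*⟩ [ N ] ⟨*⟩ ([ q ] ⟨*⟩ [ q ]))
              1≤m 1≤κ 1≤q (ℤ.+≤+ z≤n) (ℤ.+≤+ z≤n) refl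
              (≤ℤ ([ v ] ⟨*⟩ [ v ]) qj² (proj₁ (⌊√⌋-spec (q * (j * j))))) (<ℤ qj² ([ Y ] ⟨*⟩ [ Y ]) qj²<Y²))))
        (≤ℕ tY (Wj ⟨+⟩ H≡) (ℤ.≤-reflexive (sym (x+[y-x] (+ m ℤ.* + κ ℤ.* + j) (+ t ℤ.* + Y)))))
        where
        H≡ : + H ≡ D
        H≡ = nonneg-difference (≤ℤ Wj tY Wj≤tY)

    -- Parity excludes N = t - 1, which leaves N ≥ t or N ≤ t - 2. In the second case N > 0 forces t
    -- ≥ 3, so the right end point is finite there and s = t - 2 ≥ N.
    √q∉I₃ : ∀ {t} .{{_ : NonZero t}} → N % 2 ≡ t % 2 → √ q ∈ᴵ I₃ m κ t → ⊥
    √q∉I₃ {t} N≡t √q∈ = split t √q∈ (map₂ (same-parity-gap N≡t) (≤-<-connex t N))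
      where
      split : ∀ t .{{_ : NonZero t}} → √ q ∈ᴵ I₃ m κ t → t ≤ N ⊎ 2 + N ≤ t → ⊥
      split t@(suc _)               √q∈ (inj₁ t≤N)             = √q<lower t≤N (∈⇒lower≤ {√ q} √q∈)
      split 2                       √q∈ (inj₂ (s≤s (s≤s N≤0))) = <⇒≱ (>-nonZero⁻¹ N) N≤0
      split (suc (suc (suc s)))     √q∈ (inj₂ (s≤s (s≤s N≤s))) = upper<√q {suc s} N≤s (proj₂ √q∈)

-- The rationals as a ring for the solver

module ℚRing where
  open import Data.Rational
  open import Data.Rational.Properties
  open import Relation.Nullary.Decidable using (dec⇒maybe)
  open import Tactic.RingSolver.Core.AlmostCommutativeRing
  open import Level using (0ℓ)

  ℚ-ring : AlmostCommutativeRing 0ℓ 0ℓ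
  ℚ-ring = fromCommutativeRing +-*-commutativeRing λ x → dec⇒maybe (0ℚ ≟ x)


-- K as a commutative ring

module BiquadraticRing (p q : ℕ) where
  open ℚRing
  open Defs using (fromℕ)
  open Defs.Biquadratic p q
  open import Algebra.Structures using (IsCommutativeRing)
  open import Data.Product using (_,_)
  open import Data.Rational
  open import Data.Rational.Properties
  open import Relation.Binary.PropositionalEquality
  open import Tactic.RingSolver using (solve-∀)

  -ᴷ_ : K → K
  -ᴷ ⟨ a , b , c , d ⟩ = ⟨ - a , - b , - c , - d ⟩

  0ᴷ 1ᴷ : K
  0ᴷ = fromRational 0ℚ
  1ᴷ = fromRational 1ℚ

  K-≡ : ∀ {a b c d a′ b′ c′ d′} → a ≡ a′ → b ≡ b′ → c ≡ c′ → d ≡ d′ →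
        ⟨ a , b , c , d ⟩ ≡ ⟨ a′ , b′ , c′ , d′ ⟩
  K-≡ refl refl refl refl = refl

  private
    *-assoc-re : ∀ P Q a b c d a′ b′ c′ d′ a″ b″ c″ d″ →
      (a * a′ + P * (b * b′) + Q * (c * c′) + P * Q * (d * d′)) * a″
        + P * ((a * b′ + b * a′ + Q * (c * d′ + d * c′)) * b″)
        + Q * ((a * c′ + c * a′ + P * (b * d′ + d * b′)) * c″)
        + P * Q * ((a * d′ + d * a′ + (b * c′ + c * b′)) * d″)
      ≡ a * (a′ * a″ + P * (b′ * b″) + Q * (c′ * c″) + P * Q * (d′ * d″))
        + P * (b * (a′ * b″ + b′ * a″ + Q * (c′ * d″ + d′ * c″)))
        + Q * (c * (a′ * c″ + c′ * a″ + P * (b′ * d″ + d′ * b″)))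
        + P * Q * (d * (a′ * d″ + d′ * a″ + (b′ * c″ + c′ * b″)))
    *-assoc-re = solve-∀ ℚ-ring

    *-assoc-√p : ∀ P Q a b c d a′ b′ c′ d′ a″ b″ c″ d″ →
      (a * a′ + P * (b * b′) + Q * (c * c′) + P * Q * (d * d′)) * b″
        + (a * b′ + b * a′ + Q * (c * d′ + d * c′)) * a″
        + Q * ((a * c′ + c * a′ + P * (b * d′ + d * b′)) * d″ + (a * d′ + d * a′ + (b * c′ + c * b′)) * c″)
      ≡ a * (a′ * b″ + b′ * a″ + Q * (c′ * d″ + d′ * c″))
        + b * (a′ * a″ + P * (b′ * b″) + Q * (c′ * c″) + P * Q * (d′ * d″))
        + Q * (c * (a′ * d″ + d′ * a″ + (b′ * c″ + c′ * b″)) + d * (a′ * c″ + c′ * a″ + P * (b′ * d″ + d′ * b″)))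
    *-assoc-√p = solve-∀ ℚ-ring

    *-assoc-√q : ∀ P Q a b c d a′ b′ c′ d′ a″ b″ c″ d″ →
      (a * a′ + P * (b * b′) + Q * (c * c′) + P * Q * (d * d′)) * c″
        + (a * c′ + c * a′ + P * (b * d′ + d * b′)) * a″
        + P * ((a * b′ + b * a′ + Q * (c * d′ + d * c′)) * d″ + (a * d′ + d * a′ + (b * c′ + c * b′)) * b″)
      ≡ a * (a′ * c″ + c′ * a″ + P * (b′ * d″ + d′ * b″))
        + c * (a′ * a″ + P * (b′ * b″) + Q * (c′ * c″) + P * Q * (d′ * d″))
        + P * (b * (a′ * d″ + d′ * a″ + (b′ * c″ + c′ * b″)) + d * (a′ * b″ + b′ * a″ + Q * (c′ * d″ + d′ * c″)))
    *-assoc-√q = solve-∀ ℚ-ring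

    *-assoc-√pq : ∀ P Q a b c d a′ b′ c′ d′ a″ b″ c″ d″ →
      (a * a′ + P * (b * b′) + Q * (c * c′) + P * Q * (d * d′)) * d″
        + (a * d′ + d * a′ + (b * c′ + c * b′)) * a″
        + ((a * b′ + b * a′ + Q * (c * d′ + d * c′)) * c″ + (a * c′ + c * a′ + P * (b * d′ + d * b′)) * b″)
      ≡ a * (a′ * d″ + d′ * a″ + (b′ * c″ + c′ * b″))
        + d * (a′ * a″ + P * (b′ * b″) + Q * (c′ * c″) + P * Q * (d′ * d″))
        + (b * (a′ * c″ + c′ * a″ + P * (b′ * d″ + d′ * b″)) + c * (a′ * b″ + b′ * a″ + Q * (c′ * d″ + d′ * c″)))
    *-assoc-√pq = solve-∀ ℚ-ring

    *-comm-re : ∀ P Q a b c d a′ b′ c′ d′ →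
      a * a′ + P * (b * b′) + Q * (c * c′) + P * Q * (d * d′) ≡ a′ * a + P * (b′ * b) + Q * (c′ * c) + P * Q * (d′ * d)
    *-comm-re = solve-∀ ℚ-ring

    -- One identity covers both the √p- and the √q-coordinate, which differ by exchanging b with c
    -- and p with q. The parameter `P` is q in the first use and p in the second.
    *-comm-√ : ∀ P a b c d a′ b′ c′ d′ →
      a * b′ + b * a′ + P * (c * d′ + d * c′) ≡ a′ * b + b′ * a + P * (c′ * d + d′ * c)
    *-comm-√ = solve-∀ ℚ-ring

    *-comm-√pq : ∀ a b c d a′ b′ c′ d′ →
      a * d′ + d * a′ + (b * c′ + c * b′) ≡ a′ * d + d′ * a + (b′ * c + c′ * b)
    *-comm-√pq = solve-∀ ℚ-ring

    *-identityˡ-re : ∀ P Q a b c d → 1ℚ * a + P * (0ℚ * b) + Q * (0ℚ * c) + P * Q * (0ℚ * d) ≡ a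
    *-identityˡ-re = solve-∀ ℚ-ring

    *-identityˡ-√ : ∀ P a b c d → 1ℚ * b + 0ℚ * a + P * (0ℚ * d + 0ℚ * c) ≡ b
    *-identityˡ-√ = solve-∀ ℚ-ring

    *-identityˡ-√pq : ∀ a b c d → 1ℚ * d + 0ℚ * a + (0ℚ * c + 0ℚ * b) ≡ d
    *-identityˡ-√pq = solve-∀ ℚ-ring

    distribˡ-re : ∀ P Q a b c d a′ b′ c′ d′ a″ b″ c″ d″ →
      a * (a′ + a″) + P * (b * (b′ + b″)) + Q * (c * (c′ + c″)) + P * Q * (d * (d′ + d″))
      ≡ a * a′ + P * (b * b′) + Q * (c * c′) + P * Q * (d * d′)
        + (a * a″ + P * (b * b″) + Q * (c * c″) + P * Q * (d * d″))
    distribˡ-re = solve-∀ ℚ-ring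

    distribˡ-√ : ∀ P a b c d a′ b′ c′ d′ a″ b″ c″ d″ →
      a * (b′ + b″) + b * (a′ + a″) + P * (c * (d′ + d″) + d * (c′ + c″))
      ≡ a * b′ + b * a′ + P * (c * d′ + d * c′) + (a * b″ + b * a″ + P * (c * d″ + d * c″))
    distribˡ-√ = solve-∀ ℚ-ring

    distribˡ-√pq : ∀ a b c d a′ b′ c′ d′ a″ b″ c″ d″ →
      a * (d′ + d″) + d * (a′ + a″) + (b * (c′ + c″) + c * (b′ + b″))
      ≡ a * d′ + d * a′ + (b * c′ + c * b′) + (a * d″ + d * a″ + (b * c″ + c * b″))
    distribˡ-√pq = solve-∀ ℚ-ring

  *ᴷ-assoc : ∀ x y z → (x *ᴷ y) *ᴷ z ≡ x *ᴷ (y *ᴷ z)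
  *ᴷ-assoc ⟨ a , b , c , d ⟩ ⟨ a′ , b′ , c′ , d′ ⟩ ⟨ a″ , b″ , c″ , d″ ⟩ = K-≡
    (*-assoc-re (fromℕ p) (fromℕ q) a b c d a′ b′ c′ d′ a″ b″ c″ d″)
    (*-assoc-√p (fromℕ p) (fromℕ q) a b c d a′ b′ c′ d′ a″ b″ c″ d″)
    (*-assoc-√q (fromℕ p) (fromℕ q) a b c d a′ b′ c′ d′ a″ b″ c″ d″)
    (*-assoc-√pq (fromℕ p) (fromℕ q) a b c d a′ b′ c′ d′ a″ b″ c″ d″)

  *ᴷ-comm : ∀ x y → x *ᴷ y ≡ y *ᴷ x
  *ᴷ-comm ⟨ a , b , c , d ⟩ ⟨ a′ , b′ , c′ , d′ ⟩ = K-≡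
    (*-comm-re (fromℕ p) (fromℕ q) a b c d a′ b′ c′ d′)
    (*-comm-√ (fromℕ q) a b c d a′ b′ c′ d′)
    (*-comm-√ (fromℕ p) a c b d a′ c′ b′ d′)
    (*-comm-√pq a b c d a′ b′ c′ d′)

  *ᴷ-identityˡ : ∀ x → 1ᴷ *ᴷ x ≡ x
  *ᴷ-identityˡ ⟨ a , b , c , d ⟩ = K-≡
    (*-identityˡ-re (fromℕ p) (fromℕ q) a b c d)
    (*-identityˡ-√ (fromℕ q) a b c d) (*-identityˡ-√ (fromℕ p) a c b d) (*-identityˡ-√pq a b c d)

  *ᴷ-distribˡ-+ᴷ : ∀ x y z → x *ᴷ (y +ᴷ z) ≡ x *ᴷ y +ᴷ x *ᴷ z
  *ᴷ-distribˡ-+ᴷ ⟨ a , b , c , d ⟩ ⟨ a′ , b′ , c′ , d′ ⟩ ⟨ a″ , b″ , c″ , d″ ⟩ = K-≡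
    (distribˡ-re (fromℕ p) (fromℕ q) a b c d a′ b′ c′ d′ a″ b″ c″ d″)
    (distribˡ-√ (fromℕ q) a b c d a′ b′ c′ d′ a″ b″ c″ d″)
    (distribˡ-√ (fromℕ p) a c b d a′ c′ b′ d′ a″ c″ b″ d″)
    (distribˡ-√pq a b c d a′ b′ c′ d′ a″ b″ c″ d″)

  isCommutativeRing : IsCommutativeRing _≡_ _+ᴷ_ _*ᴷ_ -ᴷ_ 0ᴷ 1ᴷ
  isCommutativeRing = record
    { isRing = record
      { +-isAbelianGroup = record
        { isGroup = record
          { isMonoid = record
            { isSemigroup = record
              { isMagma = record { isEquivalence = isEquivalence ; ∙-cong = cong₂ _+ᴷ_ }
              ; assoc = λ where
                  ⟨ a , b , c , d ⟩ ⟨ a′ , b′ , c′ , d′ ⟩ ⟨ a″ , b″ , c″ , d″ ⟩ →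
                    K-≡ (+-assoc a a′ a″) (+-assoc b b′ b″) (+-assoc c c′ c″) (+-assoc d d′ d″)
              }
            ; identity = (λ where ⟨ a , b , c , d ⟩ → K-≡ (+-identityˡ a) (+-identityˡ b) (+-identityˡ c) (+-identityˡ d))
                       , (λ where ⟨ a , b , c , d ⟩ → K-≡ (+-identityʳ a) (+-identityʳ b) (+-identityʳ c) (+-identityʳ d))
            }
          ; inverse = (λ where ⟨ a , b , c , d ⟩ → K-≡ (+-inverseˡ a) (+-inverseˡ b) (+-inverseˡ c) (+-inverseˡ d))
                    , (λ where ⟨ a , b , c , d ⟩ → K-≡ (+-inverseʳ a) (+-inverseʳ b) (+-inverseʳ c) (+-inverseʳ d))
          ; ⁻¹-cong = cong -ᴷ_
          }
        ; comm = λ where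
            ⟨ a , b , c , d ⟩ ⟨ a′ , b′ , c′ , d′ ⟩ → K-≡ (+-comm a a′) (+-comm b b′) (+-comm c c′) (+-comm d d′)
        }
      ; *-cong = cong₂ _*ᴷ_
      ; *-assoc = *ᴷ-assoc
      ; *-identity = *ᴷ-identityˡ , λ x → trans (*ᴷ-comm x 1ᴷ) (*ᴷ-identityˡ x)
      ; distrib = *ᴷ-distribˡ-+ᴷ
                , λ x y z → trans (*ᴷ-comm (y +ᴷ z) x) (trans (*ᴷ-distribˡ-+ᴷ x y z) (cong₂ _+ᴷ_ (*ᴷ-comm x y) (*ᴷ-comm x z)))
      }
    ; *-comm = *ᴷ-comm
    }

-- Almost integral elements of a commutative ring

module AlmostIntegrality (R : CommutativeRing 0ℓ 0ℓ) (L D : CommutativeRing.Carrier R → Set) where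
  open CommutativeRing R
  open import Algebra.Solver.CommutativeMonoid *-commutativeMonoid using (solve; _⊕_; _⊜_; id)
  open import Data.Nat using (zero; suc)
  open import Data.Product using (∃-syntax; _×_; _,_)
  open import Relation.Binary.Reasoning.Setoid setoid

  infixr 8 _^_
  _^_ : Carrier → ℕ → Carrier
  x ^ zero  = 1#
  x ^ suc n = x * x ^ n

  -- The notion behind the complete integral closure, relative to a subring `L` and a multiplicative
  -- set `D` of denominators. One denominator has to serve all powers.
  AlmostIntegral : Carrier → Set
  AlmostIntegral x = ∃[ M ] D M × (∀ k → L (M * x ^ k))

  ^-distrib-* : ∀ x y k → (x * y) ^ k ≈ x ^ k * y ^ k
  ^-distrib-* x y zero    = sym (*-identityˡ 1#)
  ^-distrib-* x y (suc k) = begin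
    x * y * (x * y) ^ k        ≈⟨ *-congˡ (^-distrib-* x y k) ⟩
    x * y * (x ^ k * y ^ k)    ≈⟨ solve 4 (λ a b c d → (a ⊕ b) ⊕ (c ⊕ d) ⊜ (a ⊕ c) ⊕ (b ⊕ d)) refl x y (x ^ k) (y ^ k) ⟩
    x * x ^ k * (y * y ^ k)    ∎

  module Closure
    (L-resp : ∀ {x y} → x ≈ y → L x → L y)
    (L-1 : L 1#)
    (L-+ : ∀ {x y} → L x → L y → L (x + y))
    (L-* : ∀ {x y} → L x → L y → L (x * y))
    (D-1 : D 1#)
    (D-* : ∀ {x y} → D x → D y → D (x * y))
    where

    L-^ : ∀ {x} → L x → ∀ k → L (x ^ k)
    L-^ Lx zero    = L-1
    L-^ Lx (suc k) = L-* Lx (L-^ Lx k)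

    L⇒almostIntegral : ∀ {x} → L x → AlmostIntegral x
    L⇒almostIntegral Lx = 1# , D-1 , λ k → L-* L-1 (L-^ Lx k)

    *-almostIntegral : ∀ {x y} → AlmostIntegral x → AlmostIntegral y → AlmostIntegral (x * y)
    *-almostIntegral {x} {y} (M , DM , Mx) (N , DN , Ny) = M * N , D-* DM DN , λ k → L-resp (begin
      M * x ^ k * (N * y ^ k)      ≈⟨ solve 4 (λ a b c d → (a ⊕ b) ⊕ (c ⊕ d) ⊜ (a ⊕ c) ⊕ (b ⊕ d)) refl M (x ^ k) N (y ^ k) ⟩
      M * N * (x ^ k * y ^ k)      ≈⟨ *-congˡ (^-distrib-* x y k) ⟨
      M * N * (x * y) ^ k          ∎) (L-* (Mx k) (Ny k))

    +-almostIntegral : ∀ {x y} → AlmostIntegral x → AlmostIntegral y → AlmostIntegral (x + y)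
    +-almostIntegral {x} {y} (M , DM , Mx) (N , DN , Ny) = M * N , D-* DM DN , λ k →
      L-resp (*-congˡ (trans (*-identityˡ _) (*-identityʳ _))) (mixed k 0 0)
      where
      -- Carrying the monomials xⁱ and yʲ along allows one factor x + y to be distributed at a time,
      -- which replaces the binomial theorem.
      mixed : ∀ k i j → L (M * N * (x ^ i * ((x + y) ^ k * y ^ j)))
      mixed zero i j = L-resp (begin
        M * x ^ i * (N * y ^ j)            ≈⟨ solve 4 (λ a b c d → (a ⊕ b) ⊕ (c ⊕ d) ⊜ (a ⊕ c) ⊕ (b ⊕ (id ⊕ d))) refl M (x ^ i) N (y ^ j) ⟩
        M * N * (x ^ i * (1# * y ^ j))     ∎) (L-* (Mx i) (Ny j))
      mixed (suc k) i j = L-resp (begin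
        M * N * (x * x ^ i * (z * y ^ j)) + M * N * (x ^ i * (z * (y * y ^ j)))
          ≈⟨ +-cong
               (solve 5 (λ m x a z b → m ⊕ ((x ⊕ a) ⊕ (z ⊕ b)) ⊜ x ⊕ (m ⊕ (a ⊕ (z ⊕ b)))) refl (M * N) x (x ^ i) z (y ^ j))
               (solve 5 (λ m y a z b → m ⊕ (a ⊕ (z ⊕ (y ⊕ b))) ⊜ y ⊕ (m ⊕ (a ⊕ (z ⊕ b)))) refl (M * N) y (x ^ i) z (y ^ j)) ⟩
        x * w + y * w                      ≈⟨ distribʳ w x y ⟨
        (x + y) * w                        ≈⟨ solve 5 (λ m s a z b → s ⊕ (m ⊕ (a ⊕ (z ⊕ b))) ⊜ m ⊕ (a ⊕ ((s ⊕ z) ⊕ b))) refl (M * N) (x + y) (x ^ i) z (y ^ j) ⟩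
        M * N * (x ^ i * ((x + y) * z * y ^ j)) ∎) (L-+ (mixed k (suc i) j) (mixed k i (suc j)))
        where
        z = (x + y) ^ k
        w = M * N * (x ^ i * (z * y ^ j))

-- When a rational number is an integer

module RationalIntegers where
  open ℚRing
  open import Defs using (fromℤ; fromℕ; SquareFree)
  open import Data.Integer as ℤ using (ℤ; +_; ∣_∣)
  import Data.Integer.Properties as ℤ
  import Data.Integer.Tactic.RingSolver as ℤ-Solver
  open import Data.Nat as ℕ using (ℕ; zero; suc; s≤s; z≤n; NonZero)
  import Data.Nat.Properties as ℕ
  open import Data.Nat.Coprimality as Coprimality using (Coprime; coprime-divisor)
  open import Data.Nat.Divisibility
  open import Data.Product using (∃-syntax; _,_)
  open import Data.Rational hiding (∣_∣; NonZero)
  open import Data.Rational.Properties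
  import Data.Rational.Unnormalised as ℚᵘ
  import Data.Rational.Unnormalised.Properties as ℚᵘ
  open import Relation.Binary.PropositionalEquality
  open import Relation.Nullary using (contradiction)
  open import Tactic.RingSolver using (solve-∀)

  toℚᵘ-fromℤ : ∀ z → toℚᵘ (fromℤ z) ℚᵘ.≃ ℚᵘ.mkℚᵘ z 0
  toℚᵘ-fromℤ z = toℚᵘ-fromℚᵘ (ℚᵘ.mkℚᵘ z 0)

  fromℤ-injective : ∀ {x y} → fromℤ x ≡ fromℤ y → x ≡ y
  fromℤ-injective {x} {y} e = trans (sym (ℤ.*-identityʳ x)) (trans
    (ℚᵘ.drop-*≡* (ℚᵘ.≃-trans (ℚᵘ.≃-sym (toℚᵘ-fromℤ x)) (ℚᵘ.≃-trans (toℚᵘ-cong e) (toℚᵘ-fromℤ y))))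
    (ℤ.*-identityʳ y))

  fromℤ-+ : ∀ x y → fromℤ (x ℤ.+ y) ≡ fromℤ x + fromℤ y
  fromℤ-+ x y = toℚᵘ-injective (begin
    toℚᵘ (fromℤ (x ℤ.+ y))               ≈⟨ toℚᵘ-fromℤ (x ℤ.+ y) ⟩
    ℚᵘ.mkℚᵘ (x ℤ.+ y) 0                  ≈⟨ ℚᵘ.*≡* (lemma x y) ⟩
    ℚᵘ.mkℚᵘ x 0 ℚᵘ.+ ℚᵘ.mkℚᵘ y 0         ≈⟨ ℚᵘ.+-cong (toℚᵘ-fromℤ x) (toℚᵘ-fromℤ y) ⟨
    toℚᵘ (fromℤ x) ℚᵘ.+ toℚᵘ (fromℤ y)   ≈⟨ toℚᵘ-homo-+ (fromℤ x) (fromℤ y) ⟨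
    toℚᵘ (fromℤ x + fromℤ y)             ∎)
    where
    open ℚᵘ.≃-Reasoning
    lemma : ∀ x y → (x ℤ.+ y) ℤ.* + 1 ≡ (x ℤ.* + 1 ℤ.+ y ℤ.* + 1) ℤ.* + 1
    lemma = ℤ-Solver.solve-∀

  fromℤ-* : ∀ x y → fromℤ (x ℤ.* y) ≡ fromℤ x * fromℤ y
  fromℤ-* x y = toℚᵘ-injective (begin
    toℚᵘ (fromℤ (x ℤ.* y))               ≈⟨ toℚᵘ-fromℤ (x ℤ.* y) ⟩
    ℚᵘ.mkℚᵘ x 0 ℚᵘ.* ℚᵘ.mkℚᵘ y 0         ≈⟨ ℚᵘ.*-cong (toℚᵘ-fromℤ x) (toℚᵘ-fromℤ y) ⟨
    toℚᵘ (fromℤ x) ℚᵘ.* toℚᵘ (fromℤ y)   ≈⟨ toℚᵘ-homo-* (fromℤ x) (fromℤ y) ⟨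
    toℚᵘ (fromℤ x * fromℤ y)             ∎)
    where open ℚᵘ.≃-Reasoning

  fromℤ-neg : ∀ x → fromℤ (ℤ.- x) ≡ - fromℤ x
  fromℤ-neg x = toℚᵘ-injective (begin
    toℚᵘ (fromℤ (ℤ.- x))     ≈⟨ toℚᵘ-fromℤ (ℤ.- x) ⟩
    ℚᵘ.- ℚᵘ.mkℚᵘ x 0         ≈⟨ ℚᵘ.-‿cong (toℚᵘ-fromℤ x) ⟨
    ℚᵘ.- toℚᵘ (fromℤ x)      ≈⟨ toℚᵘ-homo‿- (fromℤ x) ⟨
    toℚᵘ (- fromℤ x)         ∎)
    where open ℚᵘ.≃-Reasoning

  IsInteger : ℚ → Set
  IsInteger a = ∃[ z ] a ≡ fromℤ z

  fromℤ-isInteger : ∀ z → IsInteger (fromℤ z)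
  fromℤ-isInteger z = z , refl

  +-isInteger : ∀ {a b} → IsInteger a → IsInteger b → IsInteger (a + b)
  +-isInteger (x , refl) (y , refl) = x ℤ.+ y , sym (fromℤ-+ x y)

  *-isInteger : ∀ {a b} → IsInteger a → IsInteger b → IsInteger (a * b)
  *-isInteger (x , refl) (y , refl) = x ℤ.* y , sym (fromℤ-* x y)

  neg-isInteger : ∀ {a} → IsInteger a → IsInteger (- a)
  neg-isInteger (x , refl) = ℤ.- x , sym (fromℤ-neg x)

  *-denominator : ∀ a → a * fromℕ (↧ₙ a) ≡ fromℤ (↥ a)
  *-denominator a@(mkℚ u d _) = toℚᵘ-injective (begin
    toℚᵘ (a * fromℕ (suc d))                        ≈⟨ toℚᵘ-homo-* a (fromℕ (suc d)) ⟩
    toℚᵘ a ℚᵘ.* toℚᵘ (fromℕ (suc d))                ≈⟨ ℚᵘ.*-cong (ℚᵘ.≃-refl {toℚᵘ a}) (toℚᵘ-fromℤ (+ suc d)) ⟩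
    ℚᵘ.mkℚᵘ u d ℚᵘ.* ℚᵘ.mkℚᵘ (+ suc d) 0            ≈⟨ ℚᵘ.*≡* (lemma u (+ suc d)) ⟩
    ℚᵘ.mkℚᵘ u 0                                     ≈⟨ toℚᵘ-fromℤ u ⟨
    toℚᵘ (fromℤ u)                                  ∎)
    where
    open ℚᵘ.≃-Reasoning
    lemma : ∀ u v → u ℤ.* v ℤ.* + 1 ≡ u ℤ.* (v ℤ.* + 1)
    lemma u v = ℤ.*-assoc u v (+ 1)

  numerator-coprime : ∀ a → Coprime (↧ₙ a) (∣ ↥ a ∣)
  numerator-coprime (mkℚ u d c) = Coprimality.sym (Coprimality.recompute c)

  denominator≡1⇒isInteger : ∀ a → ↧ₙ a ≡ 1 → IsInteger a
  denominator≡1⇒isInteger a e = ↥ a , trans (sym (*-identityʳ a))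
    (trans (cong (λ n → a * fromℕ n) (sym e)) (*-denominator a))

  -- Write y = u/v in lowest terms. Then v² divides nu², and v is coprime to u, so both factors u
  -- can be stripped and v² divides n. Square-freeness leaves v = 1.
  squareFree-isInteger : ∀ {n} → SquareFree n → ∀ {y} → IsInteger (fromℕ n * (y * y)) → IsInteger y
  squareFree-isInteger {n} n-sf {y} (z , ny²≡z) = denominator≡1⇒isInteger y (n-sf v v²∣n)
    where
    v = ↧ₙ y
    u = ↥ y
    instance
      v≢0 : NonZero v
      v≢0 = _
    rearrange : ∀ n y v → n * (y * y) * (v * v) ≡ n * ((y * v) * (y * v))
    rearrange = solve-∀ ℚ-ring
    zv²≡nu² : z ℤ.* (+ v ℤ.* + v) ≡ + n ℤ.* (u ℤ.* u)
    zv²≡nu² = fromℤ-injective {z ℤ.* (+ v ℤ.* + v)} {+ n ℤ.* (u ℤ.* u)} (begin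
      fromℤ (z ℤ.* (+ v ℤ.* + v))                     ≡⟨ fromℤ-* z (+ v ℤ.* + v) ⟩
      fromℤ z * fromℤ (+ v ℤ.* + v)                   ≡⟨ cong₂ _*_ (sym ny²≡z) (fromℤ-* (+ v) (+ v)) ⟩
      fromℕ n * (y * y) * (fromℕ v * fromℕ v)         ≡⟨ rearrange (fromℕ n) y (fromℕ v) ⟩
      fromℕ n * (y * fromℕ v * (y * fromℕ v))         ≡⟨ cong (λ x → fromℕ n * (x * x)) (*-denominator y) ⟩
      fromℕ n * (fromℤ u * fromℤ u)                   ≡⟨ cong (fromℕ n *_) (fromℤ-* u u) ⟨
      fromℕ n * fromℤ (u ℤ.* u)                       ≡⟨ fromℤ-* (+ n) (u ℤ.* u) ⟨
      fromℤ (+ n ℤ.* (u ℤ.* u))                       ∎)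
      where open ≡-Reasoning
    zv²≡u[un] : ∣ z ∣ ℕ.* (v ℕ.* v) ≡ ∣ u ∣ ℕ.* (∣ u ∣ ℕ.* n)
    zv²≡u[un] = begin
      ∣ z ∣ ℕ.* (v ℕ.* v)              ≡⟨ cong (∣ z ∣ ℕ.*_) (ℤ.abs-* (+ v) (+ v)) ⟨
      ∣ z ∣ ℕ.* ∣ + v ℤ.* + v ∣        ≡⟨ ℤ.abs-* z (+ v ℤ.* + v) ⟨
      ∣ z ℤ.* (+ v ℤ.* + v) ∣          ≡⟨ cong ∣_∣ zv²≡nu² ⟩
      ∣ + n ℤ.* (u ℤ.* u) ∣            ≡⟨ ℤ.abs-* (+ n) (u ℤ.* u) ⟩
      n ℕ.* ∣ u ℤ.* u ∣                ≡⟨ cong (n ℕ.*_) (ℤ.abs-* u u) ⟩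
      n ℕ.* (∣ u ∣ ℕ.* ∣ u ∣)          ≡⟨ ℕ.*-comm n _ ⟩
      ∣ u ∣ ℕ.* ∣ u ∣ ℕ.* n            ≡⟨ ℕ.*-assoc ∣ u ∣ ∣ u ∣ n ⟩
      ∣ u ∣ ℕ.* (∣ u ∣ ℕ.* n)          ∎
      where open ≡-Reasoning
    v²∣u[un] : v ℕ.* v ∣ ∣ u ∣ ℕ.* (∣ u ∣ ℕ.* n)
    v²∣u[un] = divides ∣ z ∣ (sym zv²≡u[un])
    v⊥u = numerator-coprime y
    v²∣u : ∀ {w} → v ℕ.* v ∣ ∣ u ∣ ℕ.* w → v ℕ.* v ∣ w
    v²∣u {w} v²∣uw = helper (coprime-divisor v⊥u (m*n∣⇒m∣ v v v²∣uw))
      where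
      helper : v ∣ w → v ℕ.* v ∣ w
      helper (divides w′ w≡w′v) = subst (v ℕ.* v ∣_) (sym w≡w′v) (*-monoˡ-∣ v (coprime-divisor v⊥u
        (*-cancelʳ-∣ v (subst (v ℕ.* v ∣_) (trans (cong (∣ u ∣ ℕ.*_) w≡w′v) (sym (ℕ.*-assoc ∣ u ∣ w′ v))) v²∣uw))))
    v²∣n : v ℕ.* v ∣ n
    v²∣n = v²∣u (v²∣u v²∣u[un])

  infixr 8 _^_
  _^_ : ℚ → ℕ → ℚ
  a ^ zero  = 1ℚ
  a ^ suc k = a * a ^ k

  n<2^n : ∀ n → n ℕ.< 2 ℕ.^ n
  n<2^n zero    = s≤s z≤n
  n<2^n (suc n) = ℕ.≤-trans (s≤s (n<2^n n)) (ℕ.≤-trans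
    (ℕ.+-monoˡ-≤ (2 ℕ.^ n) (ℕ.m^n>0 2 n)) (ℕ.+-monoʳ-≤ (2 ℕ.^ n) (ℕ.≤-reflexive (sym (ℕ.+-identityʳ (2 ℕ.^ n))))))

  -- If a = u/v in lowest terms, then vᵏ divides n for every k. For v ≥ 2 the exponent k = n already
  -- refutes this, as vⁿ ≥ 2ⁿ > n.
  bounded-denominators⇒isInteger : ∀ {n a} .{{_ : NonZero n}} → (∀ k → IsInteger (fromℕ n * a ^ k)) → IsInteger a
  bounded-denominators⇒isInteger {n} {a} h = denominator≡1⇒isInteger a (v≡1 v v^k∣n)
    where
    v = ↧ₙ a
    u = ↥ a
    v⊥u = numerator-coprime a
    z : ∀ k → ℤ
    z k = let (i , _) = h k in i
    zv^k≡nu^k : ∀ k → fromℤ (z k ℤ.* ((+ v) ℤ.^ k)) ≡ fromℤ (+ n ℤ.* u ℤ.^ k)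
    zv^k≡nu^k k = begin
      fromℤ (z k ℤ.* ((+ v) ℤ.^ k))            ≡⟨ fromℤ-* (z k) ((+ v) ℤ.^ k) ⟩
      fromℤ (z k) * fromℤ ((+ v) ℤ.^ k)        ≡⟨ cong (_* fromℤ ((+ v) ℤ.^ k)) (sym (let (_ , e) = h k in e)) ⟩
      fromℕ n * a ^ k * fromℤ ((+ v) ℤ.^ k)    ≡⟨ *-assoc (fromℕ n) (a ^ k) _ ⟩
      fromℕ n * (a ^ k * fromℤ ((+ v) ℤ.^ k))  ≡⟨ cong (fromℕ n *_) (power k) ⟩
      fromℕ n * fromℤ (u ℤ.^ k)              ≡⟨ fromℤ-* (+ n) (u ℤ.^ k) ⟨
      fromℤ (+ n ℤ.* u ℤ.^ k)                ∎
      where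
      open ≡-Reasoning
      swap : ∀ a b c d → a * b * (c * d) ≡ a * c * (b * d)
      swap = solve-∀ ℚ-ring
      power : ∀ k → a ^ k * fromℤ ((+ v) ℤ.^ k) ≡ fromℤ (u ℤ.^ k)
      power zero    = *-identityˡ 1ℚ
      power (suc k) = begin
        a * a ^ k * fromℤ (+ v ℤ.* (+ v) ℤ.^ k)            ≡⟨ cong (a * a ^ k *_) (fromℤ-* (+ v) ((+ v) ℤ.^ k)) ⟩
        a * a ^ k * (fromℕ v * fromℤ ((+ v) ℤ.^ k))        ≡⟨ swap a (a ^ k) (fromℕ v) _ ⟩
        a * fromℕ v * (a ^ k * fromℤ ((+ v) ℤ.^ k))        ≡⟨ cong₂ _*_ (*-denominator a) (power k) ⟩
        fromℤ u * fromℤ (u ℤ.^ k)                        ≡⟨ fromℤ-* u (u ℤ.^ k) ⟨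
        fromℤ (u ℤ.* u ℤ.^ k)                            ∎
    abs-^ : ∀ i k → ∣ i ℤ.^ k ∣ ≡ ∣ i ∣ ℕ.^ k
    abs-^ i zero    = refl
    abs-^ i (suc k) = trans (ℤ.abs-* i (i ℤ.^ k)) (cong (∣ i ∣ ℕ.*_) (abs-^ i k))
    v^k∣u^kn : ∀ k → v ℕ.^ k ∣ ∣ u ∣ ℕ.^ k ℕ.* n
    v^k∣u^kn k = divides ∣ z k ∣ (begin
      ∣ u ∣ ℕ.^ k ℕ.* n            ≡⟨ ℕ.*-comm (∣ u ∣ ℕ.^ k) n ⟩
      n ℕ.* ∣ u ∣ ℕ.^ k            ≡⟨ cong (n ℕ.*_) (abs-^ u k) ⟨
      n ℕ.* ∣ u ℤ.^ k ∣            ≡⟨ ℤ.abs-* (+ n) (u ℤ.^ k) ⟨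
      ∣ + n ℤ.* u ℤ.^ k ∣          ≡⟨ cong ∣_∣ (fromℤ-injective {z k ℤ.* (+ v) ℤ.^ k} {+ n ℤ.* u ℤ.^ k} (zv^k≡nu^k k)) ⟨
      ∣ z k ℤ.* ((+ v) ℤ.^ k) ∣      ≡⟨ ℤ.abs-* (z k) ((+ v) ℤ.^ k) ⟩
      ∣ z k ∣ ℕ.* ∣ (+ v) ℤ.^ k ∣    ≡⟨ cong (∣ z k ∣ ℕ.*_) (abs-^ (+ v) k) ⟩
      ∣ z k ∣ ℕ.* v ℕ.^ k          ∎)
      where open ≡-Reasoning
    coprime-^ : ∀ k {w} → v ∣ ∣ u ∣ ℕ.^ k ℕ.* w → v ∣ w
    coprime-^ zero    {w} d = subst (v ∣_) (ℕ.+-identityʳ w) d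
    coprime-^ (suc k) {w} d = coprime-^ k (coprime-divisor v⊥u (subst (v ∣_) (ℕ.*-assoc ∣ u ∣ (∣ u ∣ ℕ.^ k) w) d))
    instance
      v≢0 : NonZero v
      v≢0 = _
    -- One factor v is gained per step: if n = w vᵏ, then v divides uᵏ⁺¹w, and coprimality passes it
    -- to w.
    v^k∣n : ∀ k → v ℕ.^ k ∣ n
    v^k∣n zero = 1∣ n
    v^k∣n (suc k) = helper (v^k∣n k)
      where
      helper : v ℕ.^ k ∣ n → v ℕ.^ suc k ∣ n
      helper (divides w n≡wv^k) = subst (v ℕ.^ suc k ∣_) (sym n≡wv^k) (*-monoˡ-∣ (v ℕ.^ k) (coprime-^ (suc k)
        (*-cancelʳ-∣ (v ℕ.^ k) {{ℕ.m^n≢0 v k}} (subst (v ℕ.^ suc k ∣_)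
          (trans (cong (∣ u ∣ ℕ.^ suc k ℕ.*_) n≡wv^k) (sym (ℕ.*-assoc (∣ u ∣ ℕ.^ suc k) w (v ℕ.^ k)))) (v^k∣u^kn (suc k))))))
    v≡1 : ∀ v .{{_ : NonZero v}} → (∀ k → v ℕ.^ k ∣ n) → v ≡ 1
    v≡1 1               _ = refl
    v≡1 v@(suc (suc w)) h = contradiction
      (ℕ.≤-trans (n<2^n n) (ℕ.^-monoˡ-≤ n {2} {v} (s≤s (s≤s z≤n))))
      (ℕ.≤⇒≯ (∣⇒≤ (h n)))

-- Integral elements of K have bounded denominators

module IntegralElements (p q : ℕ) where
  open ℚRing
  open RationalIntegers
  open BiquadraticRing p q
  open Defs using (fromℤ; fromℕ)
  open Defs.Biquadratic p q
  open K
  open import Algebra.Bundles using (CommutativeRing)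
  open import Data.Empty using (⊥-elim)
  open import Data.Integer as ℤ using (ℤ; +_)
  open import Data.List using ([]; _∷_; length)
  open import Data.Nat as ℕ using (zero; suc; s≤s; z≤n)
  import Data.Nat.Properties as ℕ
  open import Data.Product using (∃-syntax; _×_; _,_; proj₁; proj₂)
  open import Data.Rational
  open import Data.Rational.Properties
  open import Level using (0ℓ)
  open import Relation.Binary.PropositionalEquality
  open import Tactic.RingSolver using (solve-∀)

  K-ring : CommutativeRing 0ℓ 0ℓ
  K-ring = record { isCommutativeRing = isCommutativeRing }

  module K-ring = CommutativeRing K-ring

  -- The order ℤ[√p, √q]. It is only the lattice against which denominators are measured and may be
  -- smaller than the ring of integers.
  Integral : K → Set
  Integral ⟨ a , b , c , d ⟩ = IsInteger a × IsInteger b × IsInteger c × IsInteger d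

  Denominator : K → Set
  Denominator M = ∃[ n ] M ≡ fromRational (fromℕ (suc n))

  open AlmostIntegrality K-ring Integral Denominator public hiding (_^_)
  open AlmostIntegrality K-ring Integral Denominator using () renaming (_^_ to _^ᴷ_)

  private
    P Q : ℚ
    P = fromℕ p
    Q = fromℕ q

    scale-re : ∀ P Q r a b c d → r * a + P * (0ℚ * b) + Q * (0ℚ * c) + P * Q * (0ℚ * d) ≡ r * a
    scale-re = solve-∀ ℚ-ring

    scale-√ : ∀ P r a b c d → r * b + 0ℚ * a + P * (0ℚ * d + 0ℚ * c) ≡ r * b
    scale-√ = solve-∀ ℚ-ring

    scale-√pq : ∀ r a b c d → r * d + 0ℚ * a + (0ℚ * c + 0ℚ * b) ≡ r * d
    scale-√pq = solve-∀ ℚ-ring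

  fromRational-* : ∀ r x → fromRational r *ᴷ x ≡
    ⟨ r * re x , r * √p-part x , r * √q-part x , r * √pq-part x ⟩
  fromRational-* r ⟨ a , b , c , d ⟩ = K-≡
    (scale-re P Q r a b c d) (scale-√ Q r a b c d) (scale-√ P r a c b d) (scale-√pq r a b c d)

  fromRational-homo-* : ∀ r s → fromRational r *ᴷ fromRational s ≡ fromRational (r * s)
  fromRational-homo-* r s = trans (fromRational-* r (fromRational s)) (K-≡ refl (*-zeroʳ r) (*-zeroʳ r) (*-zeroʳ r))

  fromRational-integral : ∀ {r} → IsInteger r → Integral (fromRational r)
  fromRational-integral r∈ℤ = r∈ℤ , fromℤ-isInteger (+ 0) , fromℤ-isInteger (+ 0) , fromℤ-isInteger (+ 0)

  denominator-integral : ∀ {M} → Denominator M → Integral M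
  denominator-integral (n , refl) = fromRational-integral (fromℤ-isInteger (+ suc n))

  integral-+ : ∀ {x y} → Integral x → Integral y → Integral (x +ᴷ y)
  integral-+ (a , b , c , d) (a′ , b′ , c′ , d′) =
    +-isInteger a a′ , +-isInteger b b′ , +-isInteger c c′ , +-isInteger d d′

  integral-* : ∀ {x y} → Integral x → Integral y → Integral (x *ᴷ y)
  integral-* (a , b , c , d) (a′ , b′ , c′ , d′) =
      a ⊗ a′ ⊕ P∈ℤ ⊗ (b ⊗ b′) ⊕ Q∈ℤ ⊗ (c ⊗ c′) ⊕ P∈ℤ ⊗ Q∈ℤ ⊗ (d ⊗ d′)
    , a ⊗ b′ ⊕ b ⊗ a′ ⊕ Q∈ℤ ⊗ (c ⊗ d′ ⊕ d ⊗ c′)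
    , a ⊗ c′ ⊕ c ⊗ a′ ⊕ P∈ℤ ⊗ (b ⊗ d′ ⊕ d ⊗ b′)
    , a ⊗ d′ ⊕ d ⊗ a′ ⊕ (b ⊗ c′ ⊕ c ⊗ b′)
    where
    infixl 6 _⊕_
    infixl 7 _⊗_
    _⊕_ = +-isInteger
    _⊗_ = *-isInteger
    P∈ℤ = fromℤ-isInteger (+ p)
    Q∈ℤ = fromℤ-isInteger (+ q)

  denominator-* : ∀ {M N} → Denominator M → Denominator N → Denominator (M *ᴷ N)
  denominator-* (m , refl) (n , refl) = n ℕ.+ m ℕ.* suc n ,
    trans (fromRational-homo-* (fromℕ (suc m)) (fromℕ (suc n))) (cong fromRational (sym (fromℤ-* (+ suc m) (+ suc n))))

  open Closure (subst Integral) (fromRational-integral (fromℤ-isInteger (+ 1))) integral-+ integral-*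
    (0 , refl) denominator-* public

  fromRational-almostIntegral : ∀ {a} → AlmostIntegral (fromRational a) → IsInteger a
  fromRational-almostIntegral {a} (_ , (n , refl) , h) = bounded-denominators⇒isInteger {suc n} {a} λ k →
    proj₁ (subst Integral (trans (cong (fromRational (fromℕ (suc n)) *ᴷ_) (power k))
      (fromRational-homo-* (fromℕ (suc n)) (a ^ k))) (h k))
    where
    power : ∀ k → fromRational a ^ᴷ k ≡ fromRational (a ^ k)
    power zero    = refl
    power (suc k) = trans (cong (fromRational a *ᴷ_) (power k)) (fromRational-homo-* a (a ^ k))

  common-denominator : ∀ x → ∃[ M ] Denominator M × Integral (M *ᴷ x)
  common-denominator x@(⟨ a , b , c , d ⟩) =
    fromRational (fromℕ n) , (ℕ.pred n , cong (λ n → fromRational (fromℕ n)) (sym (ℕ.suc-pred n))) ,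
    subst Integral (sym (fromRational-* (fromℕ n) x))
      ( multiple (↧ₙ b ℕ.* ↧ₙ c ℕ.* ↧ₙ d) a (nₐ (↧ₙ a) (↧ₙ b) (↧ₙ c) (↧ₙ d))
      , multiple (↧ₙ a ℕ.* ↧ₙ c ℕ.* ↧ₙ d) b (n_b (↧ₙ a) (↧ₙ b) (↧ₙ c) (↧ₙ d))
      , multiple (↧ₙ a ℕ.* ↧ₙ b ℕ.* ↧ₙ d) c (n_c (↧ₙ a) (↧ₙ b) (↧ₙ c) (↧ₙ d))
      , multiple (↧ₙ a ℕ.* ↧ₙ b ℕ.* ↧ₙ c) d refl )
    where
    import Data.Nat.Tactic.RingSolver as ℕ-Solver
    n = ↧ₙ a ℕ.* ↧ₙ b ℕ.* ↧ₙ c ℕ.* ↧ₙ d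
    instance
      n≢0 : ℕ.NonZero n
      n≢0 = ℕ.m*n≢0 (↧ₙ a ℕ.* ↧ₙ b ℕ.* ↧ₙ c) (↧ₙ d) {{ℕ.m*n≢0 (↧ₙ a ℕ.* ↧ₙ b) (↧ₙ c) {{ℕ.m*n≢0 (↧ₙ a) (↧ₙ b)}}}}
    nₐ : ∀ a b c d → a ℕ.* b ℕ.* c ℕ.* d ≡ b ℕ.* c ℕ.* d ℕ.* a
    nₐ = ℕ-Solver.solve-∀
    n_b : ∀ a b c d → a ℕ.* b ℕ.* c ℕ.* d ≡ a ℕ.* c ℕ.* d ℕ.* b
    n_b = ℕ-Solver.solve-∀
    n_c : ∀ a b c d → a ℕ.* b ℕ.* c ℕ.* d ≡ a ℕ.* b ℕ.* d ℕ.* c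
    n_c = ℕ-Solver.solve-∀
    multiple : ∀ {n} m a → n ≡ m ℕ.* ↧ₙ a → IsInteger (fromℕ n * a)
    multiple m a refl = subst IsInteger eq (*-isInteger (fromℤ-isInteger (+ m)) (fromℤ-isInteger (↥ a)))
      where
      shuffle : ∀ m a v → m * (a * v) ≡ m * v * a
      shuffle = solve-∀ ℚ-ring
      eq : fromℕ m * fromℤ (↥ a) ≡ fromℕ (m ℕ.* ↧ₙ a) * a
      eq = trans (cong (fromℕ m *_) (sym (*-denominator a))) (trans (shuffle (fromℕ m) a (fromℕ (↧ₙ a)))
        (cong (_* a) (trans (sym (fromℤ-* (+ m) (+ ↧ₙ a))) (cong fromℤ (sym (Data.Integer.Properties.pos-* m (↧ₙ a)))))))
        where import Data.Integer.Properties

  -- A monic relation of degree n expresses every power of x through 1, …, xⁿ⁻¹.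
  ∈𝒪⇒almostIntegral : ∀ {x} → x ∈𝒪 → AlmostIntegral x
  -- The empty coefficient list denotes the constant polynomial 1, which has no root.
  ∈𝒪⇒almostIntegral {x} ([] , e) = ⊥-elim (1≢0 (cong re e))
  ∈𝒪⇒almostIntegral {x} (cs@(_ ∷ _) , fx≡0) =
    -- If M clears the denominators of x, then Mⁿ clears those of 1, x, ..., xⁿ. It stays fixed
    -- while the power of x grows.
    M ^ᴷ n , denominator-^ n , λ k → subst S (K-ring.*-identityʳ (x ^ᴷ k)) (low-powers k 0 (s≤s z≤n))
    where
    n = length cs
    M = proj₁ (common-denominator x)
    denominator-^ : ∀ n → Denominator (M ^ᴷ n)
    denominator-^ zero    = 0 , refl
    denominator-^ (suc n) = denominator-* (proj₁ (proj₂ (common-denominator x))) (denominator-^ n)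
    M-integral : Integral M
    M-integral = denominator-integral (proj₁ (proj₂ (common-denominator x)))
    Mx-integral : Integral (M *ᴷ x)
    Mx-integral = proj₂ (proj₂ (common-denominator x))
    S : K → Set
    S y = Integral (M ^ᴷ n *ᴷ y)
    S-+ : ∀ {y z} → S y → S z → S (y +ᴷ z)
    S-+ {y} {z} Sy Sz = subst Integral (sym (*ᴷ-distribˡ-+ᴷ (M ^ᴷ n) y z)) (integral-+ Sy Sz)
    S-fromℤ : ∀ c {y} → S y → S (y *ᴷ fromRational (fromℤ c))
    S-fromℤ c {y} Sy = subst Integral (*ᴷ-assoc (M ^ᴷ n) y (fromRational (fromℤ c)))
      (integral-* Sy (fromRational-integral (fromℤ-isInteger c)))
    -- Horner's scheme: removing c·y from y·f(x) leaves (y x) times the value of the remaining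
    -- polynomial. Each step moves one factor x into `y`, until only the leading term is left.
    reduce : ∀ cs y → (∀ i → i ℕ.< length cs → S (y *ᴷ x ^ᴷ i)) → S (y *ᴷ evalMonic cs x) → S (y *ᴷ x ^ᴷ length cs)
    reduce []       y _   Sf = Sf
    reduce (c ∷ cs) y low Sf = subst S (*ᴷ-assoc y x (x ^ᴷ length cs))
      (reduce cs (y *ᴷ x) (λ i i<n → subst S (sym (*ᴷ-assoc y x (x ^ᴷ i))) (low (suc i) (s≤s i<n)))
        (subst S tail (S-+ Sf (S-fromℤ (ℤ.- c) (subst S (K-ring.*-identityʳ y) (low 0 (s≤s z≤n)))))))
      where
      C  = fromRational (fromℤ c)
      C⁻ = fromRational (fromℤ (ℤ.- c))
      xE = x *ᴷ evalMonic cs x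
      open ≡-Reasoning
      tail : y *ᴷ (C +ᴷ xE) +ᴷ y *ᴷ C⁻ ≡ y *ᴷ x *ᴷ evalMonic cs x
      tail = begin
        y *ᴷ (C +ᴷ xE) +ᴷ y *ᴷ C⁻   ≡⟨ *ᴷ-distribˡ-+ᴷ y (C +ᴷ xE) C⁻ ⟨
        y *ᴷ (C +ᴷ xE +ᴷ C⁻)        ≡⟨ cong (y *ᴷ_) (K-ring.+-assoc C xE C⁻) ⟩
        y *ᴷ (C +ᴷ (xE +ᴷ C⁻))      ≡⟨ cong (λ z → y *ᴷ (C +ᴷ z)) (K-ring.+-comm xE C⁻) ⟩
        y *ᴷ (C +ᴷ (C⁻ +ᴷ xE))      ≡⟨ cong (y *ᴷ_) (K-ring.+-assoc C C⁻ xE) ⟨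
        y *ᴷ (C +ᴷ C⁻ +ᴷ xE)        ≡⟨ cong (λ z → y *ᴷ (z +ᴷ xE)) C-C ⟩
        y *ᴷ (0ᴷ +ᴷ xE)                                       ≡⟨ cong (y *ᴷ_) (K-ring.+-identityˡ xE) ⟩
        y *ᴷ (x *ᴷ evalMonic cs x)                            ≡⟨ *ᴷ-assoc y x (evalMonic cs x) ⟨
        y *ᴷ x *ᴷ evalMonic cs x                              ∎
        where
        C-C : C +ᴷ C⁻ ≡ 0ᴷ
        C-C = K-≡ (trans (cong (λ z → fromℤ c + z) (fromℤ-neg c)) (+-inverseʳ (fromℤ c))) refl refl refl
    initial : ∀ n i → i ℕ.≤ n → Integral (M ^ᴷ n *ᴷ x ^ᴷ i)
    initial n       zero    _         = subst Integral (sym (K-ring.*-identityʳ (M ^ᴷ n))) (L-^ M-integral n)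
    initial (suc n) (suc i) (s≤s i≤n) = subst Integral
      (interchange M x (M ^ᴷ n) (x ^ᴷ i)) (integral-* Mx-integral (initial n i i≤n))
      where
      open import Algebra.Properties.CommutativeSemigroup K-ring.*-commutativeSemigroup using (interchange)
    low-powers : ∀ k i → i ℕ.< n → S (x ^ᴷ k *ᴷ x ^ᴷ i)
    low-powers zero    i i<n = subst S (sym (*ᴷ-identityˡ (x ^ᴷ i))) (initial n i (ℕ.<⇒≤ i<n))
    low-powers (suc k) i i<n = subst S
      (trans (sym (*ᴷ-assoc (x ^ᴷ k) x (x ^ᴷ i))) (cong (_*ᴷ x ^ᴷ i) (*ᴷ-comm (x ^ᴷ k) x)))
      (all-powers (suc i) i<n)
      where
      all-powers : ∀ j → j ℕ.≤ n → S (x ^ᴷ k *ᴷ x ^ᴷ j)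
      -- Only the exponent j = n leaves the range of the induction hypothesis, and only there is the
      -- relation f(x) = 0 applied.
      all-powers j j≤n = [ low-powers k j , (λ where refl → reduce cs (x ^ᴷ k) (low-powers k) Sf) ]′ (ℕ.m≤n⇒m<n∨m≡n j≤n)
        where
        open import Data.Sum using ([_,_]′)
        Sf : S (x ^ᴷ k *ᴷ evalMonic cs x)
        Sf = subst S (sym (trans (cong (x ^ᴷ k *ᴷ_) fx≡0) (K-ring.zeroʳ (x ^ᴷ k))))
          (subst Integral (sym (K-ring.zeroʳ (M ^ᴷ n))) (fromRational-integral (fromℤ-isInteger (+ 0))))

-- Parity and sums of two squares

module ParityDescent where
  open IntegerOrder using (even≢odd)
  open import Data.Integer
  open import Data.Integer.Properties
  open import Data.Integer.Tactic.RingSolver using (solve; solve-∀)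
  open import Data.List using ([]; _∷_)
  open import Data.Empty using (⊥; ⊥-elim)
  import Data.Nat as ℕ
  open import Data.Product using (∃-syntax; _,_)
  open import Data.Sum using (_⊎_; inj₁; inj₂)
  open import Relation.Binary.PropositionalEquality

  infixl 6 _⊞_

  _⊞_ : ∀ {x y} → x ≡ 0ℤ → y ≡ 0ℤ → x + y ≡ 0ℤ
  refl ⊞ refl = refl

  eq0 : ∀ {x y} → x ≡ y → ∀ c → c * (x - y) ≡ 0ℤ
  eq0 {x} refl c = trans (cong (λ z → c * z) (+-inverseʳ x)) (*-zeroʳ c)

  -- The counterpart of `by` for equations: a linear combination of hypotheses with explicit
  -- coefficients, matched by a ring identity.
  ≡-by : ∀ {e x y} → e ≡ 0ℤ → e ≡ x - y → x ≡ y
  ≡-by {e} {x} {y} e≡0 e≡x-y = i-j≡0⇒i≡j x y (trans (sym e≡x-y) e≡0)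

  Even Odd : ℤ → Set
  Even x = ∃[ y ] x ≡ + 2 * y
  Odd  x = ∃[ y ] x ≡ 1ℤ + + 2 * y

  parityℕ : ∀ n → Even (+ n) ⊎ Odd (+ n)
  parityℕ ℕ.zero    = inj₁ (0ℤ , refl)
  parityℕ (ℕ.suc n) = next (parityℕ n)
    where
    next : Even (+ n) ⊎ Odd (+ n) → Even (+ ℕ.suc n) ⊎ Odd (+ ℕ.suc n)
    next (inj₁ (y , e)) = inj₂ (y , cong (λ z → 1ℤ + z) e)
    next (inj₂ (y , e)) = inj₁ (1ℤ + y , trans (cong (λ z → 1ℤ + z) e) (lemma y))
      where
      lemma : ∀ y → 1ℤ + (1ℤ + + 2 * y) ≡ + 2 * (1ℤ + y)
      lemma = solve-∀

  parity : ∀ x → Even x ⊎ Odd x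
  parity (+ n)    = parityℕ n
  parity -[1+ n ] = negate (parityℕ (ℕ.suc n))
    where
    negate : Even (+ ℕ.suc n) ⊎ Odd (+ ℕ.suc n) → Even -[1+ n ] ⊎ Odd -[1+ n ]
    negate (inj₁ (y , e)) = inj₁ (- y , trans (cong -_ e) (lemma y))
      where
      lemma : ∀ y → - (+ 2 * y) ≡ + 2 * - y
      lemma = solve-∀
    negate (inj₂ (y , e)) = inj₂ (- y - 1ℤ , trans (cong -_ e) (lemma y))
      where
      lemma : ∀ y → - (1ℤ + + 2 * y) ≡ 1ℤ + + 2 * (- y - 1ℤ)
      lemma = solve-∀

  ¬both : ∀ {x} → Even x → Odd x → ⊥
  ¬both (y , e) (z , e′) = even≢odd y z (trans (sym e) e′)

  odd* : ∀ {x y} → Odd x → Odd y → Odd (x * y)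
  odd* (u , refl) (v , refl) = u + v + + 2 * u * v , lemma u v
    where
    lemma : ∀ u v → (1ℤ + + 2 * u) * (1ℤ + + 2 * v) ≡ 1ℤ + + 2 * (u + v + + 2 * u * v)
    lemma = solve-∀

  even*ˡ : ∀ {x} y → Even x → Even (x * y)
  even*ˡ y (u , refl) = u * y , lemma u y
    where
    lemma : ∀ u y → + 2 * u * y ≡ + 2 * (u * y)
    lemma = solve-∀

  even*ʳ : ∀ x {y} → Even y → Even (x * y)
  even*ʳ x (u , refl) = x * u , lemma x u
    where
    lemma : ∀ x u → x * (+ 2 * u) ≡ + 2 * (x * u)
    lemma = solve-∀

  odd*⇒oddˡ : ∀ {x y} → Odd (x * y) → Odd x
  odd*⇒oddˡ {x} {y} xy-odd with parity x
  ... | inj₁ x-even = ⊥-elim (¬both (even*ˡ y x-even) xy-odd)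
  ... | inj₂ x-odd  = x-odd

  odd*⇒oddʳ : ∀ {x y} → Odd (x * y) → Odd y
  odd*⇒oddʳ {x} {y} xy-odd = odd*⇒oddˡ {y} {x} (subst Odd (*-comm x y) xy-odd)

  Congruent₂ : ℤ → ℤ → Set
  Congruent₂ x y = ∃[ w ] x ≡ y + + 2 * w

  congruent-even : ∀ {x y} → Congruent₂ x y → Even y → Even x
  congruent-even (w , refl) (u , refl) = u + w , sym (*-distribˡ-+ (+ 2) u w)

  congruent-odd : ∀ {x y} → Congruent₂ x y → Odd y → Odd x
  congruent-odd (w , refl) (u , refl) = u + w , lemma u w
    where
    lemma : ∀ u w → 1ℤ + + 2 * u + + 2 * w ≡ 1ℤ + + 2 * (u + w)
    lemma = solve-∀

  congruent-sym : ∀ {x y} → Congruent₂ x y → Congruent₂ y x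
  congruent-sym {y = y} (w , refl) = - w , lemma y w
    where
    lemma : ∀ y w → y ≡ y + + 2 * w + + 2 * - w
    lemma = solve-∀

  difference-even : ∀ {x y} → Even (x - y) → Congruent₂ x y
  difference-even {x} {y} (w , e) = w , trans (lemma x y) (cong (λ z → y + z) e)
    where
    lemma : ∀ x y → x ≡ y + (x - y)
    lemma = solve-∀

  triangular : ∀ x → ∃[ t ] x * (1ℤ + x) ≡ + 2 * t
  triangular x = helper (parity x)
    where
    helper : Even x ⊎ Odd x → ∃[ t ] x * (1ℤ + x) ≡ + 2 * t
    helper (inj₁ x-even)       = even*ˡ (1ℤ + x) x-even
    helper (inj₂ (y , x≡1+2y)) = even*ʳ x (1ℤ + y , trans (cong (λ z → 1ℤ + z) x≡1+2y) (lemma y))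
      where
      lemma : ∀ y → 1ℤ + (1ℤ + + 2 * y) ≡ + 2 * (1ℤ + y)
      lemma = solve-∀

  -- The numbers (x - y)² and x² + y² differ by 2xy.
  sum-of-squares-even : ∀ {x y} → Even (x * x + y * y) → Congruent₂ x y
  sum-of-squares-even {x} {y} (s , e) = difference-even (helper (parity (x - y)))
    where
    helper : Even (x - y) ⊎ Odd (x - y) → Even (x - y)
    helper (inj₁ even)    = even
    helper (inj₂ (d , o)) = ⊥-elim (even≢odd (s - x * y) (+ 2 * d + + 2 * d * d)
      (≡-by (eq0 e (- 1ℤ) ⊞ eq0 o (x - y + 1ℤ + + 2 * d)) (solve (x ∷ y ∷ s ∷ d ∷ []))))

  -- Odd squares are 1 modulo 4, so an odd x makes the sum 1 or 2 modulo 4.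
  sum-of-squares-4∣ : ∀ {x y s} → x * x + y * y ≡ + 4 * s → Even x
  sum-of-squares-4∣ {x} {y} {s} e = helper (parity x) (parity y)
    where
    helper : Even x ⊎ Odd x → Even y ⊎ Odd y → Even x
    helper (inj₁ even)    _               = even
    helper (inj₂ (u , o)) (inj₁ (v , o′)) = ⊥-elim (even≢odd (+ 2 * s - + 2 * v * v) (+ 2 * u + + 2 * u * u)
      (≡-by (eq0 e (- 1ℤ) ⊞ eq0 o (x + 1ℤ + + 2 * u) ⊞ eq0 o′ (y + + 2 * v)) (solve (x ∷ y ∷ s ∷ u ∷ v ∷ []))))
    helper (inj₂ (u , o)) (inj₂ (v , o′)) = ⊥-elim (even≢odd s (u + u * u + v + v * v) (*-cancelˡ-≡ (+ 2) (+ 2 * s) (1ℤ + + 2 * (u + u * u + v + v * v))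
      (≡-by (eq0 e (- 1ℤ) ⊞ eq0 o (x + 1ℤ + + 2 * u) ⊞ eq0 o′ (y + 1ℤ + + 2 * v)) (solve (x ∷ y ∷ s ∷ u ∷ v ∷ [])))))

-- From the coefficients of 4x to those of 2x by congruences

module HalfIntegers where
  open IntegerOrder using (even≢odd)
  open ParityDescent
  open import Data.Integer
  open import Data.Integer.Properties
  open import Data.Integer.Tactic.RingSolver using (solve)
  open import Data.List using ([]; _∷_)
  open import Data.Empty using (⊥; ⊥-elim)
  open import Data.Product using (∃-syntax; _×_; _,_)
  open import Data.Sum using (_⊎_; inj₁; inj₂)
  open import Relation.Binary.PropositionalEquality

  -- `A′`, `e`, `C′`, `f` are to be the coefficients of 4x at 1, √p, √q, √r, so the halves are those
  -- of 2x.
  Conclusion : (A C e f : ℤ) → Set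
  Conclusion A′ C′ e f = ∃[ A ] ∃[ B ] ∃[ C ] ∃[ D ]
    A′ ≡ + 2 * A × e ≡ + 2 * B × C′ ≡ + 2 * C × f ≡ + 2 * D × Congruent₂ A C

  -- With all four coordinates odd, the first equation gives (1 + q)(1 - p) ≡ 0 (mod 8),
  -- whereas this product is 4 (mod 8).
  odd-quadruple : ∀ {x y z w h p₁ q₁ ρ} →
    let p = + 3 + + 4 * p₁ ; q = 1ℤ + + 4 * q₁ ; r = p * q - + 8 * ρ in
    (1ℤ + + 2 * x) * (1ℤ + + 2 * x) + q * ((1ℤ + + 2 * y) * (1ℤ + + 2 * y))
      - p * ((1ℤ + + 2 * z) * (1ℤ + + 2 * z)) - r * ((1ℤ + + 2 * w) * (1ℤ + + 2 * w)) ≡ + 8 * h → ⊥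
  -- Writing x(1 + x) = 2T turns each odd square into 1 + 8T, so the congruence modulo 8 becomes a
  -- polynomial identity.
  odd-quadruple {x} {y} {z} {w} {h} {p₁} {q₁} {ρ} F = helper (triangular x) (triangular y) (triangular z) (triangular w)
    where
    helper : ∃[ t ] x * (1ℤ + x) ≡ + 2 * t → ∃[ t ] y * (1ℤ + y) ≡ + 2 * t →
             ∃[ t ] z * (1ℤ + z) ≡ + 2 * t → ∃[ t ] w * (1ℤ + w) ≡ + 2 * t → ⊥
    helper (T₁ , e₁) (T₂ , e₂) (T₃ , e₃) (T₄ , e₄) =
      even≢odd (- half) (q₁ + p₁ + + 2 * q₁ * p₁) (*-cancelˡ-≡ (+ 4) (+ 2 * - half) (1ℤ + + 2 * (q₁ + p₁ + + 2 * q₁ * p₁)) 4∣)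
      where
      half = h - T₁ - (1ℤ + + 4 * q₁) * T₂ + (+ 3 + + 4 * p₁) * T₃
             + ((+ 3 + + 4 * p₁) * (1ℤ + + 4 * q₁) - + 8 * ρ) * T₄ - ρ
      4∣ : + 4 * (+ 2 * - (h - T₁ - (1ℤ + + 4 * q₁) * T₂ + (+ 3 + + 4 * p₁) * T₃
             + ((+ 3 + + 4 * p₁) * (1ℤ + + 4 * q₁) - + 8 * ρ) * T₄ - ρ)) ≡ + 4 * (1ℤ + + 2 * (q₁ + p₁ + + 2 * q₁ * p₁))
      4∣ = ≡-by (eq0 F 1ℤ ⊞ eq0 e₁ (- + 4) ⊞ eq0 e₂ (- + 4 * (1ℤ + + 4 * q₁)) ⊞ eq0 e₃ (+ 4 * (+ 3 + + 4 * p₁))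
                  ⊞ eq0 e₄ (+ 4 * ((+ 3 + + 4 * p₁) * (1ℤ + + 4 * q₁) - + 8 * ρ)))
        (solve (x ∷ y ∷ z ∷ w ∷ h ∷ p₁ ∷ q₁ ∷ ρ ∷ T₁ ∷ T₂ ∷ T₃ ∷ T₄ ∷ []))

  module Odd-p {p₁ q₁ ρ π : ℤ} where
    private
      odd-A : ∀ {x y z f k} → (1ℤ + + 2 * x) * (1ℤ + + 2 * y) - (1ℤ + + 2 * π) * (+ 2 * z) * f ≡ + 4 * k → ⊥
      odd-A {x} {y} {z} {f} {k} F₂ = even≢odd (+ 2 * k + (1ℤ + + 2 * π) * z * f) (x + y + + 2 * x * y)
        (≡-by (eq0 F₂ (- 1ℤ)) (solve (x ∷ y ∷ z ∷ f ∷ k ∷ π ∷ [])))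

      odd-ef : ∀ {A C z w k} → + 2 * A * (+ 2 * C) - (1ℤ + + 2 * π) * (1ℤ + + 2 * z) * (1ℤ + + 2 * w) ≡ + 4 * k → ⊥
      odd-ef {A} {C} {z} {w} {k} F₂ = even≢odd
        (+ 2 * A * C - + 2 * k - π * (1ℤ + + 2 * z) * (1ℤ + + 2 * w)) (z + w + + 2 * z * w)
        (≡-by (eq0 F₂ 1ℤ) (solve (A ∷ C ∷ z ∷ w ∷ k ∷ π ∷ [])))

      -- Modulo 4 one has q ≡ 1 and p ≡ r ≡ 3, so the first equation gives A² + B² + C² + D² ≡ 2h.
      -- As 2h ≡ 2k and p′ is odd, this is 2AC + 2BD. Hence 4 divides (A - C)² + (B - D)².
      halves : ∀ {A B C D h k w} → let p = + 3 + + 4 * p₁ ; q = 1ℤ + + 4 * q₁ ; r = p * q - + 8 * ρ in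
        + 2 * A * (+ 2 * A) + q * (+ 2 * C * (+ 2 * C)) - p * (+ 2 * B * (+ 2 * B)) - r * (+ 2 * D * (+ 2 * D)) ≡ + 8 * h →
        + 2 * A * (+ 2 * C) - (1ℤ + + 2 * π) * (+ 2 * B) * (+ 2 * D) ≡ + 4 * k →
        h ≡ k + + 2 * w → Congruent₂ A C
      halves {A} {B} {C} {D} {h} {k} {w} F₁ F₂ h≡k = difference-even (sum-of-squares-4∣ {A - C} {B - D} {s}
        (*-cancelˡ-≡ (+ 4) ((A - C) * (A - C) + (B - D) * (B - D)) (+ 4 * s) 4∣))
        where
        s = w - q₁ * C * C + (1ℤ + p₁) * B * B + (1ℤ + p₁ + + 3 * q₁ + + 4 * p₁ * q₁ - + 2 * ρ) * D * D - (1ℤ + π) * B * D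
        4∣ : + 4 * ((A - C) * (A - C) + (B - D) * (B - D)) ≡ + 4 * (+ 4 *
          (w - q₁ * C * C + (1ℤ + p₁) * B * B + (1ℤ + p₁ + + 3 * q₁ + + 4 * p₁ * q₁ - + 2 * ρ) * D * D - (1ℤ + π) * B * D))
        4∣ = ≡-by (eq0 F₁ 1ℤ ⊞ eq0 h≡k (+ 8) ⊞ eq0 F₂ (- + 2))
          (solve (A ∷ B ∷ C ∷ D ∷ h ∷ k ∷ w ∷ p₁ ∷ q₁ ∷ ρ ∷ π ∷ []))

      e≡f : ∀ {e f w} → (+ 3 + + 4 * p₁) * e ≡ (1ℤ + + 2 * π) * f + + 2 * w → Congruent₂ e f
      e≡f {e} {f} {w} F₅ = w - (1ℤ + + 2 * p₁) * e + π * f , ≡-by (eq0 F₅ 1ℤ) (solve (e ∷ f ∷ w ∷ p₁ ∷ π ∷ []))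

    -- A′ and C′ have equal parity, and so do e and f, because p and p′ are odd. The product
    -- equation excludes opposite parities of the two pairs, and the quadratic one excludes four odd
    -- numbers.
    descent : ∀ {A′ C′ e f h k} → let p = + 3 + + 4 * p₁ ; q = 1ℤ + + 4 * q₁ ; r = p * q - + 8 * ρ in
      A′ * A′ + q * (C′ * C′) - p * (e * e) - r * (f * f) ≡ + 8 * h →
      A′ * C′ - (1ℤ + + 2 * π) * e * f ≡ + 4 * k →
      Congruent₂ h k → Congruent₂ A′ C′ → Congruent₂ (p * e) ((1ℤ + + 2 * π) * f) → Conclusion A′ C′ e f
    descent {A′} {C′} {e} {f} {h} {k} F₁ F₂ (w , h≡k) A′≡C′ (_ , pe≡p′f) =
      cases (parity A′) (parity e)
      where
      f≡e = congruent-sym (e≡f pe≡p′f)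
      C′≡A′ = congruent-sym A′≡C′
      cases : Even A′ ⊎ Odd A′ → Even e ⊎ Odd e → Conclusion A′ C′ e f
      cases (inj₁ A′-even) (inj₁ e-even) = even-even A′-even (congruent-even C′≡A′ A′-even) e-even (congruent-even f≡e e-even)
        where
        even-even : Even A′ → Even C′ → Even e → Even f → Conclusion A′ C′ e f
        even-even (A , refl) (C , refl) (B , refl) (D , refl) =
          A , B , C , D , refl , refl , refl , refl , halves F₁ F₂ h≡k
      cases (inj₁ A′-even) (inj₂ e-odd) = even-odd A′-even (congruent-even C′≡A′ A′-even) e-odd (congruent-odd f≡e e-odd)
        where
        even-odd : Even A′ → Even C′ → Odd e → Odd f → Conclusion A′ C′ e f
        even-odd (A , refl) (C , refl) (z , refl) (w , refl) = ⊥-elim (odd-ef {A} {C} {z} {w} F₂)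
      cases (inj₂ A′-odd) (inj₁ e-even) = odd-even A′-odd (congruent-odd C′≡A′ A′-odd) e-even
        where
        odd-even : Odd A′ → Odd C′ → Even e → Conclusion A′ C′ e f
        odd-even (x , refl) (y , refl) (z , refl) = ⊥-elim (odd-A {x} {y} {z} {f} F₂)
      cases (inj₂ A′-odd) (inj₂ e-odd) = odd-odd A′-odd (congruent-odd C′≡A′ A′-odd) e-odd (congruent-odd f≡e e-odd)
        where
        odd-odd : Odd A′ → Odd C′ → Odd e → Odd f → Conclusion A′ C′ e f
        odd-odd (x , refl) (y , refl) (z , refl) (w , refl) = ⊥-elim (odd-quadruple {x} {y} {z} {w} {h} {p₁} {q₁} {ρ} F₁)

  module Even-p {p₁ q₁ r₁ g π : ℤ} (gπ≡1+2p₁ : g * π ≡ 1ℤ + + 2 * p₁) where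
    private
      odd-A : ∀ {x y e f k} → (1ℤ + + 2 * x) * (1ℤ + + 2 * y) - + 2 * π * e * f ≡ + 4 * k → ⊥
      odd-A {x} {y} {e} {f} {k} F₂ = even≢odd (+ 2 * k + π * e * f) (x + y + + 2 * x * y)
        (≡-by (eq0 F₂ (- 1ℤ)) (solve (x ∷ y ∷ e ∷ f ∷ k ∷ π ∷ [])))

      -- Halving the equation makes π times an odd number even; the factor g brings in gπ, which is
      -- odd.
      odd-ef : ∀ {A C z w k} → + 2 * A * (+ 2 * C) - + 2 * π * (1ℤ + + 2 * z) * (1ℤ + + 2 * w) ≡ + 4 * k → ⊥
      odd-ef {A} {C} {z} {w} {k} F₂ = even≢odd (g * (A * C - k)) (p₁ * (1ℤ + + 2 * z) * (1ℤ + + 2 * w) + z + w + + 2 * z * w)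
        (*-cancelˡ-≡ (+ 2) (+ 2 * (g * (A * C - k))) (1ℤ + + 2 * (p₁ * (1ℤ + + 2 * z) * (1ℤ + + 2 * w) + z + w + + 2 * z * w)) 2∣)
        where
        2∣ : + 2 * (+ 2 * (g * (A * C - k))) ≡ + 2 * (1ℤ + + 2 * (p₁ * (1ℤ + + 2 * z) * (1ℤ + + 2 * w) + z + w + + 2 * z * w))
        2∣ = ≡-by (eq0 F₂ g ⊞ eq0 gπ≡1+2p₁ (+ 2 * (1ℤ + + 2 * z) * (1ℤ + + 2 * w)))
          (solve (A ∷ C ∷ z ∷ w ∷ k ∷ g ∷ π ∷ p₁ ∷ []))

      -- As p and r are twice odd numbers, the quadratic equation modulo 4 reduces to 2(e² + f²) ≡ 0
      -- once the other two coefficients are even.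
      e≡f : ∀ {A C e f h} →
        + 2 * A * (+ 2 * A) + (1ℤ + + 4 * q₁) * (+ 2 * C * (+ 2 * C))
          - + 2 * (1ℤ + + 2 * p₁) * (e * e) - + 2 * (1ℤ + + 2 * r₁) * (f * f) ≡ + 8 * h → Congruent₂ e f
      e≡f {A} {C} {e} {f} {h} F₁ = sum-of-squares-even {e} {f} (s , *-cancelˡ-≡ (+ 2) (e * e + f * f) (+ 2 * s) 2∣)
        where
        s = A * A + (1ℤ + + 4 * q₁) * C * C - + 2 * h - p₁ * e * e - r₁ * f * f
        2∣ : + 2 * (e * e + f * f) ≡
             + 2 * (+ 2 * (A * A + (1ℤ + + 4 * q₁) * C * C - + 2 * h - p₁ * e * e - r₁ * f * f))
        2∣ = ≡-by (eq0 F₁ (- 1ℤ)) (solve (A ∷ C ∷ e ∷ f ∷ h ∷ p₁ ∷ q₁ ∷ r₁ ∷ []))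

      halves : ∀ {A B C D h k w} → let p = + 2 * (1ℤ + + 2 * p₁) ; q = 1ℤ + + 4 * q₁ ; r = + 2 * (1ℤ + + 2 * r₁) in
        + 2 * A * (+ 2 * A) + q * (+ 2 * C * (+ 2 * C)) - p * (+ 2 * B * (+ 2 * B)) - r * (+ 2 * D * (+ 2 * D)) ≡ + 8 * h →
        + 2 * A * (+ 2 * C) - + 2 * π * (+ 2 * B) * (+ 2 * D) ≡ + 4 * k →
        h ≡ k + + 2 * w → Congruent₂ A C
      halves {A} {B} {C} {D} {h} {k} {w} F₁ F₂ h≡k = difference-even (square-even (parity (A - C)))
        where
        s = + 2 * w - + 2 * q₁ * C * C + (1ℤ + + 2 * p₁) * B * B + (1ℤ + + 2 * r₁) * D * D - + 2 * π * B * D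
        4∣ : + 4 * ((A - C) * (A - C)) ≡ + 4 * (+ 2 *
          (+ 2 * w - + 2 * q₁ * C * C + (1ℤ + + 2 * p₁) * B * B + (1ℤ + + 2 * r₁) * D * D - + 2 * π * B * D))
        4∣ = ≡-by (eq0 F₁ 1ℤ ⊞ eq0 h≡k (+ 8) ⊞ eq0 F₂ (- + 2))
          (solve (A ∷ B ∷ C ∷ D ∷ h ∷ k ∷ w ∷ p₁ ∷ q₁ ∷ r₁ ∷ π ∷ []))
        square-even : Even (A - C) ⊎ Odd (A - C) → Even (A - C)
        square-even (inj₁ even) = even
        square-even (inj₂ odd)  = ⊥-elim (¬both
          (s , *-cancelˡ-≡ (+ 4) ((A - C) * (A - C)) (+ 2 * s) 4∣) (odd* {A - C} {A - C} odd odd))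

    -- The parity of A′ has to be settled first: an odd A′ contradicts the product equation, whose
    -- other terms are even, and the congruence of e and f is available only for even A′ and C′.
    descent : ∀ {A′ C′ e f h k} → let p = + 2 * (1ℤ + + 2 * p₁) ; q = 1ℤ + + 4 * q₁ ; r = + 2 * (1ℤ + + 2 * r₁) in
      A′ * A′ + q * (C′ * C′) - p * (e * e) - r * (f * f) ≡ + 8 * h →
      A′ * C′ - + 2 * π * e * f ≡ + 4 * k →
      Congruent₂ h k → Congruent₂ A′ C′ → Conclusion A′ C′ e f
    descent {A′} {C′} {e} {f} {h} {k} F₁ F₂ (w , h≡k) A′≡C′ = case-A (parity A′)
      where
      C′≡A′ = congruent-sym A′≡C′
      case-A : Even A′ ⊎ Odd A′ → Conclusion A′ C′ e f
      case-A (inj₂ A′-odd)  = odd A′-odd (congruent-odd C′≡A′ A′-odd)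
        where
        odd : Odd A′ → Odd C′ → Conclusion A′ C′ e f
        odd (x , refl) (y , refl) = ⊥-elim (odd-A {x} {y} {e} {f} F₂)
      case-A (inj₁ A′-even) = even A′-even (congruent-even C′≡A′ A′-even)
        where
        even : Even A′ → Even C′ → Conclusion A′ C′ e f
        even (A , refl) (C , refl) = case-e (parity f)
          where
          e≡f′ = e≡f {A} {C} {e} {f} F₁
          case-e : Even f ⊎ Odd f → Conclusion A′ C′ e f
          case-e (inj₁ f-even) = all-even f-even (congruent-even e≡f′ f-even)
            where
            all-even : Even f → Even e → Conclusion A′ C′ e f
            all-even (D , refl) (B , refl) = A , B , C , D , refl , refl , refl , refl , halves F₁ F₂ h≡k
          case-e (inj₂ f-odd) = both-odd f-odd (congruent-odd e≡f′ f-odd)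
            where
            both-odd : Odd f → Odd e → Conclusion A′ C′ e f
            both-odd (w , refl) (z , refl) = ⊥-elim (odd-ef {A} {C} {z} {w} F₂)

-- Rationals that represent integer expressions

module Representation where
  open RationalIntegers
  open import Defs using (fromℤ)
  open import Data.Integer as ℤ using (ℤ; +_)
  open import Data.Product using (_,_)
  open import Data.Rational
  open import Data.Rational.Properties
  open import Relation.Binary.PropositionalEquality

  infix 4 _↝_
  infixl 6 _⟨+⟩_ _⟨-⟩_
  infixl 7 _⟨*⟩_

  -- A record rather than a synonym for a ≡ fromℤ x, so that x can be inferred.
  record _↝_ (a : ℚ) (x : ℤ) : Set where
    constructor rep
    field
      unrep : a ≡ fromℤ x

  open _↝_ public

  ⟦_⟧ : ∀ x → fromℤ x ↝ x
  ⟦ x ⟧ = rep refl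

  _⟨+⟩_ : ∀ {a b x y} → a ↝ x → b ↝ y → a + b ↝ x ℤ.+ y
  _⟨+⟩_ {x = x} {y} (rep refl) (rep refl) = rep (sym (fromℤ-+ x y))

  _⟨*⟩_ : ∀ {a b x y} → a ↝ x → b ↝ y → a * b ↝ x ℤ.* y
  _⟨*⟩_ {x = x} {y} (rep refl) (rep refl) = rep (sym (fromℤ-* x y))

  _⟨-⟩_ : ∀ {a b x y} → a ↝ x → b ↝ y → a - b ↝ x ℤ.- y
  _⟨-⟩_ {x = x} {y} (rep refl) (rep refl) =
    rep (sym (trans (fromℤ-+ x (ℤ.- y)) (cong (λ z → fromℤ x + z) (fromℤ-neg y))))

  ↝-injective : ∀ {a b x y} → a ↝ x → b ↝ y → a ≡ b → x ≡ y
  ↝-injective {x = x} {y} (rep a≡x) (rep b≡y) a≡b = fromℤ-injective {x} {y} (trans (sym a≡x) (trans a≡b b≡y))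

  ↝-resp : ∀ {a b x} → a ≡ b → a ↝ x → b ↝ x
  ↝-resp refl a↝x = a↝x

  ↝⇒isInteger : ∀ {a x} → a ↝ x → IsInteger a
  ↝⇒isInteger {x = x} (rep a≡x) = x , a≡x

  isInteger⇒↝ : ∀ {a} ((x , _) : IsInteger a) → a ↝ x
  isInteger⇒↝ (_ , a≡x) = rep a≡x

  double-injective : ∀ {x y} → x + x ≡ y + y → x ≡ y
  double-injective {x} {y} e = trans (half x) (trans (cong (½ *_) e) (sym (half y)))
    where
    half : ∀ x → x ≡ ½ * (x + x)
    half x = trans (sym (*-identityˡ x)) (trans (*-distribʳ-+ x ½ ½) (sym (*-distribˡ-+ ½ x x)))

  halve : ∀ {a x y} → a + a ↝ x → x ≡ + 2 ℤ.* y → a ↝ y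
  halve {a} {y = y} (rep 2a≡x) refl = rep (double-injective (trans 2a≡x (trans (fromℤ-* (+ 2) y) (double (fromℤ y)))))
    where
    double : ∀ y → fromℤ (+ 2) * y ≡ y + y
    double y = trans (*-distribʳ-+ y 1ℚ 1ℚ) (cong₂ _+_ (*-identityˡ y) (*-identityˡ y))

-- Conjugations of K and the integers of ℚ(√q)

module Conjugation (p q : ℕ) where
  open ℚRing
  open RationalIntegers
  open Representation
  open ParityDescent using (Congruent₂; sum-of-squares-even; eq0; ≡-by; _⊞_)
  open BiquadraticRing p q
  open IntegralElements p q
  open Defs using (fromℤ; fromℕ; SquareFree)
  open Defs.Biquadratic p q
  open import Data.Integer as ℤ using (ℤ; +_; 1ℤ)
  import Data.Integer.Tactic.RingSolver as ℤ-Solver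
  open import Data.Nat using (zero; suc)
  open import Data.Product using (∃-syntax; _×_; _,_; proj₁)
  open import Data.Rational
  open import Data.Rational.Properties
  open import Relation.Binary.PropositionalEquality
  open import Tactic.RingSolver using (solve-∀)
  open AlmostIntegrality K-ring Integral Denominator using () renaming (_^_ to _^ᴷ_)

  private
    P Q : ℚ
    P = fromℕ p
    Q = fromℕ q

  -- The field fixed by σ is ℚ(√q), so σ gives the relative trace and norm; τ then leads from ℚ(√q)
  -- to ℚ.
  σ τ : K → K
  σ ⟨ a , b , c , d ⟩ = ⟨ a , - b , c , - d ⟩
  τ ⟨ a , b , c , d ⟩ = ⟨ a , b , - c , - d ⟩

  private
    conjugate-re : ∀ P Q a b c d a′ b′ c′ d′ →
      a * a′ + P * (b * b′) + Q * (c * c′) + P * Q * (d * d′)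
      ≡ a * a′ + P * (- b * - b′) + Q * (c * c′) + P * Q * (- d * - d′)
    conjugate-re = solve-∀ ℚ-ring

    conjugate-re′ : ∀ P Q a b c d a′ b′ c′ d′ →
      a * a′ + P * (b * b′) + Q * (c * c′) + P * Q * (d * d′)
      ≡ a * a′ + P * (b * b′) + Q * (- c * - c′) + P * Q * (- d * - d′)
    conjugate-re′ = solve-∀ ℚ-ring

    conjugate-moved : ∀ P a b c d a′ b′ c′ d′ →
      - (a * b′ + b * a′ + P * (c * d′ + d * c′)) ≡ a * - b′ + - b * a′ + P * (c * - d′ + - d * c′)
    conjugate-moved = solve-∀ ℚ-ring

    conjugate-fixed : ∀ P a b c d a′ b′ c′ d′ →
      a * c′ + c * a′ + P * (b * d′ + d * b′) ≡ a * c′ + c * a′ + P * (- b * - d′ + - d * - b′)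
    conjugate-fixed = solve-∀ ℚ-ring

    conjugate-√pq : ∀ a b c d a′ b′ c′ d′ →
      - (a * d′ + d * a′ + (b * c′ + c * b′)) ≡ a * - d′ + - d * a′ + (- b * c′ + c * - b′)
    conjugate-√pq = solve-∀ ℚ-ring

    conjugate-√pq′ : ∀ a b c d a′ b′ c′ d′ →
      - (a * d′ + d * a′ + (b * c′ + c * b′)) ≡ a * - d′ + - d * a′ + (b * - c′ + - c * b′)
    conjugate-√pq′ = solve-∀ ℚ-ring

  σ-homo-* : ∀ x y → σ (x *ᴷ y) ≡ σ x *ᴷ σ y
  σ-homo-* ⟨ a , b , c , d ⟩ ⟨ a′ , b′ , c′ , d′ ⟩ = K-≡
    (conjugate-re P Q a b c d a′ b′ c′ d′) (conjugate-moved Q a b c d a′ b′ c′ d′)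
    (conjugate-fixed P a b c d a′ b′ c′ d′) (conjugate-√pq a b c d a′ b′ c′ d′)

  τ-homo-* : ∀ x y → τ (x *ᴷ y) ≡ τ x *ᴷ τ y
  τ-homo-* ⟨ a , b , c , d ⟩ ⟨ a′ , b′ , c′ , d′ ⟩ = K-≡
    (conjugate-re′ P Q a b c d a′ b′ c′ d′) (conjugate-fixed Q a c b d a′ c′ b′ d′)
    (conjugate-moved P a c b d a′ c′ b′ d′) (conjugate-√pq′ a b c d a′ b′ c′ d′)

  conjugate-almostIntegral : ∀ (f : K → K) → (∀ x y → f (x *ᴷ y) ≡ f x *ᴷ f y) →
    (∀ r → f (fromRational r) ≡ fromRational r) → (∀ {x} → Integral x → Integral (f x)) →
    ∀ {x} → AlmostIntegral x → AlmostIntegral (f x)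
  conjugate-almostIntegral f f-* f-ℚ f-integral {x} (_ , (n , refl) , h) =
    _ , (n , refl) , λ k → subst Integral
      (trans (f-* (fromRational (fromℕ (suc n))) (x ^ᴷ k)) (cong₂ _*ᴷ_ (f-ℚ (fromℕ (suc n))) (power k))) (f-integral (h k))
    where
    power : ∀ k → f (x ^ᴷ k) ≡ f x ^ᴷ k
    power zero    = f-ℚ 1ℚ
    power (suc k) = trans (f-* x (x ^ᴷ k)) (cong (f x *ᴷ_) (power k))

  σ-almostIntegral : ∀ {x} → AlmostIntegral x → AlmostIntegral (σ x)
  σ-almostIntegral = conjugate-almostIntegral σ σ-homo-* (λ _ → refl)
    λ (a , b , c , d) → a , neg-isInteger b , c , neg-isInteger d

  τ-almostIntegral : ∀ {x} → AlmostIntegral x → AlmostIntegral (τ x)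
  τ-almostIntegral = conjugate-almostIntegral τ τ-homo-* (λ _ → refl)
    λ (a , b , c , d) → a , b , neg-isInteger c , neg-isInteger d

  private
    norm-re : ∀ P Q u v → u * u + P * (0ℚ * 0ℚ) + Q * (v * - v) + P * Q * (0ℚ * - 0ℚ) ≡ u * u - Q * (v * v)
    norm-re = solve-∀ ℚ-ring

    norm-√p : ∀ Q u v → u * 0ℚ + 0ℚ * u + Q * (v * - 0ℚ + 0ℚ * - v) ≡ 0ℚ
    norm-√p = solve-∀ ℚ-ring

    norm-√q : ∀ P u v → u * - v + v * u + P * (0ℚ * - 0ℚ + 0ℚ * 0ℚ) ≡ 0ℚ
    norm-√q = solve-∀ ℚ-ring

    norm-√pq : ∀ u v → u * - 0ℚ + 0ℚ * u + (0ℚ * - v + v * 0ℚ) ≡ 0ℚ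
    norm-√pq = solve-∀ ℚ-ring

    discriminant : ∀ Q u v → (u + u) * (u + u) - fromℤ (+ 4) * (u * u - Q * (v * v)) ≡ Q * ((v + v) * (v + v))
    discriminant = solve-∀ ℚ-ring

    discriminant′ : ∀ Q u v → (u + u) * (u + u) - Q * ((v + v) * (v + v)) ≡ fromℤ (+ 4) * (u * u - Q * (v * v))
    discriminant′ = solve-∀ ℚ-ring

  -- The trace 2u and the norm N = u² - qv² are almost integral rationals, hence integers. Then
  -- q(2v)² = (2u)² - 4N is an integer and square-freeness yields 2v. The congruence is h² - qk² =
  -- 4N modulo 2, as q is odd.
  quadratic-integer : ∀ {q₁ u v} → SquareFree q → + q ≡ 1ℤ ℤ.+ + 4 ℤ.* q₁ → AlmostIntegral ⟨ u , 0ℚ , v , 0ℚ ⟩ →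
    ∃[ h ] ∃[ k ] u + u ↝ h × v + v ↝ k × Congruent₂ h k
  quadratic-integer {q₁} {u} {v} q-sf q≡1 ai = h , k , 2u↝h , 2v↝k ,
    sum-of-squares-even {h} {k} (+ 2 ℤ.* N ℤ.+ (1ℤ ℤ.+ + 2 ℤ.* q₁) ℤ.* (k ℤ.* k) , ≡-by (eq0 h²-qk²≡4N 1ℤ ⊞ eq0 q≡1 (k ℤ.* k))
      (identity h k N (+ q) q₁))
    where
    x = ⟨ u , 0ℚ , v , 0ℚ ⟩
    trace-integer : IsInteger (u + u)
    trace-integer = fromRational-almostIntegral (subst AlmostIntegral (K-≡ refl refl (+-inverseʳ v) refl)
      (+-almostIntegral {x} {τ x} ai (τ-almostIntegral {x} ai)))
    norm-integer : IsInteger (u * u - Q * (v * v))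
    norm-integer = fromRational-almostIntegral (subst AlmostIntegral
      (K-≡ (norm-re P Q u v) (norm-√p Q u v) (norm-√q P u v) (norm-√pq u v))
      (*-almostIntegral {x} {τ x} ai (τ-almostIntegral {x} ai)))
    h    = proj₁ trace-integer
    2u↝h = isInteger⇒↝ trace-integer
    N    = proj₁ norm-integer
    N↝   = isInteger⇒↝ norm-integer
    2v-integer : IsInteger (v + v)
    2v-integer = squareFree-isInteger q-sf (↝⇒isInteger
      (↝-resp (discriminant Q u v) (2u↝h ⟨*⟩ 2u↝h ⟨-⟩ ⟦ + 4 ⟧ ⟨*⟩ N↝)))
    k    = proj₁ 2v-integer
    2v↝k = isInteger⇒↝ 2v-integer
    h²-qk²≡4N : h ℤ.* h ℤ.- + q ℤ.* (k ℤ.* k) ≡ + 4 ℤ.* N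
    h²-qk²≡4N = ↝-injective (2u↝h ⟨*⟩ 2u↝h ⟨-⟩ ⟦ + q ⟧ ⟨*⟩ (2v↝k ⟨*⟩ 2v↝k)) (⟦ + 4 ⟧ ⟨*⟩ N↝) (discriminant′ Q u v)
    identity : ∀ h k N q q₁ → 1ℤ ℤ.* (h ℤ.* h ℤ.- q ℤ.* (k ℤ.* k) ℤ.- + 4 ℤ.* N) ℤ.+ k ℤ.* k ℤ.* (q ℤ.- (1ℤ ℤ.+ + 4 ℤ.* q₁))
      ≡ h ℤ.* h ℤ.+ k ℤ.* k ℤ.- + 2 ℤ.* (+ 2 ℤ.* N ℤ.+ (1ℤ ℤ.+ + 2 ℤ.* q₁) ℤ.* (k ℤ.* k))
    identity = ℤ-Solver.solve-∀

-- The residue of p modulo 4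

module ResidueCases where
  open ParityDescent
  open HalfIntegers
  open import Data.Integer
  open import Data.Integer.Properties
  open import Data.Integer.Tactic.RingSolver using (solve; solve-∀)
  open import Data.List using ([]; _∷_)
  open import Data.Empty using (⊥-elim)
  open import Data.Product using (∃-syntax; _,_)
  open import Data.Sum using (_⊎_; inj₁; inj₂)
  open import Relation.Binary.PropositionalEquality

  -- A common interface for p ≡ 2 and p ≡ 3, so that the computation of the coordinates need not
  -- distinguish them.
  Descent : (p q r p′ : ℤ) → Set
  Descent p q r p′ = ∀ {A C e f h k} →
    A * A + q * (C * C) - p * (e * e) - r * (f * f) ≡ + 8 * h →
    A * C - p′ * e * f ≡ + 4 * k →
    Congruent₂ h k → Congruent₂ A C → Congruent₂ (p * e) (p′ * f) → Conclusion A C e f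

  odd-1+4 : ∀ {x} y → x ≡ 1ℤ + + 4 * y → Odd x
  odd-1+4 y e = + 2 * y , trans e (lemma y)
    where
    lemma : ∀ y → 1ℤ + + 4 * y ≡ 1ℤ + + 2 * (+ 2 * y)
    lemma = solve-∀

  odd-3+4 : ∀ {x} y → x ≡ + 3 + + 4 * y → Odd x
  odd-3+4 y e = 1ℤ + + 2 * y , trans e (lemma y)
    where
    lemma : ∀ y → + 3 + + 4 * y ≡ 1ℤ + + 2 * (1ℤ + + 2 * y)
    lemma = solve-∀

  -- Since g divides the odd number q, g = 1 + 2γ and g² - 1 = 4γ(1 + γ) = 8T. Hence pq - r = (g² -
  -- 1)p′q′ is the multiple 8p′q′T of 8.
  descent-p≡3 : ∀ {g p′ q′ p₁ q₁} → g * p′ ≡ + 3 + + 4 * p₁ → g * q′ ≡ 1ℤ + + 4 * q₁ →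
                Descent (g * p′) (g * q′) (p′ * q′) p′
  descent-p≡3 {g} {p′} {q′} {p₁} {q₁} hp hq =
    helper (odd*⇒oddˡ {g} {q′} (odd-1+4 q₁ hq)) (odd*⇒oddʳ {g} {p′} (odd-3+4 p₁ hp))
    where
    helper : Odd g → Odd p′ → Descent (g * p′) (g * q′) (p′ * q′) p′
    helper (γ , g≡1+2γ) (π , p′≡1+2π) = with-ρ (triangular γ)
      where
      with-ρ : ∃[ t ] γ * (1ℤ + γ) ≡ + 2 * t → Descent (g * p′) (g * q′) (p′ * q′) p′
      with-ρ (T , γ[1+γ]≡2T) {A} {C} {e} {f} {h} {k} F₁ F₂ h≡k A≡C pe≡p′f =
        Odd-p.descent {p₁} {q₁} {p′ * q′ * T} {π}
          (subst (λ r → A * A + (1ℤ + + 4 * q₁) * (C * C) - (+ 3 + + 4 * p₁) * (e * e) - r * (f * f) ≡ + 8 * h) r≡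
            (subst₂ (λ p q → A * A + q * (C * C) - p * (e * e) - p′ * q′ * (f * f) ≡ + 8 * h) hp hq F₁))
          (subst (λ p′ → A * C - p′ * e * f ≡ + 4 * k) p′≡1+2π F₂)
          h≡k A≡C
          (subst₂ (λ p p′ → Congruent₂ (p * e) (p′ * f)) hp p′≡1+2π pe≡p′f)
        where
        r≡ : p′ * q′ ≡ (+ 3 + + 4 * p₁) * (1ℤ + + 4 * q₁) - + 8 * (p′ * q′ * T)
        r≡ = ≡-by (eq0 hp (g * q′) ⊞ eq0 hq (+ 3 + + 4 * p₁) ⊞ eq0 g≡1+2γ (- (p′ * q′ * (g + 1ℤ + + 2 * γ)))
                    ⊞ eq0 γ[1+γ]≡2T (- (+ 4 * p′ * q′)))
          (solve (g ∷ p′ ∷ q′ ∷ p₁ ∷ q₁ ∷ γ ∷ T ∷ []))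

  -- As g is odd, the factor 2 of p sits in p′ = 2π. Both gπ = p/2 and πq′ = r/2 are then odd.
  descent-p≡2 : ∀ {g p′ q′ p₁ q₁} → g * p′ ≡ + 2 + + 4 * p₁ → g * q′ ≡ 1ℤ + + 4 * q₁ →
                Descent (g * p′) (g * q′) (p′ * q′) p′
  descent-p≡2 {g} {p′} {q′} {p₁} {q₁} hp hq = helper (parity p′)
    where
    gq′-odd : Odd (g * q′)
    gq′-odd = odd-1+4 q₁ hq
    g-odd : Odd g
    g-odd = odd*⇒oddˡ {g} {q′} gq′-odd
    gp′-even : Even (g * p′)
    gp′-even = 1ℤ + + 2 * p₁ , trans hp (lemma p₁)
      where
      lemma : ∀ p₁ → + 2 + + 4 * p₁ ≡ + 2 * (1ℤ + + 2 * p₁)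
      lemma = solve-∀
    helper : Even p′ ⊎ Odd p′ → Descent (g * p′) (g * q′) (p′ * q′) p′
    helper (inj₂ p′-odd)      = ⊥-elim (¬both gp′-even (odd* {g} {p′} g-odd p′-odd))
    helper (inj₁ (π , p′≡2π)) = with-r₁ (odd* {π} {q′} (odd*⇒oddʳ {g} {π} (p₁ , gπ≡)) (odd*⇒oddʳ {g} {q′} gq′-odd))
      where
      gπ≡ : g * π ≡ 1ℤ + + 2 * p₁
      gπ≡ = *-cancelˡ-≡ (+ 2) (g * π) (1ℤ + + 2 * p₁) 2gπ≡
        where
        2gπ≡ : + 2 * (g * π) ≡ + 2 * (1ℤ + + 2 * p₁)
        2gπ≡ = ≡-by (eq0 hp 1ℤ ⊞ eq0 p′≡2π (- g)) (solve (g ∷ p′ ∷ π ∷ p₁ ∷ []))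
      p≡ : g * p′ ≡ + 2 * (1ℤ + + 2 * p₁)
      p≡ = ≡-by (eq0 hp 1ℤ) (solve (g ∷ p′ ∷ p₁ ∷ []))
      with-r₁ : Odd (π * q′) → Descent (g * p′) (g * q′) (p′ * q′) p′
      with-r₁ (r₁ , πq′≡) {A} {C} {e} {f} {h} {k} F₁ F₂ h≡k A≡C _ =
        Even-p.descent {p₁} {q₁} {r₁} {g} {π} gπ≡
          (subst (λ r → A * A + (1ℤ + + 4 * q₁) * (C * C) - + 2 * (1ℤ + + 2 * p₁) * (e * e) - r * (f * f) ≡ + 8 * h) r≡
            (subst₂ (λ p q → A * A + q * (C * C) - p * (e * e) - p′ * q′ * (f * f) ≡ + 8 * h) p≡ hq F₁))
          (subst (λ p′ → A * C - p′ * e * f ≡ + 4 * k) p′≡2π F₂)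
          h≡k A≡C
        where
        r≡ : p′ * q′ ≡ + 2 * (1ℤ + + 2 * r₁)
        r≡ = ≡-by (eq0 p′≡2π q′ ⊞ eq0 πq′≡ (+ 2)) (solve (p′ ∷ q′ ∷ π ∷ r₁ ∷ []))

-- Half-integral coordinates of the elements of the ring of integers

module IntegerCoordinates (p q : ℕ) where
  open ℚRing
  open RationalIntegers
  open Representation
  open ParityDescent
  open HalfIntegers
  open ResidueCases using (Descent)
  open BiquadraticRing p q
  open IntegralElements p q
  open Conjugation p q
  open Defs using (fromℤ; fromℕ; SquareFree)
  open Defs.Biquadratic p q
  open K
  open import Data.Integer as ℤ using (ℤ; +_; 1ℤ)
  import Data.Integer.Properties as ℤ
  import Data.Nat as ℕ
  open import Data.Nat.Coprimality using (Coprime; coprime-Bézout)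
  open import Data.Nat.GCD using (module Bézout)
  open import Data.Product using (∃-syntax; _×_; _,_; proj₁)
  open import Data.Rational
  open import Data.Rational.Properties
  open import Relation.Binary.PropositionalEquality
  open import Tactic.RingSolver using (solve-∀)

  private
    P Q : ℚ
    P = fromℕ p
    Q = fromℕ q

    norm-re : ∀ P Q a b c d → a * a + P * (b * - b) + Q * (c * c) + P * Q * (d * - d)
      ≡ a * a - P * (b * b) + Q * (c * c) - P * Q * (d * d)
    norm-re = solve-∀ ℚ-ring

    norm-√p : ∀ Q a b c d → a * - b + b * a + Q * (c * - d + d * c) ≡ 0ℚ
    norm-√p = solve-∀ ℚ-ring

    norm-√q : ∀ P a b c d → a * c + c * a + P * (b * - d + d * - b)
      ≡ a * c + c * a - P * (b * d + d * b)
    norm-√q = solve-∀ ℚ-ring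

    norm-√pq : ∀ a b c d → a * - d + d * a + (b * c + c * - b) ≡ 0ℚ
    norm-√pq = solve-∀ ℚ-ring

    √p*-re : ∀ P Q a b c d → 0ℚ * a + P * (1ℚ * b) + Q * (0ℚ * c) + P * Q * (0ℚ * d) ≡ P * b
    √p*-re = solve-∀ ℚ-ring

    √p*-√q : ∀ P a b c d → 0ℚ * c + 0ℚ * a + P * (1ℚ * d + 0ℚ * b) ≡ P * d
    √p*-√q = solve-∀ ℚ-ring

    E²-identity : ∀ P Q a b c d → (a + a + (a + a)) * (a + a + (a + a)) + Q * ((c + c + (c + c)) * (c + c + (c + c)))
      - P * ((b + b + (b + b)) * (b + b + (b + b))) - P * Q * ((d + d + (d + d)) * (d + d + (d + d)))
      ≡ fromℤ (+ 8) * (a * a - P * (b * b) + Q * (c * c) - P * Q * (d * d)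
                        + (a * a - P * (b * b) + Q * (c * c) - P * Q * (d * d)))
    E²-identity = solve-∀ ℚ-ring

    EF-identity : ∀ P a b c d → (a + a + (a + a)) * (c + c + (c + c)) - P * (b + b + (b + b)) * (d + d + (d + d))
      ≡ fromℤ (+ 4) * (a * c + c * a - P * (b * d + d * b) + (a * c + c * a - P * (b * d + d * b)))
    EF-identity = solve-∀ ℚ-ring

    norm-identity : ∀ P Q a b c d →
      (a + a + (a + a)) * (a + a + (a + a)) + Q * ((c + c + (c + c)) * (c + c + (c + c)))
        - fromℤ (+ 8) * (a * a - P * (b * b) + Q * (c * c) - P * Q * (d * d)
                          + (a * a - P * (b * b) + Q * (c * c) - P * Q * (d * d)))
      ≡ P * ((b + b + (b + b)) * (b + b + (b + b))) + P * Q * ((d + d + (d + d)) * (d + d + (d + d)))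
    norm-identity = solve-∀ ℚ-ring

    Pef-identity : ∀ P a b c d → (a + a + (a + a)) * (c + c + (c + c))
      - fromℤ (+ 4) * (a * c + c * a - P * (b * d + d * b) + (a * c + c * a - P * (b * d + d * b)))
      ≡ P * (b + b + (b + b)) * (d + d + (d + d))
    Pef-identity = solve-∀ ℚ-ring

    fourfold : ∀ P b → P * b + P * b + (P * b + P * b) ≡ P * (b + b + (b + b))
    fourfold = solve-∀ ℚ-ring

  trace-almostIntegral : ∀ {a b c d} → AlmostIntegral ⟨ a , b , c , d ⟩ → AlmostIntegral ⟨ a + a , 0ℚ , c + c , 0ℚ ⟩
  trace-almostIntegral {a} {b} {c} {d} ai = subst AlmostIntegral
    (K-≡ refl (+-inverseʳ b) refl (+-inverseʳ d)) (+-almostIntegral {x} {σ x} ai (σ-almostIntegral {x} ai))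
    where x = ⟨ a , b , c , d ⟩

  norm-almostIntegral : ∀ {a b c d} → AlmostIntegral ⟨ a , b , c , d ⟩ →
    AlmostIntegral ⟨ a * a - P * (b * b) + Q * (c * c) - P * Q * (d * d) , 0ℚ , a * c + c * a - P * (b * d + d * b) , 0ℚ ⟩
  norm-almostIntegral {a} {b} {c} {d} ai = subst AlmostIntegral
    (K-≡ (norm-re P Q a b c d) (norm-√p Q a b c d) (norm-√q P a b c d) (norm-√pq a b c d))
    (*-almostIntegral {x} {σ x} ai (σ-almostIntegral {x} ai))
    where x = ⟨ a , b , c , d ⟩

  √p*-almostIntegral : ∀ {a b c d} → AlmostIntegral ⟨ a , b , c , d ⟩ →
    AlmostIntegral (⟨ 0ℚ , 1ℚ , 0ℚ , 0ℚ ⟩ *ᴷ ⟨ a , b , c , d ⟩)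
  √p*-almostIntegral {a} {b} {c} {d} = *-almostIntegral {⟨ 0ℚ , 1ℚ , 0ℚ , 0ℚ ⟩} {⟨ a , b , c , d ⟩}
    (L⇒almostIntegral (fromℤ-isInteger (+ 0) , fromℤ-isInteger (+ 1) , fromℤ-isInteger (+ 0) , fromℤ-isInteger (+ 0)))

  -- Multiplication by √p moves the coordinates of √p and √p√q to 1 and √q, where the relative trace
  -- can see them.
  √p-trace-almostIntegral : ∀ {a b c d} → AlmostIntegral ⟨ a , b , c , d ⟩ →
    AlmostIntegral ⟨ P * b + P * b , 0ℚ , P * d + P * d , 0ℚ ⟩
  √p-trace-almostIntegral {a} {b} {c} {d} ai = subst AlmostIntegral
    (K-≡ (cong (λ z → z + z) (√p*-re P Q a b c d)) refl (cong (λ z → z + z) (√p*-√q P a b c d)) refl)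
    (trace-almostIntegral (√p*-almostIntegral {a} {b} {c} {d} ai))

  -- From p e ∈ ℤ, p f ∈ ℤ, p e f ∈ ℤ and p e² + p q f² ∈ ℤ one gets p (p e²)² ∈ ℤ.
  module _ {e f : ℚ} (p-sf : SquareFree p)
    (Pe : IsInteger (P * e)) (Pf : IsInteger (P * f)) (Pef : IsInteger (P * e * f))
    (norm : IsInteger (P * (e * e) + P * Q * (f * f))) where

    private
      p²e³ : ∀ P Q e f → P * e * (P * (e * e) + P * Q * (f * f)) + - (Q * (P * f * (P * e * f))) ≡ P * P * (e * (e * e))
      p²e³ = solve-∀ ℚ-ring

      p³e⁴ : ∀ P e → P * e * (P * P * (e * (e * e))) ≡ P * (P * (e * e) * (P * (e * e)))
      p³e⁴ = solve-∀ ℚ-ring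

      cancel : ∀ x y → x + y + - x ≡ y
      cancel = solve-∀ ℚ-ring

    e-isInteger : IsInteger e
    e-isInteger = squareFree-isInteger p-sf {e} (squareFree-isInteger p-sf {P * (e * e)}
      (subst IsInteger (p³e⁴ P e) (*-isInteger Pe (subst IsInteger (p²e³ P Q e f)
        (+-isInteger (*-isInteger Pe norm) (neg-isInteger (*-isInteger (fromℤ-isInteger (+ q)) (*-isInteger Pf Pef))))))))

    PQf²-isInteger : IsInteger (P * Q * (f * f))
    PQf²-isInteger = subst IsInteger (cancel (P * (e * e)) (P * Q * (f * f)))
      (+-isInteger norm (neg-isInteger (*-isInteger (fromℤ-isInteger (+ p)) (*-isInteger e-isInteger e-isInteger))))

  -- Bézout's identity exhibits y as an integer combination of my and ny. Over ℕ it comes with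
  -- either sign, hence the symmetric `combine`.
  coprime-factor-isInteger : ∀ {m n y} → Coprime m n → IsInteger (fromℕ m * y) → IsInteger (fromℕ n * y) → IsInteger y
  coprime-factor-isInteger {m} {n} {y} m⊥n my ny = helper (coprime-Bézout m⊥n)
    where
    combine : ∀ {i j k l} → 1 ℕ.+ i ℕ.* j ≡ k ℕ.* l → IsInteger (fromℕ l * y) → IsInteger (fromℕ j * y) → IsInteger y
    combine {i} {j} {k} {l} e ly jy = subst IsInteger eq
      (+-isInteger (*-isInteger (fromℤ-isInteger (+ k)) ly) (neg-isInteger (*-isInteger (fromℤ-isInteger (+ i)) jy)))
      where
      rearrange : ∀ i j k l y → k * (l * y) + - (i * (j * y)) ≡ (k * l - i * j) * y
      rearrange = solve-∀ ℚ-ring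
      cancel : ∀ x → 1ℚ + x - x ≡ 1ℚ
      cancel = solve-∀ ℚ-ring
      homo : ∀ a b → fromℕ (a ℕ.* b) ≡ fromℕ a * fromℕ b
      homo a b = trans (cong fromℤ (ℤ.pos-* a b)) (fromℤ-* (+ a) (+ b))
      kl : fromℕ k * fromℕ l ≡ 1ℚ + fromℕ i * fromℕ j
      kl = trans (sym (homo k l)) (trans (cong fromℕ (sym e))
        (trans (fromℤ-+ (+ 1) (+ (i ℕ.* j))) (cong (λ z → 1ℚ + z) (homo i j))))
      eq : fromℕ k * (fromℕ l * y) + - (fromℕ i * (fromℕ j * y)) ≡ y
      eq = trans (rearrange (fromℕ i) (fromℕ j) (fromℕ k) (fromℕ l) y)
        (trans (cong (λ z → (z - fromℕ i * fromℕ j) * y) kl)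
          (trans (cong (_* y) (cancel (fromℕ i * fromℕ j))) (*-identityˡ y)))
    helper : Bézout.Identity 1 m n → IsInteger y
    helper (Bézout.+- x z e) = combine {z} {n} {x} {m} e my ny
    helper (Bézout.-+ x z e) = combine {x} {m} {z} {n} e ny my

  -- Since √p√q = g√r, the coefficient of √r in 2x is 2g times the last coordinate. So 2x = A + B√p
  -- + C√q + D√r.
  record Coordinates (g : ℕ) (x : K) : Set where
    field
      A B C D : ℤ
      2re↝A   : re x + re x ↝ A
      2√p↝B   : √p-part x + √p-part x ↝ B
      2√q↝C   : √q-part x + √q-part x ↝ C
      2g√pq↝D : fromℕ g * (√pq-part x + √pq-part x) ↝ D
      A≡C     : Congruent₂ A C

  module _ {g p′ q′ r : ℕ} (p-sf : SquareFree p) (q-sf : SquareFree q)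
    (p≡gp′ : p ≡ g ℕ.* p′) (q≡gq′ : q ≡ g ℕ.* q′) (r≡p′q′ : r ≡ p′ ℕ.* q′) (p′⊥q′ : Coprime p′ q′)
    where

    open import Data.Nat.Divisibility using (_∣_; ∣n⇒∣m*n)
    private
      p′-sf : SquareFree p′
      p′-sf d d²∣p′ = p-sf d (subst (d ℕ.* d ∣_) (sym p≡gp′) (∣n⇒∣m*n g d²∣p′))

      homo : ∀ a b → fromℕ (a ℕ.* b) ≡ fromℕ a * fromℕ b
      homo a b = trans (cong fromℤ (ℤ.pos-* a b)) (fromℤ-* (+ a) (+ b))

      P≡ : P ≡ fromℕ g * fromℕ p′
      P≡ = trans (cong fromℕ p≡gp′) (homo g p′)

      Q≡ : Q ≡ fromℕ g * fromℕ q′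
      Q≡ = trans (cong fromℕ q≡gq′) (homo g q′)

      R≡ : fromℕ r ≡ fromℕ p′ * fromℕ q′
      R≡ = trans (cong fromℕ r≡p′q′) (homo p′ q′)

    module _ {q₁ : ℤ} (q≡1 : + q ≡ 1ℤ ℤ.+ + 4 ℤ.* q₁)
      (descend : Descent (+ p) (+ q) (+ r) (+ p′))
      where

      -- Three integers of ℚ(√q) feed the descent: the relative trace of x gives A′ ≡ C′, the
      -- relative norm gives `F₁`, `F₂` and h ≡ k, and the relative trace of √p x gives pe ≡ p′f.
      coordinates : ∀ {x} → x ∈𝒪 → Coordinates g x
      coordinates {⟨ a , b , c , d ⟩} x∈𝒪 = from-quadratics
        (quadratic-integer {q₁} q-sf q≡1 (trace-almostIntegral {a} {b} {c} {d} ai))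
        (quadratic-integer {q₁} q-sf q≡1 (norm-almostIntegral {a} {b} {c} {d} ai))
        (quadratic-integer {q₁} q-sf q≡1 (√p-trace-almostIntegral {a} {b} {c} {d} ai))
        where
        ai = ∈𝒪⇒almostIntegral x∈𝒪
        n₁ = a * a - P * (b * b) + Q * (c * c) - P * Q * (d * d)
        n₂ = a * c + c * a - P * (b * d + d * b)
        e₁ = b + b + (b + b)
        f₁ = d + d + (d + d)
        from-quadratics :
          (∃[ h ] ∃[ k ] a + a + (a + a) ↝ h × c + c + (c + c) ↝ k × Congruent₂ h k) →
          (∃[ h ] ∃[ k ] n₁ + n₁ ↝ h × n₂ + n₂ ↝ k × Congruent₂ h k) →
          (∃[ h ] ∃[ k ] P * b + P * b + (P * b + P * b) ↝ h × P * d + P * d + (P * d + P * d) ↝ k × Congruent₂ h k) →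
          Coordinates g ⟨ a , b , c , d ⟩
        from-quadratics (A′ , C′ , A′↝ , C′↝ , A′≡C′) (h , k , h↝ , k↝ , h≡k) (u , v , u↝ , v↝ , u≡v) =
          finish (descend F₁ F₂ h≡k A′≡C′ pe≡p′f)
          where
          Pe↝u : P * e₁ ↝ u
          Pe↝u = ↝-resp (fourfold P b) u↝
          Pf↝v : P * f₁ ↝ v
          Pf↝v = ↝-resp (fourfold P d) v↝
          Pef-integer : IsInteger (P * e₁ * f₁)
          Pef-integer = ↝⇒isInteger (↝-resp (Pef-identity P a b c d) (A′↝ ⟨*⟩ C′↝ ⟨-⟩ ⟦ + 4 ⟧ ⟨*⟩ k↝))
          norm-integer : IsInteger (P * (e₁ * e₁) + P * Q * (f₁ * f₁))
          norm-integer = ↝⇒isInteger (↝-resp (norm-identity P Q a b c d)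
            (A′↝ ⟨*⟩ A′↝ ⟨+⟩ ⟦ + q ⟧ ⟨*⟩ (C′↝ ⟨*⟩ C′↝) ⟨-⟩ ⟦ + 8 ⟧ ⟨*⟩ h↝))
          Pe-integer = ↝⇒isInteger Pe↝u
          Pf-integer = ↝⇒isInteger Pf↝v
          e-integer : IsInteger e₁
          e-integer = e-isInteger {e₁} {f₁} p-sf Pe-integer Pf-integer Pef-integer norm-integer
          -- With y = p′(gf)², the numbers p′y = (pf)² and q′y = pqf² are integers. Coprimality
          -- makes y an integer, and p′ is square-free.
          gf-integer : IsInteger (fromℕ g * f₁)
          gf-integer = squareFree-isInteger p′-sf {fromℕ g * f₁} (coprime-factor-isInteger {p′} {q′} p′⊥q′
            (subst IsInteger (trans (cong (λ P → P * f₁ * (P * f₁)) P≡) (square (fromℕ g) (fromℕ p′) f₁))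
              (*-isInteger Pf-integer Pf-integer))
            (subst IsInteger (trans (cong₂ (λ P Q → P * Q * (f₁ * f₁)) P≡ Q≡) (product (fromℕ g) (fromℕ p′) (fromℕ q′) f₁))
              (PQf²-isInteger {e₁} {f₁} p-sf Pe-integer Pf-integer Pef-integer norm-integer)))
            where
            square : ∀ g p′ f → g * p′ * f * (g * p′ * f) ≡ p′ * (p′ * (g * f * (g * f)))
            square = solve-∀ ℚ-ring
            product : ∀ g p′ q′ f → g * p′ * (g * q′) * (f * f) ≡ q′ * (p′ * (g * f * (g * f)))
            product = solve-∀ ℚ-ring
          e = proj₁ e-integer
          f = proj₁ gf-integer
          e↝ = isInteger⇒↝ e-integer
          f↝ = isInteger⇒↝ gf-integer
          PQf²≡R[gf]² : P * Q * (f₁ * f₁) ≡ fromℕ r * (fromℕ g * f₁ * (fromℕ g * f₁))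
          PQf²≡R[gf]² = trans (cong₂ (λ P Q → P * Q * (f₁ * f₁)) P≡ Q≡) (trans (lemma (fromℕ g) (fromℕ p′) (fromℕ q′) f₁)
            (cong (_* (fromℕ g * f₁ * (fromℕ g * f₁))) (sym R≡)))
            where
            lemma : ∀ g p′ q′ f → g * p′ * (g * q′) * (f * f) ≡ p′ * q′ * (g * f * (g * f))
            lemma = solve-∀ ℚ-ring
          F₁ : A′ ℤ.* A′ ℤ.+ + q ℤ.* (C′ ℤ.* C′) ℤ.- + p ℤ.* (e ℤ.* e) ℤ.- + r ℤ.* (f ℤ.* f) ≡ + 8 ℤ.* h
          F₁ = ↝-injective
            (A′↝ ⟨*⟩ A′↝ ⟨+⟩ ⟦ + q ⟧ ⟨*⟩ (C′↝ ⟨*⟩ C′↝) ⟨-⟩ ⟦ + p ⟧ ⟨*⟩ (e↝ ⟨*⟩ e↝) ⟨-⟩ ⟦ + r ⟧ ⟨*⟩ (f↝ ⟨*⟩ f↝))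
            (⟦ + 8 ⟧ ⟨*⟩ h↝)
            (trans (cong (λ z → a₁ * a₁ + Q * (c₁ * c₁) - P * (e₁ * e₁) - z) (sym PQf²≡R[gf]²)) (E²-identity P Q a b c d))
            where
            a₁ = a + a + (a + a)
            c₁ = c + c + (c + c)
          p′gf≡Pf : ∀ x → fromℕ p′ * x * (fromℕ g * f₁) ≡ P * x * f₁
          p′gf≡Pf x = trans (lemma (fromℕ g) (fromℕ p′) x f₁) (cong (λ P → P * x * f₁) (sym P≡))
            where
            lemma : ∀ g p′ e f → p′ * e * (g * f) ≡ g * p′ * e * f
            lemma = solve-∀ ℚ-ring
          F₂ : A′ ℤ.* C′ ℤ.- + p′ ℤ.* e ℤ.* f ≡ + 4 ℤ.* k
          F₂ = ↝-injective (A′↝ ⟨*⟩ C′↝ ⟨-⟩ ⟦ + p′ ⟧ ⟨*⟩ e↝ ⟨*⟩ f↝) (⟦ + 4 ⟧ ⟨*⟩ k↝)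
            (trans (cong (λ z → (a + a + (a + a)) * (c + c + (c + c)) - z) (p′gf≡Pf e₁)) (EF-identity P a b c d))
          pe≡p′f : Congruent₂ (+ p ℤ.* e) (+ p′ ℤ.* f)
          pe≡p′f = subst₂ Congruent₂ (↝-injective Pe↝u (⟦ + p ⟧ ⟨*⟩ e↝) refl)
            (↝-injective Pf↝v (⟦ + p′ ⟧ ⟨*⟩ f↝) (trans (cong (_* f₁) P≡) (lemma (fromℕ g) (fromℕ p′) f₁))) u≡v
            where
            lemma : ∀ g p′ f → g * p′ * f ≡ p′ * (g * f)
            lemma = solve-∀ ℚ-ring
          finish : Conclusion A′ C′ e f → Coordinates g ⟨ a , b , c , d ⟩
          finish (A , B , C , D , A′≡2A , e≡2B , C′≡2C , f≡2D , A≡C) = record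
            { 2re↝A   = halve A′↝ A′≡2A
            ; 2√p↝B   = halve e↝ e≡2B
            ; 2√q↝C   = halve C′↝ C′≡2C
            ; 2g√pq↝D = halve (↝-resp (*-distribˡ-+ (fromℕ g) (d + d) (d + d)) f↝) f≡2D
            ; A≡C     = A≡C
            }

-- Gram matrices of pairs of integer vectors

module GramEntries where
  open IntegerOrder
  open import Data.Integer
  open import Data.Integer.Properties
  open import Data.Integer.Tactic.RingSolver using (solve-∀)
  open import Data.Product using (_×_; _,_)
  open import Data.Sum using ([_,_]′)
  open import Function using (id)
  open import Relation.Binary.PropositionalEquality

  -- The Gram matrix entries ΣX², ΣXY, ΣY² of two integer vectors, as far as they are needed.
  record Gram (xx xy yy : ℤ) : Set where
    field
      xx≥0  : 0ℤ ≤ xx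
      yy≥0  : 0ℤ ≤ yy
      psd   : ∀ s t → 0ℤ ≤ s * s * xx + + 2 * (s * t) * xy + t * t * yy
      yy≡0⇒xy≡0 : yy ≡ 0ℤ → xy ≡ 0ℤ

  gram-zero : Gram 0ℤ 0ℤ 0ℤ
  gram-zero = record
    { xx≥0 = lit 0 ; yy≥0 = lit 0 ; yy≡0⇒xy≡0 = id
    ; psd = λ s t → ≤-reflexive (lemma s t) }
    where
    lemma : ∀ s t → 0ℤ ≡ s * s * 0ℤ + + 2 * (s * t) * 0ℤ + t * t * 0ℤ
    lemma = solve-∀

  gram-square : ∀ x y → Gram (x * x) (x * y) (y * y)
  gram-square x y = record
    { xx≥0 = sq x ; yy≥0 = sq y
    ; psd = λ s t → subst (0ℤ ≤_) (lemma s t x y) (sq (s * x + t * y))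
    ; yy≡0⇒xy≡0 = λ yy≡0 → trans (cong (λ z → x * z) ([ id , id ]′ (i*j≡0⇒i≡0∨j≡0 y yy≡0))) (*-zeroʳ x) }
    where
    lemma : ∀ s t x y → (s * x + t * y) * (s * x + t * y)
      ≡ s * s * (x * x) + + 2 * (s * t) * (x * y) + t * t * (y * y)
    lemma = solve-∀

  nonneg-summands≡0 : ∀ {x y} → 0ℤ ≤ x → 0ℤ ≤ y → x + y ≡ 0ℤ → x ≡ 0ℤ × y ≡ 0ℤ
  nonneg-summands≡0 {+ 0} {+ 0} _ _ _ = refl , refl

  gram-+ : ∀ {a b c a′ b′ c′} → Gram a b c → Gram a′ b′ c′ → Gram (a + a′) (b + b′) (c + c′)
  gram-+ {a} {b} {c} {a′} {b′} {c′} G H = record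
    { xx≥0 = G.xx≥0 ⊕ H.xx≥0 ; yy≥0 = G.yy≥0 ⊕ H.yy≥0
    ; psd = λ s t → subst (0ℤ ≤_) (lemma s t a b c a′ b′ c′) (G.psd s t ⊕ H.psd s t)
    ; yy≡0⇒xy≡0 = λ yy≡0 → let c≡0 , c′≡0 = nonneg-summands≡0 G.yy≥0 H.yy≥0 yy≡0
                            in cong₂ _+_ (G.yy≡0⇒xy≡0 c≡0) (H.yy≡0⇒xy≡0 c′≡0) }
    where
    module G = Gram G
    module H = Gram H
    lemma : ∀ s t a b c a′ b′ c′ →
      s * s * a + + 2 * (s * t) * b + t * t * c + (s * s * a′ + + 2 * (s * t) * b′ + t * t * c′)
      ≡ s * s * (a + a′) + + 2 * (s * t) * (b + b′) + t * t * (c + c′)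
    lemma = solve-∀

-- Trace and √q-coefficient of a sum of squares

module SumsOfSquares (p q g p′ q′ r : ℕ) where
  open GramEntries
  open ℚRing
  open Representation
  open ParityDescent using (Congruent₂)
  open IntegerCoordinates p q using (Coordinates)
  open Defs using (fromℕ)
  open Defs.Biquadratic p q
  open K
  open import Data.Integer as ℤ using (ℤ; +_; 0ℤ)
  import Data.Integer.Tactic.RingSolver as ℤ-Solver
  open import Data.List using (List; []; _∷_)
  open import Data.List.Relation.Unary.All using (All; []; _∷_)
  open import Data.Product using (_,_; proj₁; proj₂)
  open import Data.Rational
  open import Relation.Binary.PropositionalEquality
  open import Tactic.RingSolver using (solve-∀)

  -- For one summand, x² has rational part ¼(A² + pB² + qC² + rD²) and √q-part ½(AC + p′BD), because
  -- √p√r = p′√q; this explains the factors 4 and 2. All fields are additive, so the individual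
  -- summands can be forgotten.
  record Summary (x : K) : Set where
    field
      {SA SAC SC SB SBD SD} : ℤ
      gram-AC : Gram SA SAC SC
      gram-BD : Gram SB SBD SD
      SAC≡SC  : Congruent₂ SAC SC
      trace   : re x + re x + (re x + re x) ↝ SA ℤ.+ + p ℤ.* SB ℤ.+ + q ℤ.* SC ℤ.+ + r ℤ.* SD
      √q-sum  : √q-part x + √q-part x ↝ SAC ℤ.+ + p′ ℤ.* SBD

  summary-zero : Summary (fromRational 0ℚ)
  summary-zero = record
    { gram-AC = gram-zero ; gram-BD = gram-zero ; SAC≡SC = 0ℤ , refl
    ; trace  = subst (0ℚ ↝_) (lemma (+ p) (+ q) (+ r)) ⟦ 0ℤ ⟧
    ; √q-sum = subst (0ℚ ↝_) (lemma′ (+ p′)) ⟦ 0ℤ ⟧ }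
    where
    lemma : ∀ p q r → 0ℤ ≡ 0ℤ ℤ.+ p ℤ.* 0ℤ ℤ.+ q ℤ.* 0ℤ ℤ.+ r ℤ.* 0ℤ
    lemma = ℤ-Solver.solve-∀
    lemma′ : ∀ p′ → 0ℤ ≡ 0ℤ ℤ.+ p′ ℤ.* 0ℤ
    lemma′ = ℤ-Solver.solve-∀

  summary-+ : ∀ {x y} → Summary x → Summary y → Summary (x +ᴷ y)
  summary-+ {x} {y} S T = record
    { gram-AC = gram-+ S.gram-AC T.gram-AC
    ; gram-BD = gram-+ S.gram-BD T.gram-BD
    ; SAC≡SC  = proj₁ S.SAC≡SC ℤ.+ proj₁ T.SAC≡SC ,
        trans (cong₂ ℤ._+_ (proj₂ S.SAC≡SC) (proj₂ T.SAC≡SC)) (congruent S.SC T.SC (proj₁ S.SAC≡SC) (proj₁ T.SAC≡SC))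
    ; trace   = subst₂ _↝_ (quadruple (re x) (re y)) (traces (+ p) (+ q) (+ r) S.SA S.SB S.SC S.SD T.SA T.SB T.SC T.SD)
        (S.trace ⟨+⟩ T.trace)
    ; √q-sum  = subst₂ _↝_ (double (√q-part x) (√q-part y)) (sums (+ p′) S.SAC S.SBD T.SAC T.SBD) (S.√q-sum ⟨+⟩ T.√q-sum)
    }
    where
    module S = Summary S
    module T = Summary T
    congruent : ∀ a b v w → a ℤ.+ + 2 ℤ.* v ℤ.+ (b ℤ.+ + 2 ℤ.* w) ≡ a ℤ.+ b ℤ.+ + 2 ℤ.* (v ℤ.+ w)
    congruent = ℤ-Solver.solve-∀
    quadruple : ∀ a b → a + a + (a + a) + (b + b + (b + b)) ≡ a + b + (a + b) + (a + b + (a + b))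
    quadruple = solve-∀ ℚ-ring
    double : ∀ a b → a + a + (b + b) ≡ a + b + (a + b)
    double = solve-∀ ℚ-ring
    traces : ∀ p q r a b c d a′ b′ c′ d′ →
      a ℤ.+ p ℤ.* b ℤ.+ q ℤ.* c ℤ.+ r ℤ.* d ℤ.+ (a′ ℤ.+ p ℤ.* b′ ℤ.+ q ℤ.* c′ ℤ.+ r ℤ.* d′)
      ≡ a ℤ.+ a′ ℤ.+ p ℤ.* (b ℤ.+ b′) ℤ.+ q ℤ.* (c ℤ.+ c′) ℤ.+ r ℤ.* (d ℤ.+ d′)
    traces = ℤ-Solver.solve-∀
    sums : ∀ p′ a b a′ b′ → a ℤ.+ p′ ℤ.* b ℤ.+ (a′ ℤ.+ p′ ℤ.* b′) ≡ a ℤ.+ a′ ℤ.+ p′ ℤ.* (b ℤ.+ b′)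
    sums = ℤ-Solver.solve-∀

  module _ (P≡ : fromℕ p ≡ fromℕ g * fromℕ p′) (Q≡ : fromℕ q ≡ fromℕ g * fromℕ q′) (R≡ : fromℕ r ≡ fromℕ p′ * fromℕ q′) where

    summary-square : ∀ {x} → Coordinates g x → Summary (x *ᴷ x)
    summary-square {x@(⟨ a , b , c , d ⟩)} coords = record
      { gram-AC = gram-square A C
      ; gram-BD = gram-square B D
      ; SAC≡SC  = proj₁ A≡C ℤ.* C , trans (cong (ℤ._* C) (proj₂ A≡C)) (congruent C (proj₁ A≡C))
      ; trace   = ↝-resp (trans (cong (λ z → (a + a) * (a + a) + P * ((b + b) * (b + b)) + Q * ((c + c) * (c + c)) + z) R[2gd]²≡)
                    (traces P Q a b c d))
          (2re↝A ⟨*⟩ 2re↝A ⟨+⟩ ⟦ + p ⟧ ⟨*⟩ (2√p↝B ⟨*⟩ 2√p↝B) ⟨+⟩ ⟦ + q ⟧ ⟨*⟩ (2√q↝C ⟨*⟩ 2√q↝C) ⟨+⟩ ⟦ + r ⟧ ⟨*⟩ (2g√pq↝D ⟨*⟩ 2g√pq↝D))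
      ; √q-sum  = ↝-resp (trans (cong (λ z → (a + a) * (c + c) + z) p′[2b][2gd]≡) (sums P a b c d))
          (2re↝A ⟨*⟩ 2√q↝C ⟨+⟩ ⟦ + p′ ⟧ ⟨*⟩ (2√p↝B ⟨*⟩ 2g√pq↝D))
      }
      where
      open Coordinates coords
      P = fromℕ p
      Q = fromℕ q
      congruent : ∀ c w → (c ℤ.+ + 2 ℤ.* w) ℤ.* c ≡ c ℤ.* c ℤ.+ + 2 ℤ.* (w ℤ.* c)
      congruent = ℤ-Solver.solve-∀
      R[2gd]²≡ : fromℕ r * (fromℕ g * (d + d) * (fromℕ g * (d + d))) ≡ P * Q * ((d + d) * (d + d))
      R[2gd]²≡ = trans (cong (_* (fromℕ g * (d + d) * (fromℕ g * (d + d)))) R≡)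
        (trans (lemma (fromℕ g) (fromℕ p′) (fromℕ q′) d) (cong₂ (λ P Q → P * Q * ((d + d) * (d + d))) (sym P≡) (sym Q≡)))
        where
        lemma : ∀ g p′ q′ d → p′ * q′ * (g * (d + d) * (g * (d + d))) ≡ g * p′ * (g * q′) * ((d + d) * (d + d))
        lemma = solve-∀ ℚ-ring
      p′[2b][2gd]≡ : fromℕ p′ * ((b + b) * (fromℕ g * (d + d))) ≡ P * ((b + b) * (d + d))
      p′[2b][2gd]≡ = trans (lemma (fromℕ g) (fromℕ p′) b d) (cong (_* ((b + b) * (d + d))) (sym P≡))
        where
        lemma : ∀ g p′ b d → p′ * ((b + b) * (g * (d + d))) ≡ g * p′ * ((b + b) * (d + d))
        lemma = solve-∀ ℚ-ring
      traces : ∀ P Q a b c d →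
        (a + a) * (a + a) + P * ((b + b) * (b + b)) + Q * ((c + c) * (c + c)) + P * Q * ((d + d) * (d + d))
        ≡ a * a + P * (b * b) + Q * (c * c) + P * Q * (d * d) + (a * a + P * (b * b) + Q * (c * c) + P * Q * (d * d))
          + (a * a + P * (b * b) + Q * (c * c) + P * Q * (d * d) + (a * a + P * (b * b) + Q * (c * c) + P * Q * (d * d)))
      traces = solve-∀ ℚ-ring
      sums : ∀ P a b c d → (a + a) * (c + c) + P * ((b + b) * (d + d))
        ≡ a * c + c * a + P * (b * d + d * b) + (a * c + c * a + P * (b * d + d * b))
      sums = solve-∀ ℚ-ring

    summary : (∀ {x} → x ∈𝒪 → Coordinates g x) → ∀ {xs} → All _∈𝒪 xs → Summary (sumOfSquares xs)
    summary coordinates []              = summary-zero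
    summary coordinates (_∷_ {x} x∈ xs∈) = summary-+ {x *ᴷ x} (summary-square (coordinates x∈)) (summary coordinates xs∈)

-- The totally positive integer α

module Witness (p q a′ κ : ℕ) where
  open ℚRing
  open RationalIntegers
  open Representation
  open Fractions
  open Reals
  open ParityDescent using (Congruent₂; eq0; ≡-by; _⊞_)
  open BiquadraticRing p q
  open IntegralElements p q using (module K-ring)
  open Defs using (fromℤ; fromℕ; seq; √_)
  open Defs.Biquadratic p q
  open import Data.Integer as ℤ using (ℤ; +_; 1ℤ)
  import Data.Integer.Tactic.RingSolver as ℤ-Solver
  open import Data.List using ([]; _∷_)
  open import Data.Nat as ℕ using (suc)
  import Data.Nat.Properties as ℕ
  import Data.Nat.Tactic.RingSolver as ℕ-Solver
  open import Data.Product using (_,_)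
  open import Data.Rational
  open import Data.Rational.Properties
  open import Data.Sign as Sign using (Sign)
  open import Relation.Binary.PropositionalEquality
  open import Tactic.RingSolver using (solve-∀)

  a : ℕ
  a = suc a′

  α : K
  α = ⟨ ½ * fromℕ a , 0ℚ , ½ * fromℕ κ , 0ℚ ⟩

  -- α is a root of x² - ax + (a² - qκ²)/4. With a = κ + 2z and q = 1 + 4q₁ the constant term is the
  -- integer `n₀`.
  α∈𝒪 : ∀ {q₁} → + q ≡ 1ℤ ℤ.+ + 4 ℤ.* q₁ → Congruent₂ (+ a) (+ κ) → α ∈𝒪
  α∈𝒪 {q₁} q≡1 (z , a≡κ+2z) = n₀ ∷ ℤ.- (+ a) ∷ [] ,
    trans (cong (λ x → fromRational N +ᴷ α *ᴷ (fromRational (fromℤ (ℤ.- (+ a))) +ᴷ x)) (K-ring.*-identityʳ α))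
      (K-≡ (trans (cong (λ x → N + (½ * A * (x + ½ * A) + P * (0ℚ * 0ℚ) + Q * (½ * k * (0ℚ + ½ * k)) + P * Q * (0ℚ * 0ℚ))) (fromℤ-neg (+ a)))
             (trans (re-part P Q N A k) (trans (cong (½ * ½ *_) 4N-≡0) (*-zeroʳ (½ * ½)))))
           (√p-zero Q (fromℤ (ℤ.- (+ a))) (½ * A) (½ * k))
           (trans (cong (λ x → 0ℚ + (½ * A * (0ℚ + ½ * k) + ½ * k * (x + ½ * A) + P * (0ℚ * 0ℚ + 0ℚ * 0ℚ))) (fromℤ-neg (+ a)))
             (√q-zero P A k))
           (√pq-zero (fromℤ (ℤ.- (+ a))) (½ * A) (½ * k)))
    where
    n₀ = + κ ℤ.* z ℤ.+ z ℤ.* z ℤ.- q₁ ℤ.* (+ κ ℤ.* + κ)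
    N = fromℤ n₀
    A = fromℕ a
    k = fromℕ κ
    P = fromℕ p
    Q = fromℕ q
    4n₀≡ : + 4 ℤ.* n₀ ≡ + a ℤ.* + a ℤ.- + q ℤ.* (+ κ ℤ.* + κ)
    4n₀≡ = ≡-by (eq0 a≡κ+2z (ℤ.- (+ a ℤ.+ + κ ℤ.+ + 2 ℤ.* z)) ⊞ eq0 q≡1 (+ κ ℤ.* + κ)) (lemma (+ a) (+ κ) z (+ q) q₁)
      where
      lemma : ∀ a κ z q q₁ →
        ℤ.- (a ℤ.+ κ ℤ.+ + 2 ℤ.* z) ℤ.* (a ℤ.- (κ ℤ.+ + 2 ℤ.* z)) ℤ.+ κ ℤ.* κ ℤ.* (q ℤ.- (1ℤ ℤ.+ + 4 ℤ.* q₁))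
        ≡ + 4 ℤ.* (κ ℤ.* z ℤ.+ z ℤ.* z ℤ.- q₁ ℤ.* (κ ℤ.* κ)) ℤ.- (a ℤ.* a ℤ.- q ℤ.* (κ ℤ.* κ))
      lemma = ℤ-Solver.solve-∀
    4N≡ : fromℤ (+ 4) * N ≡ A * A - Q * (k * k)
    4N≡ = trans (unrep (⟦ + 4 ⟧ ⟨*⟩ ⟦ n₀ ⟧)) (trans (cong fromℤ 4n₀≡)
      (sym (unrep (⟦ + a ⟧ ⟨*⟩ ⟦ + a ⟧ ⟨-⟩ ⟦ + q ⟧ ⟨*⟩ (⟦ + κ ⟧ ⟨*⟩ ⟦ + κ ⟧)))))
    4N-≡0 : fromℤ (+ 4) * N - (A * A - Q * (k * k)) ≡ 0ℚ
    4N-≡0 = trans (cong (_- (A * A - Q * (k * k))) 4N≡) (+-inverseʳ (A * A - Q * (k * k)))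
    re-part : ∀ P Q N A k →
      N + (½ * A * (- A + ½ * A) + P * (0ℚ * 0ℚ) + Q * (½ * k * (0ℚ + ½ * k)) + P * Q * (0ℚ * 0ℚ))
      ≡ ½ * ½ * (fromℤ (+ 4) * N - (A * A - Q * (k * k)))
    re-part = solve-∀ ℚ-ring
    √p-zero : ∀ Q A u v → 0ℚ + (u * 0ℚ + 0ℚ * (A + u) + Q * (v * 0ℚ + 0ℚ * (0ℚ + v))) ≡ 0ℚ
    √p-zero = solve-∀ ℚ-ring
    √q-zero : ∀ P A k → 0ℚ + (½ * A * (0ℚ + ½ * k) + ½ * k * (- A + ½ * A) + P * (0ℚ * 0ℚ + 0ℚ * 0ℚ)) ≡ 0ℚ
    √q-zero = solve-∀ ℚ-ring
    √pq-zero : ∀ A u v → 0ℚ + (u * 0ℚ + 0ℚ * (A + u) + (0ℚ * (0ℚ + v) + v * 0ℚ)) ≡ 0ℚ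
    √pq-zero = solve-∀ ℚ-ring

  -- From κ²q ≤ a² - 1 follows √q ≤ (2a² - 1)/(2aκ), and ½κ times this fraction is exactly ½a -
  -- 1/(4a). This bounds the smaller conjugates of α away from 0 at every index.
  gap : .{{_ : ℕ.NonZero κ}} → κ ℕ.* κ ℕ.* q ℕ.< a ℕ.* a → ∀ n →
        ½ * fromℕ κ * seq (√ q) n + + 1 / (4 ℕ.* a) ≤ ½ * fromℕ a
  gap κ²q<a² n = let open ≤-Reasoning in begin
    ½ * fromℕ κ * seq (√ q) n + ε      ≤⟨ +-monoˡ-≤ ε (*-monoˡ-≤-nonNeg (½ * fromℕ κ) {{½κ≥0}} (seq-√≤ {S} {T} {q} {1} qT²≤S² n)) ⟩
    ½ * fromℕ κ * (+ S / T) + ε        ≡⟨ cong (λ x → x * (+ S / T) + ε) (*-/ 1 2 κ 1) ⟩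
    + (1 ℕ.* κ) / 2 * (+ S / T) + ε    ≡⟨ cong (_+ ε) (*-/ (1 ℕ.* κ) 2 S T) ⟩
    + (1 ℕ.* κ ℕ.* S) / (2 ℕ.* T) + ε  ≡⟨ +-/ (1 ℕ.* κ ℕ.* S) (2 ℕ.* T) 1 (4 ℕ.* a) ⟩
    + (1 ℕ.* κ ℕ.* S ℕ.* (4 ℕ.* a) ℕ.+ 1 ℕ.* (2 ℕ.* T)) / (2 ℕ.* T ℕ.* (4 ℕ.* a))
      ≤⟨ /-mono-≤ {1 ℕ.* κ ℕ.* S ℕ.* (4 ℕ.* a) ℕ.+ 1 ℕ.* (2 ℕ.* T)} {2 ℕ.* T ℕ.* (4 ℕ.* a)} {1 ℕ.* a} {2} (ℕ.≤-reflexive (trans (cross a κ w) (cross′ a κ))) ⟩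
    + (1 ℕ.* a) / 2                    ≡⟨ *-/ 1 2 a 1 ⟨
    ½ * fromℕ a                        ∎
    where
    w = a′ ℕ.+ a′ ℕ.* a
    S = suc (2 ℕ.* w)
    T = 2 ℕ.* a ℕ.* κ
    ε = + 1 / (4 ℕ.* a)
    ½κ≥0 : NonNegative (½ * fromℕ κ)
    ½κ≥0 = nonNeg*nonNeg⇒nonNeg ½ (fromℕ κ) {{normalize-nonNeg κ 1}}
    instance
      T≢0 : ℕ.NonZero T
      T≢0 = ℕ.m*n≢0 (2 ℕ.* a) κ
      2T≢0 : ℕ.NonZero (2 ℕ.* T)
      2T≢0 = ℕ.m*n≢0 2 T
      2T4a≢0 : ℕ.NonZero (2 ℕ.* T ℕ.* (4 ℕ.* a))
      2T4a≢0 = ℕ.m*n≢0 (2 ℕ.* T) (4 ℕ.* a)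
    qT²≤S² : q ℕ.* (T ℕ.* T) ℕ.≤ S ℕ.* S ℕ.* 1
    qT²≤S² = let open ℕ.≤-Reasoning in begin
      q ℕ.* (T ℕ.* T)                        ≡⟨ lhs q a κ ⟩
      4 ℕ.* (a ℕ.* a) ℕ.* (κ ℕ.* κ ℕ.* q)    ≤⟨ ℕ.*-monoʳ-≤ (4 ℕ.* (a ℕ.* a)) (ℕ.s≤s⁻¹ κ²q<a²) ⟩
      4 ℕ.* suc w ℕ.* w                      ≤⟨ ℕ.n≤1+n _ ⟩
      suc (4 ℕ.* suc w ℕ.* w)                ≡⟨ rhs w ⟩
      S ℕ.* S ℕ.* 1                          ∎
      where
      lhs : ∀ q a κ → q ℕ.* (2 ℕ.* a ℕ.* κ ℕ.* (2 ℕ.* a ℕ.* κ)) ≡ 4 ℕ.* (a ℕ.* a) ℕ.* (κ ℕ.* κ ℕ.* q)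
      lhs = ℕ-Solver.solve-∀
      rhs : ∀ w → suc (4 ℕ.* suc w ℕ.* w) ≡ suc (2 ℕ.* w) ℕ.* suc (2 ℕ.* w) ℕ.* 1
      rhs = ℕ-Solver.solve-∀
    cross : ∀ a κ w → (1 ℕ.* κ ℕ.* suc (2 ℕ.* w) ℕ.* (4 ℕ.* a) ℕ.+ 1 ℕ.* (2 ℕ.* (2 ℕ.* a ℕ.* κ))) ℕ.* 2 ≡
      16 ℕ.* (a ℕ.* κ) ℕ.* suc w
    cross = ℕ-Solver.solve-∀
    cross′ : ∀ a κ → 16 ℕ.* (a ℕ.* κ) ℕ.* (a ℕ.* a) ≡ 1 ℕ.* a ℕ.* (2 ℕ.* (2 ℕ.* a ℕ.* κ) ℕ.* (4 ℕ.* a))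
    cross′ = ℕ-Solver.solve-∀

  seq-√≥0 : ∀ c n → 0ℚ ≤ seq (√ c) n
  seq-√≥0 c n = nonNegative⁻¹ (seq (√ c) n)
    {{normalize-nonNeg Defs.⌊√ c ℕ.* 1 ℕ.* (suc n ℕ.* suc n) ⌋ (1 ℕ.* suc n)}}

  α-totallyPositive : .{{_ : ℕ.NonZero κ}} → κ ℕ.* κ ℕ.* q ℕ.< a ℕ.* a → TotallyPositive α
  α-totallyPositive κ²q<a² s s′ = ε , positive⁻¹ ε {{normalize-pos 1 (4 ℕ.* a)}} , 0 , λ n _ → subst₂ _≤_
    (sym (+-identityˡ ε))
    (sym (trans (cong₂ (λ x y → u + x * seq (√ p) n + signed s′ v * seq (√ q) n + y * seq (√ (p ℕ.* q)) n) (signed-0 s) (signed-0 (s Sign.* s′)))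
      (drop-zeros u (signed s′ v) (seq (√ p) n) (seq (√ q) n) (seq (√ (p ℕ.* q)) n))))
    (bound s′ n)
    where
    ε = + 1 / (4 ℕ.* a)
    u = ½ * fromℕ a
    v = ½ * fromℕ κ
    signed-0 : ∀ s → signed s 0ℚ ≡ 0ℚ
    signed-0 Sign.+ = refl
    signed-0 Sign.- = refl
    drop-zeros : ∀ u v x y z → u + 0ℚ * x + v * y + 0ℚ * z ≡ u + v * y
    drop-zeros = solve-∀ ℚ-ring
    vy≥0 : ∀ n → 0ℚ ≤ v * seq (√ q) n
    vy≥0 n = nonNegative⁻¹ (v * seq (√ q) n) {{nonNeg*nonNeg⇒nonNeg v {{nonNeg*nonNeg⇒nonNeg ½ (fromℕ κ) {{normalize-nonNeg κ 1}}}}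
      (seq (√ q) n) {{nonNegative (seq-√≥0 q n)}}}}
    bound : ∀ s′ n → ε ≤ u + signed s′ v * seq (√ q) n
    bound Sign.- n = subst₂ _≤_ (lhs (v * seq (√ q) n) ε) (rhs u v (seq (√ q) n)) (+-monoˡ-≤ (- (v * seq (√ q) n)) (gap κ²q<a² n))
      where
      lhs : ∀ x ε → x + ε + - x ≡ ε
      lhs = solve-∀ ℚ-ring
      rhs : ∀ u v y → u + - (v * y) ≡ u + - v * y
      rhs = solve-∀ ℚ-ring
    bound Sign.+ n = begin
      ε                          ≡⟨ +-identityˡ ε ⟨
      0ℚ + ε                     ≤⟨ +-monoˡ-≤ ε (vy≥0 n) ⟩
      v * seq (√ q) n + ε        ≤⟨ gap κ²q<a² n ⟩
      u                          ≡⟨ +-identityʳ u ⟨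
      u + 0ℚ                     ≤⟨ +-monoʳ-≤ u (vy≥0 n) ⟩
      u + v * seq (√ q) n        ∎
      where open ≤-Reasoning

-- The choice of b, and residues as congruences

module Choices where
  open import Defs
  open Fractions
  open RationalIntegers
  open ParityDescent
  open import Data.Integer as ℤ using (ℤ; +_; ∣_∣)
  import Data.Integer.Properties as ℤ
  import Data.Integer.Tactic.RingSolver as ℤ-Solver
  open import Data.Nat as ℕ hiding (_/_; parity; ∣_-_∣)
  open import Data.Nat.Divisibility using (divides; ∣⇒≤)
  open import Data.Nat.DivMod using (_%_; m≡m%n+[m/n]*n)
  open import Data.Nat.Properties
  open import Data.Nat.Tactic.RingSolver using (solve-∀)
  open import Data.Empty using (⊥; ⊥-elim)
  open import Data.Product using (∃-syntax; _×_; _,_; proj₁; proj₂)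
  open import Data.Rational as ℚ using (ℚ; _/_)
  open import Data.Sum using (_⊎_; inj₁; inj₂)
  open import Relation.Binary.PropositionalEquality

  -- From s² = κ²q with s > 0 one gets q(κ/s)² = 1, so κ/s is an integer by square-freeness. Then s
  -- ≤ κ, against κ² < κ²q.
  κ²q-nonsquare : ∀ {q κ s} .{{_ : NonZero κ}} → SquareFree q → 2 ≤ q → s * s ≢ κ * κ * q
  κ²q-nonsquare {q} {κ} {zero} _ 2≤q e = <⇒≢ (<-≤-trans (s≤s z≤n) (≤-trans 2≤q (m≤n*m q (κ * κ) {{m*n≢0 κ κ}}))) e
  κ²q-nonsquare {q} {κ} {s@(suc _)} q-sf 2≤q e = <⇒≱ κ²<κ²q (≤-trans (≤-reflexive (sym e)) (*-mono-≤ s≤κ s≤κ))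
    where
    y : ℚ
    y = + κ / s
    instance
      1s²≢0 : NonZero (1 * (s * s))
      1s²≢0 = m*n≢0 1 (s * s)
      1s≢0 : NonZero (1 * s)
      1s≢0 = m*n≢0 1 s
    qy²≡1 : fromℕ q ℚ.* (y ℚ.* y) ≡ fromℕ 1
    qy²≡1 = trans (cong (fromℕ q ℚ.*_) (*-/ κ s κ s)) (trans (*-/ q 1 (κ * κ) (s * s))
      (/-cross {q * (κ * κ)} {1 * (s * s)} {1} {1} (trans (lemma q κ) (trans (sym e) (lemma′ (s * s))))))
      where
      lemma : ∀ q κ → q * (κ * κ) * 1 ≡ κ * κ * q
      lemma = solve-∀
      lemma′ : ∀ u → u ≡ 1 * (1 * u)
      lemma′ = solve-∀
    y-integer : IsInteger y
    y-integer = squareFree-isInteger q-sf {y} (+ 1 , qy²≡1)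
    sy≡κ : fromℕ s ℚ.* y ≡ fromℕ κ
    sy≡κ = trans (*-/ s 1 κ s) (/-cross {s * κ} {1 * s} {κ} {1} (lemma s κ))
      where
      lemma : ∀ s κ → s * κ * 1 ≡ κ * (1 * s)
      lemma = solve-∀
    z = proj₁ y-integer
    sz≡κ : + s ℤ.* z ≡ + κ
    sz≡κ = fromℤ-injective {+ s ℤ.* z} {+ κ} (trans (fromℤ-* (+ s) z) (trans (cong (fromℕ s ℚ.*_) (sym (proj₂ y-integer))) sy≡κ))
    s≤κ : s ≤ κ
    s≤κ = ∣⇒≤ (divides ∣ z ∣ (trans (sym (cong ∣_∣ sz≡κ)) (trans (ℤ.abs-* (+ s) z) (*-comm s ∣ z ∣))))
    κ²<κ²q : κ * κ < κ * κ * q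
    κ²<κ²q = m<m*n (κ * κ) q {{m*n≢0 κ κ}} 2≤q

  -- b + 2 is the least integer above κ√q with the parity of κ.
  parity-floor : ∀ {q κ} .{{_ : NonZero κ}} → SquareFree q → 2 ≤ q →
    ∃[ b ] b * b < κ * κ * q × κ * κ * q < (2 + b) * (2 + b) × Congruent₂ (+ (2 + b)) (+ κ)
  parity-floor {q} {κ} q-sf 2≤q = choose ⌊√ n ⌋ (proj₁ (⌊√⌋-spec n)) (proj₂ (⌊√⌋-spec n)) (parity (+ ⌊√ n ⌋ ℤ.- + κ))
    where
    n = κ * κ * q
    choose : ∀ s → s * s ≤ n → n < suc s * suc s → Even (+ s ℤ.- + κ) ⊎ Odd (+ s ℤ.- + κ) →
      ∃[ b ] b * b < n × n < (2 + b) * (2 + b) × Congruent₂ (+ (2 + b)) (+ κ)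
    choose s s²≤n n<[1+s]² (inj₁ (w , e)) = s ,
      -- When b is the floor itself, the strict inequality b < κ√q rests on κ²q not being a square.
      ≤∧≢⇒< s²≤n (κ²q-nonsquare {q} {κ} {s} q-sf 2≤q) ,
      <-trans n<[1+s]² (*-mono-< (n<1+n (suc s)) (n<1+n (suc s))) ,
      (ℤ.1ℤ ℤ.+ w , ≡-by (eq0 e ℤ.1ℤ) (identity (+ s) (+ κ) w))
      where
      identity : ∀ s κ w → ℤ.1ℤ ℤ.* (s ℤ.- κ ℤ.- + 2 ℤ.* w) ≡ + 2 ℤ.+ s ℤ.- (κ ℤ.+ + 2 ℤ.* (ℤ.1ℤ ℤ.+ w))
      identity = ℤ-Solver.solve-∀
    choose zero _ n<1 (inj₂ _) = ⊥-elim (<⇒≱ n<1 (≤-trans (≤-trans (s≤s z≤n) 2≤q) (m≤n*m q (κ * κ) {{m*n≢0 κ κ}})))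
    choose (suc b) s²≤n n<[1+s]² (inj₂ (w , e)) = b ,
      <-≤-trans (*-mono-< (n<1+n b) (n<1+n b)) s²≤n , n<[1+s]² ,
      (ℤ.1ℤ ℤ.+ w , ≡-by (eq0 e ℤ.1ℤ) (identity (+ b) (+ κ) w))
      where
      identity : ∀ b κ w → ℤ.1ℤ ℤ.* (ℤ.1ℤ ℤ.+ b ℤ.- κ ℤ.- (ℤ.1ℤ ℤ.+ + 2 ℤ.* w)) ≡ + 2 ℤ.+ b ℤ.- (κ ℤ.+ + 2 ℤ.* (ℤ.1ℤ ℤ.+ w))
      identity = ℤ-Solver.solve-∀

  residue : ∀ {n k} → n % 4 ≡ k → ∃[ n₁ ] + n ≡ + k ℤ.+ + 4 ℤ.* n₁
  residue {n} {k} e = + (n ℕ./ 4) , trans (cong (+_) (trans (m≡m%n+[m/n]*n n 4)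
    (trans (cong (_+ n ℕ./ 4 * 4) e) (cong (λ z → k + z) (*-comm (n ℕ./ 4) 4)))))
    (cong (λ z → + k ℤ.+ z) (ℤ.pos-* 4 (n ℕ./ 4)))

  congruent⇒%2≡ : ∀ {x y} → Congruent₂ (+ x) (+ y) → x % 2 ≡ y % 2
  congruent⇒%2≡ {x} {y} x≡y = cases (remainder x) (remainder y)
    where
    remainder : ∀ n → (n % 2 ≡ 0 × Even (+ n)) ⊎ (n % 2 ≡ 1 × Odd (+ n))
    remainder 0             = inj₁ (refl , ℤ.0ℤ , refl)
    remainder 1             = inj₂ (refl , ℤ.0ℤ , refl)
    remainder (suc (suc n)) = step (remainder n)
      where
      even-step : ∀ w → + 2 ℤ.+ + 2 ℤ.* w ≡ + 2 ℤ.* (ℤ.1ℤ ℤ.+ w)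
      even-step = ℤ-Solver.solve-∀
      odd-step : ∀ w → + 2 ℤ.+ (ℤ.1ℤ ℤ.+ + 2 ℤ.* w) ≡ ℤ.1ℤ ℤ.+ + 2 ℤ.* (ℤ.1ℤ ℤ.+ w)
      odd-step = ℤ-Solver.solve-∀
      step : (n % 2 ≡ 0 × Even (+ n)) ⊎ (n % 2 ≡ 1 × Odd (+ n)) →
             (n % 2 ≡ 0 × Even (+ (2 + n))) ⊎ (n % 2 ≡ 1 × Odd (+ (2 + n)))
      step (inj₁ (e , w , e′)) = inj₁ (e , ℤ.1ℤ ℤ.+ w , trans (cong (λ z → + 2 ℤ.+ z) e′) (even-step w))
      step (inj₂ (e , w , e′)) = inj₂ (e , ℤ.1ℤ ℤ.+ w , trans (cong (λ z → + 2 ℤ.+ z) e′) (odd-step w))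
    cases : (x % 2 ≡ 0 × Even (+ x)) ⊎ (x % 2 ≡ 1 × Odd (+ x)) → (y % 2 ≡ 0 × Even (+ y)) ⊎ (y % 2 ≡ 1 × Odd (+ y)) → x % 2 ≡ y % 2
    cases (inj₁ (e , _))     (inj₁ (e′ , _))     = trans e (sym e′)
    cases (inj₂ (e , _))     (inj₂ (e′ , _))     = trans e (sym e′)
    cases (inj₁ (_ , even))  (inj₂ (_ , odd))    = ⊥-elim (¬both (congruent-even (congruent-sym x≡y) even) odd)
    cases (inj₂ (_ , odd))   (inj₁ (_ , even))   = ⊥-elim (¬both even (congruent-odd (congruent-sym x≡y) odd))

-- The Cauchy-Schwarz inequality for the A and C

module CauchySchwarz where
  open IntegerOrder
  open import Data.Integer
  open import Data.List using ([]; _∷_)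
  open import Data.Integer.Tactic.RingSolver using (solve)
  open import Relation.Binary.PropositionalEquality

  -- The form at (N, -mκ) is N times N·ΣA² - (mκ)², so (mκ)² ≤ N·ΣA². The trace bounds ΣA² by 2m(b +
  -- 2) - qN, the other two terms being nonnegative.
  cauchy-schwarz : ∀ {m κ p q r b SA SAC SB N SD} →
    0ℤ < N → 0ℤ ≤ p → 0ℤ ≤ SB → 0ℤ ≤ r → 0ℤ ≤ SD →
    (∀ s t → 0ℤ ≤ s * s * SA + + 2 * (s * t) * SAC + t * t * N) →
    SAC ≡ m * κ → SA + p * SB + q * N + r * SD ≡ + 2 * m * (b + + 2) →
    m * κ * (m * κ) + q * (N * N) ≤ + 2 * m * N * (b + + 2)
  cauchy-schwarz {m} {κ} {p} {q} {r} {b} {SA} {SAC} {SB} {N} {SD} 0<N 0≤p 0≤SB 0≤r 0≤SD psd SAC≡W trace =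
    *-cancelˡ {N} 0<N N*≤
    where
    N*≤ : N * (m * κ * (m * κ) + q * (N * N)) ≤ N * (+ 2 * m * N * (b + + 2))
    N*≤ = by (psd N (- (m * κ)) ⊕ eq SAC≡W (+ 2 * N * (m * κ)) ⊕ eq trace (- (N * N))
               ⊕ sq N ⊗ (0≤p ⊗ 0≤SB) ⊕ sq N ⊗ (0≤r ⊗ 0≤SD))
      (solve (m ∷ κ ∷ p ∷ q ∷ r ∷ b ∷ SA ∷ SAC ∷ SB ∷ N ∷ SD ∷ []))

-- The multiple mα is not a sum of squares

module NotSumOfSquares where
  open import Defs
  open ℚRing
  open RationalIntegers
  open Representation hiding (_⟨+⟩_)
  open ParityDescent using (Congruent₂)
  open ResidueCases
  open Choices
  open GramEntries
  open CauchySchwarz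
  open IntegerOrder using (lit)
  open Casts using (≤ℤ; <ℤ) renaming ([_] to [_]ᶜ; _⟨*⟩_ to _*ᶜ_; _⟨+⟩_ to _+ᶜ_)
  open TraceBound using (√r-coordinates-vanish)
  open I₃Gap using (√q∉I₃)
  open import Data.Integer as ℤ using (ℤ; +_; 0ℤ; 1ℤ; ∣_∣)
  import Data.Integer.Properties as ℤ
  open import Data.Nat hiding (_/_; parity; ∣_-_∣)
  open import Data.Nat.Coprimality using (Coprime)
  open import Data.Nat.DivMod using (_%_)
  open import Data.Nat.Properties
  open import Data.Nat.Tactic.RingSolver using (solve-∀)
  open import Data.Empty using (⊥)
  open import Data.Product using (_,_; proj₁; proj₂)
  open import Data.Rational as ℚ using (ℚ; _/_; ½; 0ℚ)
  open import Data.Sum using (_⊎_; inj₁; inj₂)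
  open import Relation.Binary.PropositionalEquality
  open import Relation.Nullary using (¬_)
  import Tactic.RingSolver as RingSolver

  square-cancel-< : ∀ {x y} → x * x < y * y → x < y
  square-cancel-< {x} {y} h = ≰⇒> λ y≤x → <⇒≱ h (*-mono-≤ y≤x y≤x)

  descent : ∀ {g p′ q′ p q r} → p ≡ g * p′ → q ≡ g * q′ → r ≡ p′ * q′ →
            (p % 4 ≡ 2) ⊎ (p % 4 ≡ 3) → q % 4 ≡ 1 → Descent (+ p) (+ q) (+ r) (+ p′)
  descent {g} {p′} {q′} {p} {q} {r} p≡ q≡ r≡ p%4 q%4 = cases p%4
    where
    pᶻ : + p ≡ + g ℤ.* + p′
    pᶻ = trans (cong (+_) p≡) (ℤ.pos-* g p′)
    qᶻ : + q ≡ + g ℤ.* + q′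
    qᶻ = trans (cong (+_) q≡) (ℤ.pos-* g q′)
    rᶻ : + r ≡ + p′ ℤ.* + q′
    rᶻ = trans (cong (+_) r≡) (ℤ.pos-* p′ q′)
    transport : Descent (+ g ℤ.* + p′) (+ g ℤ.* + q′) (+ p′ ℤ.* + q′) (+ p′) → Descent (+ p) (+ q) (+ r) (+ p′)
    transport D = subst (λ p → Descent p (+ q) (+ r) (+ p′)) (sym pᶻ) (subst₂ (λ q r → Descent (+ g ℤ.* + p′) q r (+ p′)) (sym qᶻ) (sym rᶻ) D)
    cases : (p % 4 ≡ 2) ⊎ (p % 4 ≡ 3) → Descent (+ p) (+ q) (+ r) (+ p′)
    cases (inj₁ p≡2) = let p₁ , hp = residue {p} {2} p≡2 ; q₁ , hq = residue {q} {1} q%4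
      in transport (descent-p≡2 {+ g} {+ p′} {+ q′} {p₁} {q₁} (trans (sym pᶻ) hp) (trans (sym qᶻ) hq))
    cases (inj₂ p≡3) = let p₁ , hp = residue {p} {3} p≡3 ; q₁ , hq = residue {q} {1} q%4
      in transport (descent-p≡3 {+ g} {+ p′} {+ q′} {p₁} {q₁} (trans (sym pᶻ) hp) (trans (sym qᶻ) hq))

  module _ {p q r g p′ q′ m κ t b c : ℕ}
    .{{_ : NonZero m}} .{{_ : NonZero κ}} .{{_ : NonZero t}} .{{_ : NonZero q}} .{{_ : NonZero g}}
    (p-sf : SquareFree p) (q-sf : SquareFree q)
    (p%4 : (p % 4 ≡ 2) ⊎ (p % 4 ≡ 3)) (q%4 : q % 4 ≡ 1)
    (p≡ : p ≡ g * p′) (q≡ : q ≡ g * q′) (r≡ : r ≡ p′ * q′) (p′⊥q′ : Coprime p′ q′)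
    (q<r : q < r) (κ²r≤c² : κ * κ * r ≤ c * c) (2mc≤r : 2 * m * c ≤ r) (m≤p : m ≤ p) (2m≤q : 2 * m ≤ q)
    (mκ≡t : (m * κ) % 2 ≡ t % 2) (√q∈I₃ : √ q ∈ᴵ I₃ m κ t)
    (b²<κ²q : b * b < κ * κ * q) (κ²q<[b+2]² : κ * κ * q < (2 + b) * (2 + b)) (b+2≡κ : Congruent₂ (+ (2 + b)) (+ κ))
    where

    open Biquadratic p q
    open Witness p q (suc b) κ
    open SumsOfSquares p q g p′ q′ r
    open IntegralElements p q using (fromRational-*)
    open IntegerCoordinates p q using (coordinates)

    private
      q₁ : ℤ
      q₁ = proj₁ (residue {q} {1} q%4)

      hq : + q ≡ 1ℤ ℤ.+ + 4 ℤ.* q₁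
      hq = proj₂ (residue {q} {1} q%4)

      homo : ∀ a b → fromℕ (a * b) ≡ fromℕ a ℚ.* fromℕ b
      homo a b = trans (cong fromℤ (ℤ.pos-* a b)) (fromℤ-* (+ a) (+ b))

      -- The squared form of b < κ√q < κ√r ≤ c.
      b+2≤c+1 : b + 2 ≤ c + 1
      b+2≤c+1 = subst₂ _≤_ (+-comm 2 b) (+-comm 1 c) (s≤s (square-cancel-< {b} {c}
        (<-≤-trans b²<κ²q (≤-trans (*-monoʳ-≤ (κ * κ) (<⇒≤ q<r)) κ²r≤c²))))

      g<p′ : g < p′
      g<p′ = *-cancelʳ-< q′ g p′ (subst₂ _<_ q≡ r≡ q<r)

    α-multiple-not-sum : ¬ IsSumOfSquares (fromRational (fromℕ m) *ᴷ α)
    α-multiple-not-sum (xs , xs∈𝒪 , mα≡Σ) = contra (subst Summary (trans (sym mα≡Σ) (fromRational-* (fromℕ m) α))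
      (summary (trans (cong fromℕ p≡) (homo g p′)) (trans (cong fromℕ q≡) (homo g q′)) (trans (cong fromℕ r≡) (homo p′ q′))
        (coordinates {g} {p′} {q′} {r} p-sf q-sf p≡ q≡ r≡ p′⊥q′ {q₁} hq (descent {g} {p′} {q′} p≡ q≡ r≡ p%4 q%4)) xs∈𝒪))
      where
      contra : ¬ Summary ⟨ fromℕ m ℚ.* (½ ℚ.* fromℕ a) , fromℕ m ℚ.* 0ℚ , fromℕ m ℚ.* (½ ℚ.* fromℕ κ) , fromℕ m ℚ.* 0ℚ ⟩
      contra S = √q∉I₃ {m} {κ} {q} {b} {n} E′ b²<κ²q′ n≡t √q∈I₃
        where
        open Summary S
        module AC = Gram gram-AC
        module BD = Gram gram-BD
        trace′ : SA ℤ.+ + p ℤ.* SB ℤ.+ + q ℤ.* SC ℤ.+ + r ℤ.* SD ≡ + 2 ℤ.* + m ℤ.* (+ b ℤ.+ + 2)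
        trace′ = ↝-injective trace (⟦ + 2 ⟧ ⟨*⟩ ⟦ + m ⟧ ⟨*⟩ ⟦ + b ℤ.+ + 2 ⟧)
          (trans (quadruple (fromℕ m) (fromℕ a)) (cong (λ a → fromℤ (+ 2) ℚ.* fromℕ m ℚ.* fromℕ a) (+-comm 2 b)))
          where
          quadruple : ∀ m a → m ℚ.* (½ ℚ.* a) ℚ.+ m ℚ.* (½ ℚ.* a) ℚ.+ (m ℚ.* (½ ℚ.* a) ℚ.+ m ℚ.* (½ ℚ.* a)) ≡ fromℤ (+ 2) ℚ.* m ℚ.* a
          quadruple = RingSolver.solve-∀ ℚ-ring
        √q-sum′ : SAC ℤ.+ + p′ ℤ.* SBD ≡ + m ℤ.* + κ
        √q-sum′ = ↝-injective √q-sum (⟦ + m ⟧ ⟨*⟩ ⟦ + κ ⟧) (double (fromℕ m) (fromℕ κ))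
          where
          double : ∀ m k → m ℚ.* (½ ℚ.* k) ℚ.+ m ℚ.* (½ ℚ.* k) ≡ m ℚ.* k
          double = RingSolver.solve-∀ ℚ-ring
        pᶻ : + p ≡ + g ℤ.* + p′
        pᶻ = trans (cong (+_) p≡) (ℤ.pos-* g p′)
        qᶻ : + q ≡ + g ℤ.* + q′
        qᶻ = trans (cong (+_) q≡) (ℤ.pos-* g q′)
        rᶻ : + r ≡ + p′ ℤ.* + q′
        rᶻ = trans (cong (+_) r≡) (ℤ.pos-* p′ q′)
        b²<κ²q′ : + b ℤ.* + b ℤ.< + κ ℤ.* + κ ℤ.* + q
        b²<κ²q′ = <ℤ ([ b ]ᶜ *ᶜ [ b ]ᶜ) ([ κ ]ᶜ *ᶜ [ κ ]ᶜ *ᶜ [ q ]ᶜ) b²<κ²q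
        SD≡0 : SD ≡ 0ℤ
        SD≡0 = √r-coordinates-vanish {+ g} {+ p′} {+ q′} {+ m} {+ κ} {+ b} {+ c} {SA} {SB} {SC} {SD} {SAC} {SBD} {q₁}
          (ℤ.+≤+ (>-nonZero⁻¹ g)) (ℤ.+≤+ (>-nonZero⁻¹ m)) (ℤ.+≤+ (>-nonZero⁻¹ κ)) (lit b) (lit c)
          (ℤ.+<+ g<p′) (<ℤ qᶻ rᶻ q<r) (trans (sym qᶻ) hq)
          (≤ℤ refl pᶻ m≤p) (≤ℤ ([ 2 ]ᶜ *ᶜ [ m ]ᶜ) qᶻ 2m≤q) (≤ℤ ([ 2 ]ᶜ *ᶜ [ m ]ᶜ *ᶜ [ c ]ᶜ) rᶻ 2mc≤r)
          (subst (λ r → + κ ℤ.* + κ ℤ.* r ℤ.≤ + c ℤ.* + c) rᶻ (≤ℤ ([ κ ]ᶜ *ᶜ [ κ ]ᶜ *ᶜ [ r ]ᶜ) ([ c ]ᶜ *ᶜ [ c ]ᶜ) κ²r≤c²))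
          (subst (λ q → + b ℤ.* + b ℤ.< + κ ℤ.* + κ ℤ.* q) qᶻ b²<κ²q′)
          (ℤ.+≤+ b+2≤c+1) AC.xx≥0 BD.xx≥0 AC.yy≥0 BD.yy≥0 AC.yy≡0⇒xy≡0 BD.psd
          (subst (λ r → SA ℤ.+ + g ℤ.* + p′ ℤ.* SB ℤ.+ + g ℤ.* + q′ ℤ.* SC ℤ.+ r ℤ.* SD ≡ + 2 ℤ.* + m ℤ.* (+ b ℤ.+ + 2)) rᶻ
            (subst₂ (λ p q → SA ℤ.+ p ℤ.* SB ℤ.+ q ℤ.* SC ℤ.+ + r ℤ.* SD ≡ + 2 ℤ.* + m ℤ.* (+ b ℤ.+ + 2)) pᶻ qᶻ trace′))
          √q-sum′
        SAC≡W : SAC ≡ + m ℤ.* + κ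
        SAC≡W = trans (sym (trans (cong (λ x → SAC ℤ.+ + p′ ℤ.* x) (BD.yy≡0⇒xy≡0 SD≡0))
          (trans (cong (λ x → SAC ℤ.+ x) (ℤ.*-zeroʳ (+ p′))) (ℤ.+-identityʳ SAC)))) √q-sum′
        n = ∣ SC ∣
        n≡SC : + n ≡ SC
        n≡SC = ℤ.0≤i⇒+∣i∣≡i AC.yy≥0
        instance
         n≢0 : NonZero n
         -- If all C vanished, so would ΣAC, which equals mκ > 0.
         n≢0 = ≢-nonZero λ n≡0 → ≢-nonZero⁻¹ (m * κ) {{m*n≢0 m κ}} (ℤ.+-injective (trans (ℤ.pos-* m κ)
          (trans (sym SAC≡W) (AC.yy≡0⇒xy≡0 (trans (sym n≡SC) (cong (+_) n≡0))))))
        E : + m ℤ.* + κ ℤ.* (+ m ℤ.* + κ) ℤ.+ + q ℤ.* (SC ℤ.* SC) ℤ.≤ + 2 ℤ.* + m ℤ.* SC ℤ.* (+ b ℤ.+ + 2)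
        E = cauchy-schwarz {+ m} {+ κ} {+ p} {+ q} {+ r} {+ b} {SA} {SAC} {SB} {SC} {SD}
          (subst (0ℤ ℤ.<_) n≡SC (ℤ.+<+ (>-nonZero⁻¹ n {{n≢0}}))) (lit p) BD.xx≥0 (lit r) BD.yy≥0 AC.psd SAC≡W trace′
        E′ : + m ℤ.* + κ ℤ.* (+ m ℤ.* + κ) ℤ.+ + q ℤ.* (+ n ℤ.* + n) ℤ.≤ + 2 ℤ.* + m ℤ.* + n ℤ.* (+ b ℤ.+ + 2)
        E′ = subst (λ N → + m ℤ.* + κ ℤ.* (+ m ℤ.* + κ) ℤ.+ + q ℤ.* (N ℤ.* N) ℤ.≤ + 2 ℤ.* + m ℤ.* N ℤ.* (+ b ℤ.+ + 2)) (sym n≡SC) E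
        n≡t : n % 2 ≡ t % 2
        n≡t = trans (sym (congruent⇒%2≡ {m * κ} {n}
          (subst₂ Congruent₂ (trans SAC≡W (sym (ℤ.pos-* m κ))) (sym n≡SC) SAC≡SC))) mκ≡t

    not-all-sums : ¬ (∀ x → x ∈𝒪⁺ → IsSumOfSquares (fromRational (fromℕ m) *ᴷ x))
    not-all-sums all = α-multiple-not-sum (all α (α∈𝒪 {q₁} hq b+2≡κ , α-totallyPositive κ²q<[b+2]²))

-- Non-emptiness of the intervals

module NonEmptyIntervals where
  open import Defs
  open Fractions
  open Reals
  open RealBounds using (≤-⇒-≤)
  open import Data.Integer using (+_)
  open import Data.Nat hiding (_/_)
  open import Data.Nat.Properties
  open import Data.Nat.Tactic.RingSolver using (solve-∀)
  open import Data.Product using (_,_; proj₁)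
  open import Data.Rational as ℚ using (_/_)
  import Data.Rational.Properties as ℚ
  open import Relation.Binary.PropositionalEquality

  ≤ᴿ-refl : ∀ {x} → x ≤ᴿ x
  ≤ᴿ-refl {x} = ≤-pointwise {x} {x} λ _ → ℚ.≤-refl

  -- Replacing √(t(t - 1)) by a rational X/Y below it turns the hypothesis on m into integer
  -- inequalities, one for each such X/Y. The right X/Y is supplied later.
  large-m : ∀ {m κ t} .{{_ : NonZero κ}} →
    _/_ (+ (8 * t * (t ∸ 1))) (κ ^ 2) {{m^n≢0 κ 2}} ·ᴿ (const (fromℕ (2 * t ∸ 1)) +ᴿ fromℕ 2 ·ᴿ √ (t * (t ∸ 1))) ≤ᴿ const (fromℕ m) →
    ∀ X Y .{{_ : NonZero Y}} → X * X ≤ t * (t ∸ 1) * (Y * Y) →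
    8 * t * (t ∸ 1) * ((2 * t ∸ 1) * Y + 2 * X) ≤ m * (κ * κ) * Y
  large-m {m} {κ} {t} h X Y X²≤ = subst₂ _≤_ (lhs (8 * t * (t ∸ 1)) (2 * t ∸ 1) X Y) (trans (rhs m (κ ^ 2) Y) (cong (λ s → m * s * Y) (cong (κ *_) (*-identityʳ κ))))
    (/-cancel-≤ {8 * t * (t ∸ 1) * ((2 * t ∸ 1) * (1 * Y) + 2 * X * 1)} {κ ^ 2 * (1 * (1 * Y))} {m} {1}
      (subst (ℚ._≤ fromℕ m) fraction (const-cancel-≤ (≤ᴿ-trans {c} {A ·ᴿ z′} {const (fromℕ m)}
        (≤-pointwise {c} {A ·ᴿ z′} λ _ → ℚ.≤-refl)
        (≤ᴿ-trans {A ·ᴿ z′} {A ·ᴿ z} {const (fromℕ m)}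
          (·ᴿ-monoʳ-≤ (8 * t * (t ∸ 1)) (κ ^ 2) {z′} {z} (+ᴿ-monoʳ-≤ (const (fromℕ (2 * t ∸ 1))) {fromℕ 2 ·ᴿ const (+ X / Y)} {fromℕ 2 ·ᴿ √ (t * (t ∸ 1))}
            (·ᴿ-monoʳ-≤ 2 1 {const (+ X / Y)} {√ (t * (t ∸ 1))} (const≤√ {X} {Y} {t * (t ∸ 1)} {1}
              (≤-trans (≤-reflexive (*-identityʳ (X * X))) X²≤))))) h)))))
    where
    instance
      κ²≢0 : NonZero (κ ^ 2)
      κ²≢0 = m^n≢0 κ 2
      1Y≢0 : NonZero (1 * Y)
      1Y≢0 = m*n≢0 1 Y
      11Y≢0 : NonZero (1 * (1 * Y))
      11Y≢0 = m*n≢0 1 (1 * Y)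
      κ²11Y≢0 : NonZero (κ ^ 2 * (1 * (1 * Y)))
      κ²11Y≢0 = m*n≢0 (κ ^ 2) (1 * (1 * Y))
    A  = + (8 * t * (t ∸ 1)) / (κ ^ 2)
    z  = const (fromℕ (2 * t ∸ 1)) +ᴿ fromℕ 2 ·ᴿ √ (t * (t ∸ 1))
    z′ = const (fromℕ (2 * t ∸ 1)) +ᴿ fromℕ 2 ·ᴿ const (+ X / Y)
    c  = const (A ℚ.* (fromℕ (2 * t ∸ 1) ℚ.+ fromℕ 2 ℚ.* (+ X / Y)))
    fraction : A ℚ.* (fromℕ (2 * t ∸ 1) ℚ.+ fromℕ 2 ℚ.* (+ X / Y)) ≡
      + (8 * t * (t ∸ 1) * ((2 * t ∸ 1) * (1 * Y) + 2 * X * 1)) / (κ ^ 2 * (1 * (1 * Y)))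
    fraction = trans (cong (A ℚ.*_) (trans (cong (fromℕ (2 * t ∸ 1) ℚ.+_) (*-/ 2 1 X Y)) (+-/ (2 * t ∸ 1) 1 (2 * X) (1 * Y))))
      (*-/ (8 * t * (t ∸ 1)) (κ ^ 2) ((2 * t ∸ 1) * (1 * Y) + 2 * X * 1) (1 * (1 * Y)))
    lhs : ∀ a b X Y → a * (b * (1 * Y) + 2 * X * 1) * 1 ≡ a * (b * Y + 2 * X)
    lhs = solve-∀
    rhs : ∀ m s Y → m * (s * (1 * (1 * Y))) ≡ m * s * Y
    rhs = solve-∀

  module _ {m κ : ℕ} .{{_ : NonZero m}} .{{_ : NonZero κ}} where

    -- The order of the end points times 4tsk, where `u` and `v` stand for k√(2mt) and k√(2ms)
    -- rounded down. After squaring, the mixed term uv remains; uv/(2mk²) is a rational at most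
    -- √(ts), and taking it as X/Y makes the claim the bound on m.
    I₂-gap : ∀ {s u v k} .{{_ : NonZero s}} .{{_ : NonZero k}} → let t = suc s in
      (∀ X Y .{{_ : NonZero Y}} → X * X ≤ t * s * (Y * Y) → 8 * t * s * ((2 * t ∸ 1) * Y + 2 * X) ≤ m * (κ * κ) * Y) →
      u * u ≤ m * (2 * t) * (k * k) → v * v ≤ m * (2 * s) * (k * k) →
      2 * (s * u + t * v) ≤ m * κ * k
    I₂-gap {s} {u} {v} {k} h u²≤ v²≤ = square-cancel-≤ (begin
      2 * (s * u + t * v) * (2 * (s * u + t * v))                     ≡⟨ expand s t u v ⟩
      4 * (s * s * (u * u) + t * t * (v * v) + 2 * s * t * (u * v))   ≤⟨ *-monoʳ-≤ 4 (+-monoˡ-≤ (2 * s * t * (u * v))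
                                                                          (+-mono-≤ (*-monoʳ-≤ (s * s) u²≤) (*-monoʳ-≤ (t * t) v²≤))) ⟩
      4 * (s * s * (m * (2 * t) * (k * k)) + t * t * (m * (2 * s) * (k * k)) + 2 * s * t * (u * v)) ≡⟨ collect s t m k (u * v) ⟩
      8 * t * s * ((t + s) * (m * (k * k)) + u * v)                   ≤⟨ *-cancelˡ-≤ 2 (≤-trans (≤-reflexive (trans (double s t m k (u * v)) (cong (λ x → 8 * t * s * (x * (2 * (m * (k * k))) + 2 * (u * v))) (2t-1 s))))
                                                                          (≤-trans (h (u * v) (2 * (m * (k * k))) uv≤) (≤-reflexive (final m κ k)))) ⟩
      m * κ * k * (m * κ * k)                                         ∎)
      where
      open ≤-Reasoning
      t = suc s
      instance
        Y≢0 : NonZero (2 * (m * (k * k)))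
        Y≢0 = m*n≢0 2 (m * (k * k)) {{it}} {{m*n≢0 m (k * k) {{it}} {{m*n≢0 k k}}}}
          where open import Function using (it)
      uv≤ : u * v * (u * v) ≤ t * s * (2 * (m * (k * k)) * (2 * (m * (k * k))))
      uv≤ = ≤-trans (≤-reflexive (squares u v)) (≤-trans (*-mono-≤ u²≤ v²≤) (≤-reflexive (product s t m k)))
        where
        squares : ∀ u v → u * v * (u * v) ≡ u * u * (v * v)
        squares = solve-∀
        product : ∀ s t m k → m * (2 * t) * (k * k) * (m * (2 * s) * (k * k)) ≡ t * s * (2 * (m * (k * k)) * (2 * (m * (k * k))))
        product = solve-∀
      expand : ∀ s t u v → 2 * (s * u + t * v) * (2 * (s * u + t * v)) ≡ 4 * (s * s * (u * u) + t * t * (v * v) + 2 * s * t * (u * v))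
      expand = solve-∀
      collect : ∀ s t m k x → 4 * (s * s * (m * (2 * t) * (k * k)) + t * t * (m * (2 * s) * (k * k)) + 2 * s * t * x) ≡
        8 * t * s * ((t + s) * (m * (k * k)) + x)
      collect = solve-∀
      double : ∀ s t m k x → 2 * (8 * t * s * ((t + s) * (m * (k * k)) + x)) ≡ 8 * t * s * ((t + s) * (2 * (m * (k * k))) + 2 * x)
      double = solve-∀
      2t-1 : ∀ s → suc s + s ≡ 2 * suc s ∸ 1
      2t-1 s = trans (+-comm (suc s) s) (cong (λ z → s + z) (sym (+-identityʳ (suc s))))
      final : ∀ m κ k → m * (κ * κ) * (2 * (m * (k * k))) ≡ 2 * (m * κ * k * (m * κ * k))
      final = solve-∀

    -- Here s = t - 2, and `u`, `v` stand for k√(mt) and k√(ms). Squaring leaves ts((s + t)mk² +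
    -- 2uv), which the bound on m covers generously: it has an extra factor 8, t - 1 for s, and 2t -
    -- 1 for s + t.
    I₃-gap : ∀ {s u v k} .{{_ : NonZero s}} .{{_ : NonZero k}} → let t = suc (suc s) in
      (∀ X Y .{{_ : NonZero Y}} → X * X ≤ t * suc s * (Y * Y) → 8 * t * suc s * ((2 * t ∸ 1) * Y + 2 * X) ≤ m * (κ * κ) * Y) →
      u * u ≤ m * t * (k * k) → v * v ≤ m * s * (k * k) →
      s * u + t * v ≤ m * κ * k
    I₃-gap {s} {u} {v} {k} h u²≤ v²≤ = square-cancel-≤ (begin
      (s * u + t * v) * (s * u + t * v)                               ≡⟨ expand s t u v ⟩
      s * s * (u * u) + t * t * (v * v) + 2 * s * t * (u * v)         ≤⟨ +-monoˡ-≤ (2 * s * t * (u * v))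
                                                                          (+-mono-≤ (*-monoʳ-≤ (s * s) u²≤) (*-monoʳ-≤ (t * t) v²≤)) ⟩
      s * s * (m * t * (k * k)) + t * t * (m * s * (k * k)) + 2 * s * t * (u * v) ≡⟨ collect s t m k (u * v) ⟩
      t * s * ((s + t) * Y + 2 * (u * v))                             ≤⟨ *-mono-≤ (*-mono-≤ (m≤n*m t 8) (n≤1+n s))
                                                                          (+-monoˡ-≤ (2 * (u * v)) (*-monoˡ-≤ Y s+t≤2t-1)) ⟩
      8 * t * suc s * ((2 * t ∸ 1) * Y + 2 * (u * v))                 ≤⟨ h (u * v) Y uv≤ ⟩
      m * (κ * κ) * Y                                                 ≡⟨ final m κ k ⟩
      m * κ * k * (m * κ * k)                                         ∎)
      where
      open ≤-Reasoning
      t = suc (suc s)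
      Y = m * (k * k)
      instance
        Y≢0 : NonZero Y
        Y≢0 = m*n≢0 m (k * k) {{it}} {{m*n≢0 k k}}
          where open import Function using (it)
      s+t≤2t-1 : s + t ≤ 2 * t ∸ 1
      s+t≤2t-1 = +-mono-≤ (n≤1+n s) (≤-reflexive (sym (+-identityʳ t)))
      uv≤ : u * v * (u * v) ≤ t * suc s * (Y * Y)
      uv≤ = ≤-trans (≤-reflexive (squares u v)) (≤-trans (*-mono-≤ u²≤ v²≤)
        (≤-trans (≤-reflexive (product s t m k)) (*-monoˡ-≤ (Y * Y) (*-monoʳ-≤ t (n≤1+n s)))))
        where
        squares : ∀ u v → u * v * (u * v) ≡ u * u * (v * v)
        squares = solve-∀
        product : ∀ s t m k → m * t * (k * k) * (m * s * (k * k)) ≡ t * s * (m * (k * k) * (m * (k * k)))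
        product = solve-∀
      expand : ∀ s t u v → (s * u + t * v) * (s * u + t * v) ≡ s * s * (u * u) + t * t * (v * v) + 2 * s * t * (u * v)
      expand = solve-∀
      collect : ∀ s t m k x → s * s * (m * t * (k * k)) + t * t * (m * s * (k * k)) + 2 * s * t * x ≡
        t * s * ((s + t) * (m * (k * k)) + 2 * x)
      collect = solve-∀
      final : ∀ m κ k → m * (κ * κ) * (m * (k * k)) ≡ m * κ * k * (m * κ * k)
      final = solve-∀

    I₂-nonEmpty : ∀ t .{{_ : NonZero t}} →
      _/_ (+ (8 * t * (t ∸ 1))) (κ ^ 2) {{m^n≢0 κ 2}} ·ᴿ (const (fromℕ (2 * t ∸ 1)) +ᴿ fromℕ 2 ·ᴿ √ (t * (t ∸ 1))) ≤ᴿ const (fromℕ m) →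
      NonEmpty (I₂ m κ t)
    I₂-nonEmpty 1 _ = l , ≤ᴿ-refl {l}
      where l = Interval.lower (I₂ m κ 1)
    -- The left end point is the witness. It stays below the right one at every index, because both
    -- approximated roots are rounded down and both only narrow the interval.
    I₂-nonEmpty (suc s@(suc _)) h = l , ≤ᴿ-refl {l} , ≤-pointwise {l} {u} pointwise
      where
      t = suc s
      W = m * κ
      l = Interval.lower (I₂ m κ t)
      u = const (+ W / (4 * s)) -ᴿ √[ m / 2 * s ]
      pointwise : ∀ n → seq l n ℚ.≤ seq u n
      pointwise n = ≤-⇒-≤ (subst (ℚ._≤ + W / (4 * s)) (sym fraction)
        (/-mono-≤ {(W * (2 * t * k) + x * (4 * t)) * (2 * s * k) + y * (4 * t * (2 * t * k))}
                  {4 * t * (2 * t * k) * (2 * s * k)} {W} {4 * s} (begin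
          ((W * (2 * t * k) + x * (4 * t)) * (2 * s * k) + y * (4 * t * (2 * t * k))) * (4 * s)  ≡⟨ lhs s t k W x y ⟩
          16 * t * s * k * (s * W * k + 2 * (s * x + t * y))  ≤⟨ *-monoʳ-≤ (16 * t * s * k) (+-monoʳ-≤ (s * W * k)
                                                                   (I₂-gap {s} {x} {y} {k} (large-m {m} {κ} {t} h) (proj₁ (⌊√⌋-spec (m * (2 * t) * (k * k)))) (proj₁ (⌊√⌋-spec (m * (2 * s) * (k * k)))))) ⟩
          16 * t * s * k * (s * W * k + W * k)                ≡⟨ rhs s k W ⟩
          W * (4 * t * (2 * t * k) * (2 * s * k))             ∎)))
        where
        open ≤-Reasoning
        k = suc n
        x = ⌊√ m * (2 * t) * (k * k) ⌋
        y = ⌊√ m * (2 * s) * (k * k) ⌋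
        fraction : + W / (4 * t) ℚ.+ + x / (2 * t * k) ℚ.+ + y / (2 * s * k) ≡
          + ((W * (2 * t * k) + x * (4 * t)) * (2 * s * k) + y * (4 * t * (2 * t * k))) / (4 * t * (2 * t * k) * (2 * s * k))
        fraction = trans (cong (ℚ._+ + y / (2 * s * k)) (+-/ W (4 * t) x (2 * t * k)))
          (+-/ (W * (2 * t * k) + x * (4 * t)) (4 * t * (2 * t * k)) y (2 * s * k))
        lhs : ∀ s t k W x y → ((W * (2 * t * k) + x * (4 * t)) * (2 * s * k) + y * (4 * t * (2 * t * k))) * (4 * s) ≡
          16 * t * s * k * (s * W * k + 2 * (s * x + t * y))
        lhs = solve-∀
        rhs : ∀ s k W → 16 * suc s * s * k * (s * W * k + W * k) ≡ W * (4 * suc s * (2 * suc s * k) * (2 * s * k))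
        rhs = solve-∀

    I₃-nonEmpty : ∀ t .{{_ : NonZero t}} →
      _/_ (+ (8 * t * (t ∸ 1))) (κ ^ 2) {{m^n≢0 κ 2}} ·ᴿ (const (fromℕ (2 * t ∸ 1)) +ᴿ fromℕ 2 ·ᴿ √ (t * (t ∸ 1))) ≤ᴿ const (fromℕ m) →
      NonEmpty (I₃ m κ t)
    I₃-nonEmpty 1 _ = l , ≤ᴿ-refl {l}
      where l = Interval.lower (I₃ m κ 1)
    I₃-nonEmpty 2 _ = l , ≤ᴿ-refl {l}
      where l = Interval.lower (I₃ m κ 2)
    I₃-nonEmpty (suc (suc s@(suc _))) h = l , ≤ᴿ-refl {l} , ≤-pointwise {l} {u} pointwise
      where
      t = suc (suc s)
      W = m * κ
      l = Interval.lower (I₃ m κ t)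
      u = const (+ W / s) -ᴿ fromℕ 2 ·ᴿ √[ m / s ]
      pointwise : ∀ n → seq l n ℚ.≤ seq u n
      pointwise n = ≤-⇒-≤ (subst (ℚ._≤ + W / s) (sym fraction)
        (/-mono-≤ {(W * (1 * (t * k)) + 2 * x * t) * (1 * (s * k)) + 2 * y * (t * (1 * (t * k)))}
                  {t * (1 * (t * k)) * (1 * (s * k))} {W} {s} (begin
          ((W * (1 * (t * k)) + 2 * x * t) * (1 * (s * k)) + 2 * y * (t * (1 * (t * k)))) * s  ≡⟨ lhs s t k W x y ⟩
          t * s * k * (s * W * k + 2 * (s * x + t * y))       ≤⟨ *-monoʳ-≤ (t * s * k) (+-monoʳ-≤ (s * W * k) (*-monoʳ-≤ 2
                                                                   (I₃-gap {s} {x} {y} {k} (large-m {m} {κ} {t} h) (proj₁ (⌊√⌋-spec (m * t * (k * k)))) (proj₁ (⌊√⌋-spec (m * s * (k * k))))))) ⟩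
          t * s * k * (s * W * k + 2 * (W * k))               ≡⟨ rhs s k W ⟩
          W * (t * (1 * (t * k)) * (1 * (s * k)))             ∎)))
        where
        open ≤-Reasoning
        k = suc n
        x = ⌊√ m * t * (k * k) ⌋
        y = ⌊√ m * s * (k * k) ⌋
        fraction : + W / t ℚ.+ fromℕ 2 ℚ.* (+ x / (t * k)) ℚ.+ fromℕ 2 ℚ.* (+ y / (s * k)) ≡
          + ((W * (1 * (t * k)) + 2 * x * t) * (1 * (s * k)) + 2 * y * (t * (1 * (t * k)))) / (t * (1 * (t * k)) * (1 * (s * k)))
        fraction = trans (cong₂ (λ a b → + W / t ℚ.+ a ℚ.+ b) (*-/ 2 1 x (t * k)) (*-/ 2 1 y (s * k)))
          (trans (cong (ℚ._+ + (2 * y) / (1 * (s * k))) (+-/ W t (2 * x) (1 * (t * k))))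
            (+-/ (W * (1 * (t * k)) + 2 * x * t) (t * (1 * (t * k))) (2 * y) (1 * (s * k))))
        lhs : ∀ s t k W x y → ((W * (1 * (t * k)) + 2 * x * t) * (1 * (s * k)) + 2 * y * (t * (1 * (t * k)))) * s ≡
          t * s * k * (s * W * k + 2 * (s * x + t * y))
        lhs = solve-∀
        rhs : ∀ s k W → suc (suc s) * s * k * (s * W * k + 2 * (W * k)) ≡ W * (suc (suc s) * (1 * (suc (suc s) * k)) * (1 * (s * k)))
        rhs = solve-∀

-- From the hypotheses of the theorem to integer data

module Reduction where
  open import Defs
  open Fractions using (/-cancel-≤)
  open RealBounds using (·√≤const⇒)
  open Choices using (parity-floor)
  open NotSumOfSquares using (not-all-sums)
  open import Data.Integer using (+_)
  open import Data.Nat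
  open import Data.Nat.Coprimality using (coprime-/gcd)
  open import Data.Nat.DivMod using (_%_; m*[n/m]≡n)
  open import Data.Nat.GCD using (gcd; gcd[m,n]≢0; gcd[m,n]∣m; gcd[m,n]∣n)
  open import Data.Nat.Properties
  open import Data.Nat.Tactic.RingSolver using (solve-∀)
  open import Data.Product using (_,_)
  import Data.Rational as ℚ
  import Data.Rational.Properties as ℚ
  open import Data.Sum using (_⊎_; inj₂)
  open import Relation.Binary.PropositionalEquality
  open import Relation.Nullary using (¬_)

  not-all-sums-of-squares : ∀ {p q r m κ t c} .{{_ : NonZero m}} .{{_ : NonZero κ}} .{{_ : NonZero t}} .{{_ : NonZero c}} →
    2 ≤ q → SquareFree p → SquareFree q → (p % 4 ≡ 2) ⊎ (p % 4 ≡ 3) → q % 4 ≡ 1 →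
    r * gcd p q ^ 2 ≡ p * q → q < r → fromℕ κ ·ᴿ √ r ≤ᴿ const (fromℕ c) →
    fromℕ m ℚ.≤ ℚ._/_ (+ r) (2 * c) {{m*n≢0 2 c}} ℚ.⊓ fromℕ p ℚ.⊓ (+ q ℚ./ 2) →
    (m * κ) % 2 ≡ t % 2 → √ q ∈ᴵ I₃ m κ t →
    let open Biquadratic p q in ¬ (∀ α → α ∈𝒪⁺ → IsSumOfSquares (fromRational (fromℕ m) *ᴷ α))
  not-all-sums-of-squares {p} {q} {r} {m} {κ} {t} {c} 2≤q p-sf q-sf p%4 q%4 rg²≡pq q<r κ√r≤c m≤ mκ≡t √q∈I₃ =
    let b , b²<κ²q , κ²q<[b+2]² , b+2≡κ = parity-floor {q} {κ} q-sf 2≤q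
    in not-all-sums {p} {q} {r} {g} {p / g} {q / g} {m} {κ} {t} {b} {c} p-sf q-sf p%4 q%4
         p≡ q≡ r≡ (coprime-/gcd p q) q<r κ²r≤c² 2mc≤r m≤p 2m≤q mκ≡t √q∈I₃ b²<κ²q κ²q<[b+2]² b+2≡κ
    where
    g = gcd p q
    instance
      q≢0 : NonZero q
      q≢0 = >-nonZero (≤-trans (s≤s z≤n) 2≤q)
      g≢0 : NonZero g
      g≢0 = ≢-nonZero (gcd[m,n]≢0 p q (inj₂ (≢-nonZero⁻¹ q)))
      2c≢0 : NonZero (2 * c)
      2c≢0 = m*n≢0 2 c
    p≡ : p ≡ g * (p / g)
    p≡ = sym (m*[n/m]≡n (gcd[m,n]∣m p q))
    q≡ : q ≡ g * (q / g)
    q≡ = sym (m*[n/m]≡n (gcd[m,n]∣n p q))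
    r≡ : r ≡ p / g * (q / g)
    -- The equation r g² = pq avoids a quotient by g²; cancelling g² gives the product of the
    -- cofactors.
    r≡ = *-cancelʳ-≡ r (p / g * (q / g)) (g ^ 2) {{m^n≢0 g 2}}
      (trans rg²≡pq (trans (cong₂ _*_ p≡ q≡) (lemma g (p / g) (q / g))))
      where
      lemma : ∀ g p′ q′ → g * p′ * (g * q′) ≡ p′ * q′ * (g * (g * 1))
      lemma = solve-∀
    r/2c = + r ℚ./ (2 * c)
    m≤r/2c⊓p = ℚ.≤-trans m≤ (ℚ.p⊓q≤p (r/2c ℚ.⊓ fromℕ p) (+ q ℚ./ 2))
    2m≤q : 2 * m ≤ q
    2m≤q = subst₂ _≤_ (*-comm m 2) (*-identityʳ q)
      (/-cancel-≤ {m} {1} {q} {2} (ℚ.≤-trans m≤ (ℚ.p⊓q≤q (r/2c ℚ.⊓ fromℕ p) (+ q ℚ./ 2))))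
    m≤p : m ≤ p
    m≤p = subst₂ _≤_ (*-identityʳ m) (*-identityʳ p)
      (/-cancel-≤ {m} {1} {p} {1} (ℚ.≤-trans m≤r/2c⊓p (ℚ.p⊓q≤q r/2c (fromℕ p))))
    2mc≤r : 2 * m * c ≤ r
    2mc≤r = subst₂ _≤_ (trans (sym (*-assoc m 2 c)) (cong (_* c) (*-comm m 2))) (*-identityʳ r)
      (/-cancel-≤ {m} {1} {r} {2 * c} (ℚ.≤-trans m≤r/2c⊓p (ℚ.p⊓q≤p r/2c (fromℕ p))))
    κ²r≤c² : κ * κ * r ≤ c * c
    κ²r≤c² = subst (_≤ c * c) (*-identityʳ (κ * κ * r)) (·√≤const⇒ {κ} {c} {1} {r} κ√r≤c)

open import Defs
open import Data.Integer using (+_)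
open import Data.Nat using (NonZero; _+_; _*_; _^_; _∸_; _<_; _≤_)
open import Data.Nat.DivMod using (_%_)
open import Data.Nat.GCD using (gcd)
open import Data.Nat.Properties using (m*n≢0; m^n≢0)
open import Data.Product using (_×_; _,_)
open import Data.Rational using (_/_; _⊓_) renaming (_≤_ to _≤ℚ_)
open import Data.Sum using (_⊎_)
open import Relation.Binary.PropositionalEquality using (_≡_)
open import Relation.Nullary using (¬_)

proposition5p1 : (p q r : ℕ) →
    2 ≤ p → 2 ≤ q → SquareFree p → SquareFree q →
    (p % 4 ≡ 2) ⊎ (p % 4 ≡ 3) → q % 4 ≡ 1 →
    r * gcd p q ^ 2 ≡ p * q →
    p < q → q < r →
    (m κ t : ℕ) .{{_ : NonZero m}} .{{_ : NonZero κ}} .{{_ : NonZero t}} →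
    let open Biquadratic p q in
    ( (c : ℕ) .{{_ : NonZero c}} → IsCeiling (fromℕ κ ·ᴿ √ r) (+ c) →
    fromℕ m ≤ℚ _/_ (+ r) (2 * c) {{m*n≢0 2 c}} ⊓ fromℕ p ⊓ (+ q / 2) →
    (m * κ) % 2 ≡ t % 2 →
    √ p ∈ᴵ I₂ m κ t → √ q ∈ᴵ I₃ m κ t →
    ¬ (∀ α → α ∈𝒪⁺ → IsSumOfSquares (fromRational (fromℕ m) *ᴷ α)) )
    ×
    ( _/_ (+ (8 * t * (t ∸ 1))) (κ ^ 2) {{m^n≢0 κ 2}}
    ·ᴿ (const (fromℕ (2 * t ∸ 1)) +ᴿ fromℕ 2 ·ᴿ √ (t * (t ∸ 1)))
    ≤ᴿ const (fromℕ m) →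
    NonEmpty (I₂ m κ t) × NonEmpty (I₃ m κ t) )
proposition5p1 p q r _ 2≤q p-sf q-sf p%4 q%4 rg²≡pq _ q<r m κ t =
  (λ c (κ√r≤c , _) m≤ mκ≡t _ √q∈I₃ →
    Reduction.not-all-sums-of-squares 2≤q p-sf q-sf p%4 q%4 rg²≡pq q<r κ√r≤c m≤ mκ≡t √q∈I₃) ,
  λ m-large → NonEmptyIntervals.I₂-nonEmpty t m-large , NonEmptyIntervals.I₃-nonEmpty t m-large
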